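{- Let $G=(V,E)$ be a simple, undirected graph with $n=|V|$ vertices, $m=|E|$ edges, average degeneracy $\bar\delta$, and at least one triangle, and let $A\in\{0,1\}^{n\times n}$ be its adjacency matrix. Given $A$ as a sparse matrix, there is a linear algebraic algorithm that computes the triangle centrality $TC(v)$ for all vertices $v\in V$ in $O(m\bar\delta)$ time and $O(m+n)$ space.
   Context: $V$ is labeled $[n]=\{1,\dots,n\}$. For $v\in V$, $N(v)=\{u\mid (u,v)\in E\}$ and $d(v)=|N(v)|$. The average degeneracy of $G$ is $\bar\delta=\frac{1}{m}\sum_{(v,u)\in E}\min\{d(v),d(u)\}$ (sum over the $m$ undirected edges). A triangle is a complete subgraph on three vertices; $\triangle(v)$ is the number of triangles of $G$ containing $v$, and $\triangle(G)$ is the total number of triangles in $G$. The triangle neighborhood of $v$ is $N_\triangle(v)=\{u\in N(v)\mid N(u)\cap N(v)\neq\varnothing\}$, and $N_\triangle[v]=\{v\}\cup N_\triangle(v)$. The triangle centrality of $v$ is $$TC(v)=\frac{\frac13\sum_{u\in N_\triangle[v]}\triangle(u)+\sum_{w\in N(v)\setminus N_\triangle(v)}\triangle(w)}{\triangle(G)}.$$ The graph triangle matrix is $T=A^2\circ A$, where $\circ$ is the Hadamard (entrywise) product; $\check T$ is the $0/1$ matrix obtained from $T$ by replacing each non-zero entry by $1$; $I$ is the identity matrix and $\mathbf 1$ the all-ones vector. "Linear algebraic algorithm" means an algorithm that evaluates the vector $\mathbf r_{TC}=(TC(v))_{v\in V}$ through the matrix formulation $$\mathbf r_{TC}=\frac{(3A-2\check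 T+I)\,T\mathbf 1}{\mathbf 1^{\mathsf T}T\mathbf 1}.$$ A sparse matrix representation stores, and operations process, only non-zero entries. Time (including the construction of $T$) and space are for sequential algorithms in the standard unit-cost model. -}

module Defs where

open import Data.Bool using (if_then_else_)
open import Data.Fin using (Fin; zero; suc; toℕ; _<_; _<?_; _≟_)
open import Data.Fin.Properties using (any?)
open import Data.Integer as ℤ using (ℤ; +_; 0ℤ; 1ℤ)
open import Data.List using (List; []; _∷_; length; filter; map; lookup; allFin; cartesianProduct)
open import Data.List.Membership.Propositional using (_∈_)
open import Data.List.Relation.Unary.Unique.Propositional using (Unique)
open import Data.Nat as ℕ using (ℕ; zero; suc; _⊓_; _∸_)
open import Data.Nat.ListAction using (sum)
open import Data.Product using (Σ-syntax; ∃-syntax; _×_; _,_)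
open import Data.Rational as ℚ using (ℚ; 0ℚ)
open import Data.Vec.Functional using (Vector; updateAt)
open import Function using (const)
open import Function.Bundles using (_⇔_)
open import Level using (0ℓ)
open import Relation.Binary using (Rel; Decidable; Symmetric; Irreflexive)
open import Relation.Binary.PropositionalEquality using (_≡_; _≢_)
open import Relation.Nullary using (Dec; does; ¬?)
open import Relation.Nullary.Decidable using (_×-dec_; _⊎-dec_)
import Algebra.Properties.CommutativeMonoid.Sum
import Data.Integer.Properties as ℤₚ

open Algebra.Properties.CommutativeMonoid.Sum ℤₚ.+-0-commutativeMonoid
  using () renaming (sum to ∑)

fromℕ : ℕ → ℚ
fromℕ k = + k ℚ./ 1

infixl 7 _÷_

-- Division by zero is given the value 0; the statement only uses q ÷ k with k ≢ 0.
_÷_ : ℚ → ℕ → ℚ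
q ÷ zero  = 0ℚ
q ÷ suc k = q ℚ.* (1ℤ ℚ./ suc k)

------------------------------------------------------------------------
-- Graphs and triangle centrality

-- A simple undirected graph on the vertices 0, …, n - 1.
record Graph (n : ℕ) : Set₁ where
  infix 4 _~_ _~?_
  field
    _~_      : Rel (Fin n) 0ℓ
    _~?_     : Decidable _~_
    ~-sym    : Symmetric _~_
    ~-irrefl : Irreflexive _≡_ _~_

module _ {n : ℕ} (G : Graph n) where
  open Graph G

  N : Fin n → List (Fin n)
  N v = filter (λ u → u ~? v) (allFin n)

  d : Fin n → ℕ
  d v = length (N v)

  -- Each undirected edge is listed once, smaller endpoint first.
  edges : List (Fin n × Fin n)
  edges = filter (λ (u , v) → (u <? v) ×-dec (u ~? v))
                 (cartesianProduct (allFin n) (allFin n))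

  m : ℕ
  m = length edges

  δ̄ : ℚ
  δ̄ = fromℕ (sum (map (λ (u , v) → d u ⊓ d v) edges)) ÷ m

  -- Each triangle is listed once, as an increasing triple.
  triangles : List (Fin n × Fin n × Fin n)
  triangles =
    filter (λ (u , v , w) → (u <? v) ×-dec (v <? w)
                       ×-dec (u ~? v) ×-dec (v ~? w) ×-dec (u ~? w))
           (cartesianProduct (allFin n) (cartesianProduct (allFin n) (allFin n)))

  △G : ℕ
  △G = length triangles

  △ : Fin n → ℕ
  △ v = length (filter (λ (a , b , c) → (v ≟ a) ⊎-dec (v ≟ b) ⊎-dec (v ≟ c)) triangles)

  commonNeighbour? : ∀ u v → Dec (∃[ w ] (w ~ u × w ~ v))
  commonNeighbour? u v = any? (λ w → (w ~? u) ×-dec (w ~? v))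

  N△ : Fin n → List (Fin n)
  N△ v = filter (λ u → commonNeighbour? u v) (N v)

  N△[_] : Fin n → List (Fin n)
  N△[ v ] = v ∷ N△ v

  N∖N△ : Fin n → List (Fin n)
  N∖N△ v = filter (λ u → ¬? (commonNeighbour? u v)) (N v)

  TC : Fin n → ℚ
  TC v = ((+ 1 ℚ./ 3) ℚ.* fromℕ (sum (map △ N△[ v ])) ℚ.+ fromℕ (sum (map △ (N∖N△ v)))) ÷ △G

------------------------------------------------------------------------
-- The matrix formulation

Matrix : ℕ → Set
Matrix n = Fin n → Fin n → ℤ

infixl 7 _·_ _⊙_ _•_ _*ᵥ_ _∙ᵥ_
infixl 6 _⊞_ _⊟_

_·_ _⊙_ _⊞_ _⊟_ : ∀ {n} → Matrix n → Matrix n → Matrix n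
(M · L) i j = ∑ λ k → M i k ℤ.* L k j
(M ⊙ L) i j = M i j ℤ.* L i j
(M ⊞ L) i j = M i j ℤ.+ L i j
(M ⊟ L) i j = M i j ℤ.- L i j

_•_ : ∀ {n} → ℤ → Matrix n → Matrix n
(a • M) i j = a ℤ.* M i j

_*ᵥ_ : ∀ {n} → Matrix n → Vector ℤ n → Vector ℤ n
(M *ᵥ x) i = ∑ λ j → M i j ℤ.* x j

_∙ᵥ_ : ∀ {n} → Vector ℤ n → Vector ℤ n → ℤ
x ∙ᵥ y = ∑ λ i → x i ℤ.* y i

Id : ∀ {n} → Matrix n
Id i j = if does (i ≟ j) then 1ℤ else 0ℤ

𝟏 : ∀ {n} → Vector ℤ n
𝟏 = const 1ℤ

pattern01 : ∀ {n} → Matrix n → Matrix n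
pattern01 M i j = if does (M i j ℤ.≟ 0ℤ) then 0ℤ else 1ℤ

module _ {n : ℕ} (G : Graph n) where
  open Graph G

  A T Ť : Matrix n
  A u v = if does (u ~? v) then 1ℤ else 0ℤ
  T     = (A · A) ⊙ A
  Ť     = pattern01 T

  T𝟏 : Vector ℤ n
  T𝟏 = T *ᵥ 𝟏

  numerator : Vector ℤ n
  numerator = ((+ 3) • A ⊟ (+ 2) • Ť ⊞ Id) *ᵥ T𝟏

  denominator : ℤ
  denominator = 𝟏 ∙ᵥ T𝟏

------------------------------------------------------------------------
-- The machine: a sequential unit-cost RAM with R registers and K arrays,
-- programmed by structured commands.

data Op : Set where
  add monus mul : Op

⟦_⟧ : Op → ℕ → ℕ → ℕ
⟦ add   ⟧ = ℕ._+_
⟦ monus ⟧ = _∸_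
⟦ mul   ⟧ = ℕ._*_

data Expr (R K : ℕ) : Set where
  lit  : ℕ → Expr R K
  op   : Op → Fin R → Fin R → Expr R K
  load : Fin K → Fin R → Expr R K

infix  5 _≔_
infixr 4 _⨾_

data Cmd (R K : ℕ) : Set where
  skip          : Cmd R K
  _≔_           : Fin R → Expr R K → Cmd R K
  store         : Fin K → Fin R → Fin R → Cmd R K   -- store a i x  is  a[i] ≔ x
  _⨾_           : Cmd R K → Cmd R K → Cmd R K
  if≢0_then_else_ : Fin R → Cmd R K → Cmd R K → Cmd R K
  while≢0_loop_ : Fin R → Cmd R K → Cmd R K

record State (R K : ℕ) : Set where
  constructor state
  field
    reg : Fin R → ℕ
    arr : Fin K → ℕ → ℕ

open State public

setReg : ∀ {R K} → Fin R → ℕ → State R K → State R K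
setReg x w σ = record σ { reg = updateAt (reg σ) x (const w) }

setArr : ∀ {R K} → Fin K → ℕ → ℕ → State R K → State R K
setArr a i w σ =
  record σ { arr = updateAt (arr σ) a (λ f j → if does (j ℕ.≟ i) then w else f j) }

-- A command that would produce a word ≥ words, or access an array at an
-- index ≥ cells, is stuck: it has no run.
record Limits : Set where
  constructor limits
  field
    words : ℕ
    cells : ℕ

open Limits public

infix 3 _⊢_,_↦_ _⊢_,_⇓[_]_

data _⊢_,_↦_ {R K} (L : Limits) : Expr R K → State R K → ℕ → Set where
  ↦lit  : ∀ {σ k} → L ⊢ lit k , σ ↦ k
  ↦op   : ∀ {σ o x y} → L ⊢ op o x y , σ ↦ ⟦ o ⟧ (reg σ x) (reg σ y)
  ↦load : ∀ {σ a i} → reg σ i ℕ.< cells L → L ⊢ load a i , σ ↦ arr σ a (reg σ i)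

-- L ⊢ c , σ ⇓[ t ] σ′ : started in σ, command c halts in σ′ after t steps.
data _⊢_,_⇓[_]_ {R K} (L : Limits) : Cmd R K → State R K → ℕ → State R K → Set where
  ⇓skip   : ∀ {σ} → L ⊢ skip , σ ⇓[ 1 ] σ
  ⇓assign : ∀ {σ x e w} →
            L ⊢ e , σ ↦ w → w ℕ.< words L →
            L ⊢ x ≔ e , σ ⇓[ 1 ] setReg x w σ
  ⇓store  : ∀ {σ a i x} →
            reg σ i ℕ.< cells L →
            L ⊢ store a i x , σ ⇓[ 1 ] setArr a (reg σ i) (reg σ x) σ
  ⇓seq    : ∀ {σ σ′ σ″ c c′ t t′} →
            L ⊢ c , σ ⇓[ t ] σ′ → L ⊢ c′ , σ′ ⇓[ t′ ] σ″ →
            L ⊢ c ⨾ c′ , σ ⇓[ t ℕ.+ t′ ] σ″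
  ⇓then   : ∀ {σ σ′ x c c′ t} →
            reg σ x ≢ 0 → L ⊢ c , σ ⇓[ t ] σ′ →
            L ⊢ if≢0 x then c else c′ , σ ⇓[ suc t ] σ′
  ⇓else   : ∀ {σ σ′ x c c′ t} →
            reg σ x ≡ 0 → L ⊢ c′ , σ ⇓[ t ] σ′ →
            L ⊢ if≢0 x then c else c′ , σ ⇓[ suc t ] σ′
  ⇓loop   : ∀ {σ σ′ σ″ x c t t′} →
            reg σ x ≢ 0 → L ⊢ c , σ ⇓[ t ] σ′ → L ⊢ while≢0 x loop c , σ′ ⇓[ t′ ] σ″ →
            L ⊢ while≢0 x loop c , σ ⇓[ suc (t ℕ.+ t′) ] σ″
  ⇓exit   : ∀ {σ x c} →
            reg σ x ≡ 0 →
            L ⊢ while≢0 x loop c , σ ⇓[ 1 ] σ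

------------------------------------------------------------------------
-- Data in memory

-- Coordinate format: the p-th non-zero entry of the matrix is at index p of
-- the three arrays; the register nnz holds the number of non-zero entries.
record SparseMatrix (R K : ℕ) : Set where
  constructor sparseMatrix
  field
    rows cols vals : Fin K
    nnz            : Fin R

-- The entries come in arbitrary order, each non-zero entry exactly once.
StoresMatrix : ∀ {R K n} → State R K → SparseMatrix R K → Matrix n → Set
StoresMatrix {n = n} σ h M =
  Σ[ es ∈ List (Fin n × Fin n) ]
    Unique es
  × (∀ i j → (i , j) ∈ es ⇔ M i j ≢ 0ℤ)
  × reg σ nnz ≡ length es
  × (∀ p → let (i , j) = lookup es p in
       arr σ rows (toℕ p) ≡ toℕ i
     × arr σ cols (toℕ p) ≡ toℕ j
     × + arr σ vals (toℕ p) ≡ M i j)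
  where open SparseMatrix h

-- A vector of integers, indexed directly by vertices.
StoresVector : ∀ {R K n} → State R K → Fin K → Vector ℤ n → Set
StoresVector σ a x = ∀ v → + arr σ a (toℕ v) ≡ x v

-- A sparse vector of fractions: the non-zero entries, in arbitrary order,
-- each with its index, a numerator and a non-zero denominator.
record SparseFractions (R K : ℕ) : Set where
  constructor sparseFractions
  field
    inds nums dens : Fin K
    nnz            : Fin R

StoresFractions : ∀ {R K n} → State R K → SparseFractions R K → Vector ℚ n → Set
StoresFractions {n = n} σ h x =
  Σ[ vs ∈ List (Fin n) ]
    Unique vs
  × (∀ v → v ∈ vs ⇔ x v ≢ 0ℚ)
  × reg σ nnz ≡ length vs
  × (∀ p → let v = lookup vs p in
       arr σ inds (toℕ p) ≡ toℕ v
     × arr σ dens (toℕ p) ≢ 0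
     × fromℕ (arr σ nums (toℕ p)) ÷ arr σ dens (toℕ p) ≡ x v)
  where open SparseFractions h

------------------------------------------------------------------------
-- Linear algebraic algorithms

-- The input occupies fixed places: register 0 holds n, and the sparse matrix A
-- is held by arrays 0, 1, 2 and register 1.
inputMatrix : ∀ {R K} → SparseMatrix (2 ℕ.+ R) (3 ℕ.+ K)
inputMatrix = sparseMatrix zero (suc zero) (suc (suc zero)) (suc zero)

-- Apart from the input, memory is initially zero.
record Initial {R K n} (G : Graph n) (σ : State (2 ℕ.+ R) (3 ℕ.+ K)) : Set where
  field
    dimension : reg σ zero ≡ n
    input     : StoresMatrix σ inputMatrix (A G)
    zeroRegs  : ∀ x → reg σ (suc (suc x)) ≡ 0
    zeroArrs  : ∀ a i → arr σ (suc (suc (suc a))) i ≡ 0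

-- One stage for each object of the formulation
--   (3A − 2Ť + I) T𝟏 / 𝟏ᵀT𝟏,
-- together with the places where the stages leave their results.
record Algorithm : Set where
  field
    R K : ℕ

  regs : ℕ
  regs = 2 ℕ.+ R

  arrs : ℕ
  arrs = 3 ℕ.+ K

  field
    makeT makeŤ makeT𝟏 makeDenominator makeNumerator divide : Cmd regs arrs
    atT atŤ                                                  : SparseMatrix regs arrs
    atT𝟏 atNumerator                                         : Fin arrs
    atDenominator                                            : Fin regs
    atOutput                                                 : SparseFractions regs arrs

  program : Cmd regs arrs
  program = makeT ⨾ makeŤ ⨾ makeT𝟏 ⨾ makeDenominator ⨾ makeNumerator ⨾ divide

  -- All registers, and arrays of the given number of cells.
  space : ℕ → ℕ
  space s = regs ℕ.+ arrs ℕ.* s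

-- A run of the program from σ₀ through the matrix formulation: each stage
-- starts with its operands in memory and leaves its result in memory.
record Evaluation {n} (L : Limits) (alg : Algorithm) (G : Graph n)
                  (σ₀ : State (Algorithm.regs alg) (Algorithm.arrs alg)) : Set where
  open Algorithm alg
  field
    -- The arrays have room for the entries of A and for a vector.
    matrixFits : 2 ℕ.* m G ℕ.≤ cells L
    vectorFits : n ℕ.≤ cells L

    {σ₁ σ₂ σ₃ σ₄ σ₅ final} : State regs arrs
    {t₁ t₂ t₃ t₄ t₅ t₆}    : ℕ

    runT : L ⊢ makeT , σ₀ ⇓[ t₁ ] σ₁
    A₁   : StoresMatrix σ₁ inputMatrix (A G)
    T₁   : StoresMatrix σ₁ atT (T G)

    runŤ : L ⊢ makeŤ , σ₁ ⇓[ t₂ ] σ₂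
    A₂   : StoresMatrix σ₂ inputMatrix (A G)
    T₂   : StoresMatrix σ₂ atT (T G)
    Ť₂   : StoresMatrix σ₂ atŤ (Ť G)

    runT𝟏 : L ⊢ makeT𝟏 , σ₂ ⇓[ t₃ ] σ₃
    A₃    : StoresMatrix σ₃ inputMatrix (A G)
    Ť₃    : StoresMatrix σ₃ atŤ (Ť G)
    T𝟏₃   : StoresVector σ₃ atT𝟏 (T𝟏 G)

    runDenominator : L ⊢ makeDenominator , σ₃ ⇓[ t₄ ] σ₄
    A₄             : StoresMatrix σ₄ inputMatrix (A G)
    Ť₄             : StoresMatrix σ₄ atŤ (Ť G)
    T𝟏₄            : StoresVector σ₄ atT𝟏 (T𝟏 G)
    denominator₄   : + reg σ₄ atDenominator ≡ denominator G

    runNumerator : L ⊢ makeNumerator , σ₄ ⇓[ t₅ ] σ₅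
    denominator₅ : + reg σ₅ atDenominator ≡ denominator G
    numerator₅   : StoresVector σ₅ atNumerator (numerator G)

    runDivide : L ⊢ divide , σ₅ ⇓[ t₆ ] final

  time : ℕ
  time = t₁ ℕ.+ (t₂ ℕ.+ (t₃ ℕ.+ (t₄ ℕ.+ (t₅ ℕ.+ t₆))))

  run : L ⊢ program , σ₀ ⇓[ time ] final
  run = ⇓seq runT (⇓seq runŤ (⇓seq runT𝟏 (⇓seq runDenominator (⇓seq runNumerator runDivide))))

-- Store A as linked adjacency lists. For every vertex v, mark N(v), and for
-- every u ∈ N(v) with d(u) ≤ d(v) count the marked vertices in the list of u.
-- This gives T(v,u) = T(u,v) in time O(d(u)), so that an edge costs
-- O(min{d(u),d(v)}), while all the marking costs O(m). Since T has at most 2m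
-- entries, the rest of the formula takes a bounded number of passes over the
-- entries of A and T. No pass runs over the vertices: m δ̄ does not bound the
-- number of isolated vertices.
--
-- The value is right because T𝟏(v) = 2△(v), 𝟏ᵀT𝟏 = 6△(G), and T(v,u) ≠ 0 if
-- and only if u ∈ N△(v).

module Submission where

open import Defs
import Algebra.Properties.CommutativeMonoid.Sum
import Algebra.Properties.Semiring.Sum
open import Data.Bool using (Bool; true; false; if_then_else_; _∨_)
open import Data.Empty using (⊥; ⊥-elim)
open import Data.Fin as F using (Fin; zero; suc; toℕ)
import Data.Fin.Properties as F
open import Data.Integer as ℤ using (ℤ; 0ℤ; 1ℤ)
import Data.Integer.Properties as ℤ
import Data.Integer.Tactic.RingSolver as ℤ-Solver
open import Data.List using (List; []; _∷_; _++_; _ʳ++_; length; lookup; map; filter; reverse; allFin; tabulate; cartesianProduct)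
open import Data.List.Membership.Propositional using (_∈_; _∉_)
open import Data.List.Membership.Propositional.Properties
  using (∈-allFin; ∈-cartesianProduct⁺; ∈-filter⁺; ∈-filter⁻; ∈-lookup)
import Data.List.Properties as L
open import Data.List.Relation.Binary.Permutation.Propositional using (↭-sym; ↭⇒↭ₛ)
open import Data.List.Relation.Binary.Permutation.Propositional.Properties using (↭-reverse; ∈-resp-↭)
import Data.List.Relation.Binary.Permutation.Setoid.Properties as ↭ₛ
import Data.List.Relation.Unary.All as All
open import Data.List.Relation.Unary.AllPairs using ([]; _∷_)
open import Data.List.Relation.Unary.Any using (here; there)
open import Data.List.Relation.Unary.Unique.Propositional using (Unique)
open import Data.Nat as ℕ using (ℕ; zero; suc; _+_; _*_; _∸_; _^_; _⊓_; _≤_; _<_; z≤n; s≤s)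
open import Data.Nat.ListAction using (sum)
open import Data.Nat.ListAction.Properties using (sum-++)
import Data.Nat.Properties as ℕ
open import Data.Nat.Tactic.RingSolver using (solve-∀)
open import Data.Product using (Σ-syntax; ∃-syntax; _×_; _,_; proj₁; proj₂)
open import Data.Rational as ℚ using (0ℚ; toℚᵘ)
import Data.Rational.Properties as ℚ
open import Data.Rational.Unnormalised as ℚᵘ using (mkℚᵘ; *≡*; *≤*)
import Data.Rational.Unnormalised.Properties as ℚᵘ
open import Data.Sum using (_⊎_; inj₁; inj₂)
open import Data.Unit using (⊤; tt)
open import Data.Vec.Functional.Properties using (updateAt-minimal)
open import Function using (_∘_; _$_; const)
open import Function.Bundles using (_⇔_; mk⇔; Equivalence)
open import Level using (Level)
open import Relation.Binary.Definitions using (tri<; tri≈; tri>)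
open import Relation.Binary.PropositionalEquality
open import Relation.Nullary using (Dec; yes; no; does; ¬_; ¬?)
open import Relation.Nullary.Decidable using (_×-dec_; _⊎-dec_; dec-true; dec-false; decidable-stable)
open import Relation.Unary using (Pred; Decidable)

-- A command that overflows or leaves its array has no run, so every step needs a bound on its
-- result. All accumulators only grow until a last phase of subtractions, so that it is enough to
-- bound final values; the critical one is the numerator before subtraction, at most n² + 3n³. The
-- machine has no negative numbers. The numerator is therefore a truncated difference of naturals,
-- and it is exact because Ť is dominated by A. All counting is done in ℕ and cast to ℤ and ℚ at the
-- end. Loops count down. The counter is then the length of the list of unread entries, and
-- correctness is an induction on that list, with a budget of steps in place of a separate cost
-- analysis. A row v occurs d(v) times among the entries but is searched only once. The fixed cost
-- of its search is charged to its neighbours, and work proportional to m is absorbed by m δ̄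
-- because both ends of an edge have degree at least 1. An edge is scanned from the end of larger
-- degree, and from both ends on a tie. That no entry of T is produced twice or missed is the
-- combinatorial core of the search.

-- Finite sums

module Sum = Algebra.Properties.Semiring.Sum ℕ.+-*-semiring
open Sum using () renaming (sum to ∑) public

private variable
  ℓ ℓ′ : Level
  P : Set ℓ
  P′ : Set ℓ′
  B : Set ℓ
  C : Set ℓ′
  n : ℕ

module _ {n : ℕ} where
  open import Data.List.Membership.DecPropositional (F._≟_ {n}) using (_∈?_) public

∑-cong : {f g : Fin n → ℕ} → (∀ i → f i ≡ g i) → ∑ f ≡ ∑ g
∑-cong {n} = Sum.sum-cong-≗ {n}

∑-+ : (f g : Fin n → ℕ) → ∑ (λ i → f i + g i) ≡ ∑ f + ∑ g
∑-+ = Sum.∑-distrib-+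

∑-comm : (f : Fin n → Fin n → ℕ) → ∑ (λ i → ∑ (λ j → f i j)) ≡ ∑ (λ j → ∑ (λ i → f i j))
∑-comm = Sum.∑-comm

∑-* : (k : ℕ) (f : Fin n → ℕ) → ∑ (λ i → k * f i) ≡ k * ∑ f
∑-* k f = sym (Sum.*-distribˡ-sum k f)

𝟙 : Dec P → ℕ
𝟙 p = if does p then 1 else 0

𝟙-yes : (p : Dec P) → P → 𝟙 p ≡ 1
𝟙-yes p x = cong (if_then 1 else 0) (dec-true p x)

𝟙-no : (p : Dec P) → ¬ P → 𝟙 p ≡ 0
𝟙-no p x = cong (if_then 1 else 0) (dec-false p x)

𝟙-⇔ : (p : Dec P) (q : Dec P′) → (P → P′) → (P′ → P) → 𝟙 p ≡ 𝟙 q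
𝟙-⇔ (yes x) q f g = sym (𝟙-yes q (f x))
𝟙-⇔ (no x) q f g = sym (𝟙-no q (x ∘ g))

𝟙-× : (p : Dec P) (q : Dec P′) → 𝟙 (p ×-dec q) ≡ 𝟙 p * 𝟙 q
𝟙-× (yes _) q = sym (ℕ.+-identityʳ (𝟙 q))
𝟙-× (no _) q = refl

∑-mono : {f g : Fin n → ℕ} → (∀ i → f i ≤ g i) → ∑ f ≤ ∑ g
∑-mono {zero} h = z≤n
∑-mono {suc n} h = ℕ.+-mono-≤ (h zero) (∑-mono (h ∘ suc))

term≤∑ : (f : Fin n → ℕ) (i : Fin n) → f i ≤ ∑ f
term≤∑ f zero = ℕ.m≤m+n (f zero) _
term≤∑ f (suc i) = ℕ.≤-trans (term≤∑ (f ∘ suc) i) (ℕ.m≤n+m _ (f zero))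

∑-bounded : {f : Fin n → ℕ} {b : ℕ} → (∀ i → f i ≤ b) → ∑ f ≤ n * b
∑-bounded {zero} h = z≤n
∑-bounded {suc n} h = ℕ.+-mono-≤ (h zero) (∑-bounded (h ∘ suc))

∑≡0 : {f : Fin n → ℕ} → (∀ i → f i ≡ 0) → ∑ f ≡ 0
∑≡0 {n} h = trans (∑-cong h) (Sum.sum-replicate-zero n)

∑-select : (f : Fin n → ℕ) (v : Fin n) → ∑ (λ u → 𝟙 (v F.≟ u) * f u) ≡ f v
∑-select {suc n} f zero = trans (cong₂ _+_ (ℕ.+-identityʳ (f zero)) (∑≡0 {n} {f = λ _ → 0} λ _ → refl)) (ℕ.+-identityʳ (f zero))
∑-select {suc n} f (suc v) = trans (∑-cong {n} λ u → cong (_* f (suc u)) (𝟙-⇔ (suc v F.≟ suc u) (v F.≟ u) F.suc-injective (cong suc)))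
                           (∑-select (f ∘ suc) v)

∑-𝟙 : (v : Fin n) → ∑ (λ u → 𝟙 (u F.≟ v)) ≡ 1
∑-𝟙 {n} v = trans (∑-cong {n} λ u → trans (𝟙-⇔ (u F.≟ v) (v F.≟ u) sym sym) (sym (ℕ.*-identityʳ _)))
                  (∑-select (const 1) v)

sum-map-++ : (f : B → ℕ) (xs ys : List B) → sum (map f (xs ++ ys)) ≡ sum (map f xs) + sum (map f ys)
sum-map-++ f xs ys = trans (cong sum (L.map-++ f xs ys)) (sum-++ (map f xs) (map f ys))

sum-tabulate : (f : Fin n → ℕ) → sum (tabulate f) ≡ ∑ f
sum-tabulate {zero} f = refl
sum-tabulate {suc n} f = cong (f zero +_) (sum-tabulate (f ∘ suc))

sum-allFin : (f : Fin n → ℕ) → sum (map f (allFin n)) ≡ ∑ f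
sum-allFin f = trans (cong sum (L.map-tabulate (λ i → i) f)) (sum-tabulate f)

sum-filter : {P : Pred B ℓ} (P? : Decidable P) (f : B → ℕ) (xs : List B) →
             sum (map f (filter P? xs)) ≡ sum (map (λ x → 𝟙 (P? x) * f x) xs)
sum-filter P? f [] = refl
sum-filter P? f (x ∷ xs) with does (P? x)
... | true  = cong₂ _+_ (sym (ℕ.+-identityʳ (f x))) (sum-filter P? f xs)
... | false = sum-filter P? f xs

sum-map-const : (k : ℕ) (xs : List B) → sum (map (const k) xs) ≡ length xs * k
sum-map-const k [] = refl
sum-map-const k (x ∷ xs) = cong (k +_) (sum-map-const k xs)

length≡sum : (xs : List B) → length xs ≡ sum (map (const 1) xs)
length≡sum xs = trans (sym (ℕ.*-identityʳ _)) (sym (sum-map-const 1 xs))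

sum-cartesianProduct : (f : B × C → ℕ) (xs : List B) (ys : List C) →
  sum (map f (cartesianProduct xs ys)) ≡ sum (map (λ x → sum (map (λ y → f (x , y)) ys)) xs)
sum-cartesianProduct f [] ys = refl
sum-cartesianProduct f (x ∷ xs) ys = trans (sum-map-++ f (map (x ,_) ys) _)
  (cong₂ _+_ (cong sum (sym (L.map-∘ ys))) (sum-cartesianProduct f xs ys))

sum-map-mono : {f g : B → ℕ} (xs : List B) → (∀ x → x ∈ xs → f x ≤ g x) → sum (map f xs) ≤ sum (map g xs)
sum-map-mono [] h = z≤n
sum-map-mono (x ∷ xs) h = ℕ.+-mono-≤ (h x (here refl)) (sum-map-mono xs λ y y∈ → h y (there y∈))

sum-map-cong : {f g : B → ℕ} (xs : List B) → (∀ x → x ∈ xs → f x ≡ g x) → sum (map f xs) ≡ sum (map g xs)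
sum-map-cong [] h = refl
sum-map-cong (x ∷ xs) h = cong₂ _+_ (h x (here refl)) (sum-map-cong xs λ y y∈ → h y (there y∈))

sum-map-* : (k : ℕ) (f : B → ℕ) (xs : List B) → sum (map (λ x → k * f x) xs) ≡ k * sum (map f xs)
sum-map-* k f [] = sym (ℕ.*-zeroʳ k)
sum-map-* k f (x ∷ xs) = trans (cong (k * f x +_) (sum-map-* k f xs)) (sym (ℕ.*-distribˡ-+ k (f x) _))

-- Lists held in memory come in arbitrary order; this passes from them to sums over all vertices,
-- which do not depend on the order. Uniqueness makes the membership indicator of `x ∷ xs` the sum
-- of those of `x` and of `xs`.
sum-unique : ∀ {n ℓ} {P : Fin n → Set ℓ} (P? : ∀ u → Dec (P u)) (f : Fin n → ℕ) (xs : List (Fin n)) → Unique xs →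
             (∀ u → u ∈ xs → P u) → (∀ u → P u → u ∈ xs) →
             sum (map f xs) ≡ ∑ (λ u → 𝟙 (P? u) * f u)
sum-unique {n} P? f xs uniq f⁺ f⁻ = trans (go xs uniq) (∑-cong λ u → cong (_* f u) (𝟙-⇔ (u ∈? xs) (P? u) (f⁺ u) (f⁻ u)))
  where
  𝟙-∷ : ∀ u x xs → x ∉ xs → 𝟙 (u ∈? (x ∷ xs)) ≡ 𝟙 (x F.≟ u) + 𝟙 (u ∈? xs)
  𝟙-∷ u x xs x∉ with x F.≟ u
  ... | yes refl = trans (𝟙-yes (u ∈? (u ∷ xs)) (here refl)) (cong suc (sym (𝟙-no (u ∈? xs) x∉)))
  ... | no x≢u = 𝟙-⇔ (u ∈? (x ∷ xs)) (u ∈? xs) (λ { (here e) → ⊥-elim (x≢u (sym e)) ; (there h) → h }) there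
  go : ∀ xs → Unique xs → sum (map f xs) ≡ ∑ (λ u → 𝟙 (u ∈? xs) * f u)
  go [] _ = sym (∑≡0 {n} {f = λ _ → 0} λ _ → refl)
  go (x ∷ xs) (x# ∷ uq) = sym (begin
    ∑ (λ u → 𝟙 (u ∈? (x ∷ xs)) * f u)
      ≡⟨ ∑-cong (λ u → trans (cong (_* f u) (𝟙-∷ u x xs (λ x∈ → All.lookup x# x∈ refl))) (ℕ.*-distribʳ-+ (f u) (𝟙 (x F.≟ u)) _)) ⟩
    ∑ (λ u → 𝟙 (x F.≟ u) * f u + 𝟙 (u ∈? xs) * f u)
      ≡⟨ ∑-+ {n} _ _ ⟩
    ∑ (λ u → 𝟙 (x F.≟ u) * f u) + ∑ (λ u → 𝟙 (u ∈? xs) * f u)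
      ≡⟨ cong₂ _+_ (∑-select f x) (sym (go xs uq)) ⟩
    f x + sum (map f xs) ∎)
    where open ≡-Reasoning

-- Each unordered pair is met in both orders and the diagonal vanishes. With adjacency weights this
-- is the handshake lemma; with triangle indicators it yields the factor 2 in `T1≡2△`.
∑-symmetric : (f : Fin n → Fin n → ℕ) → (∀ u v → f u v ≡ f v u) → (∀ u → f u u ≡ 0) →
              ∑ (λ u → ∑ (λ v → f u v)) ≡ 2 * ∑ (λ u → ∑ (λ v → 𝟙 (u F.<? v) * f u v))
∑-symmetric {n} f f-sym f-diag = begin
  ∑ (λ u → ∑ (λ v → f u v))
    ≡⟨ ∑-cong {n} (λ u → trans (∑-cong (split u)) (∑-+ {n} (λ v → 𝟙 (u F.<? v) * f u v) _)) ⟩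
  ∑ (λ u → ∑ (λ v → 𝟙 (u F.<? v) * f u v) + ∑ (λ v → 𝟙 (v F.<? u) * f v u))
    ≡⟨ ∑-+ {n} _ _ ⟩
  S + ∑ (λ u → ∑ (λ v → 𝟙 (v F.<? u) * f v u))
    ≡⟨ cong (S +_) (∑-comm λ u v → 𝟙 (v F.<? u) * f v u) ⟩
  S + S
    ≡⟨ cong (S +_) (sym (ℕ.+-identityʳ S)) ⟩
  2 * S ∎
  where
  open ≡-Reasoning
  S = ∑ (λ u → ∑ (λ v → 𝟙 (u F.<? v) * f u v))
  split : ∀ u v → f u v ≡ 𝟙 (u F.<? v) * f u v + 𝟙 (v F.<? u) * f v u
  split u v with F.<-cmp u v
  ... | tri< u<v _ v≮u rewrite 𝟙-yes (u F.<? v) u<v | 𝟙-no (v F.<? u) v≮u =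
    sym (trans (ℕ.+-identityʳ _) (ℕ.+-identityʳ _))
  ... | tri≈ u≮v refl _ rewrite 𝟙-no (u F.<? u) u≮v = f-diag u
  ... | tri> u≮v _ v<u rewrite 𝟙-yes (v F.<? u) v<u | 𝟙-no (u F.<? v) u≮v =
    trans (f-sym u v) (sym (ℕ.+-identityʳ _))

-- Triangle counts as row sums of T

minDegreeSum : ∀ {n} → Graph n → ℕ
minDegreeSum G = sum (map (λ (u , v) → d G u ⊓ d G v) (edges G))

∑-sum : ∀ {ℓ} {B : Set ℓ} {n} (h : Fin n → B → ℕ) (xs : List B) →
        ∑ (λ v → sum (map (h v) xs)) ≡ sum (map (λ x → ∑ (λ v → h v x)) xs)
∑-sum {n = n} h [] = ∑≡0 {n} λ _ → refl
∑-sum h (x ∷ xs) = trans (∑-+ (λ v → h v x) _) (cong (∑ (λ v → h v x) +_) (∑-sum h xs))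

module Counting {n} (G : Graph n) where
  open Graph G

  a : Fin n → Fin n → ℕ
  a u v = 𝟙 (u ~? v)

  a-sym : ∀ u v → a u v ≡ a v u
  a-sym u v = 𝟙-⇔ (u ~? v) (v ~? u) ~-sym ~-sym

  a-diag : ∀ u → a u u ≡ 0
  a-diag u = 𝟙-no (u ~? u) (~-irrefl refl)

  sum-N : ∀ (f : Fin n → ℕ) v → sum (map f (N G v)) ≡ ∑ (λ u → a v u * f u)
  sum-N f v = trans (sum-filter (λ u → u ~? v) f (allFin n))
    (trans (sum-allFin λ u → a u v * f u) (∑-cong λ u → cong (_* f u) (a-sym u v)))

  d≡∑ : ∀ v → d G v ≡ ∑ (λ u → a v u)
  d≡∑ v = trans (length≡sum (N G v)) (trans (sum-N (const 1) v) (∑-cong {n} λ u → ℕ.*-identityʳ _))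

  sum-edges : (f : Fin n → Fin n → ℕ) →
    sum (map (λ (u , v) → f u v) (edges G)) ≡ ∑ (λ u → ∑ (λ v → 𝟙 (u F.<? v) * (a u v * f u v)))
  sum-edges f = begin
    sum (map (λ (u , v) → f u v) (edges G))
      ≡⟨ sum-filter edge? _ (cartesianProduct (allFin n) (allFin n)) ⟩
    sum (map (λ e → 𝟙 (edge? e) * f (proj₁ e) (proj₂ e)) (cartesianProduct (allFin n) (allFin n)))
      ≡⟨ sum-cartesianProduct (λ e → 𝟙 (edge? e) * f (proj₁ e) (proj₂ e)) (allFin n) (allFin n) ⟩
    sum (map (λ u → sum (map (λ v → 𝟙 (edge? (u , v)) * f u v) (allFin n))) (allFin n))
      ≡⟨ sum-allFin (λ u → sum (map (λ v → 𝟙 (edge? (u , v)) * f u v) (allFin n))) ⟩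
    ∑ (λ u → sum (map (λ v → 𝟙 (edge? (u , v)) * f u v) (allFin n)))
      ≡⟨ ∑-cong (λ u → trans (sum-allFin (λ v → 𝟙 (edge? (u , v)) * f u v))
           (∑-cong λ v → trans (cong (_* f u v) (𝟙-× (u F.<? v) (u ~? v))) (ℕ.*-assoc (𝟙 (u F.<? v)) _ _))) ⟩
    ∑ (λ u → ∑ (λ v → 𝟙 (u F.<? v) * (a u v * f u v))) ∎
    where
    open ≡-Reasoning
    edge? : (e : Fin n × Fin n) → Dec (proj₁ e F.< proj₂ e × proj₁ e ~ proj₂ e)
    edge? (u , v) = (u F.<? v) ×-dec (u ~? v)

  -- Turns sums over the 2m stored entries into sums over the m edges, both for the number of
  -- entries and for the minimum degrees.
  sum-arcs : (f : Fin n → Fin n → ℕ) → (∀ u v → f u v ≡ f v u) →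
    ∑ (λ u → ∑ (λ v → a u v * f u v)) ≡ 2 * sum (map (λ (u , v) → f u v) (edges G))
  sum-arcs f f-sym = trans
    (∑-symmetric (λ u v → a u v * f u v) (λ u v → cong₂ _*_ (a-sym u v) (f-sym u v)) (λ u → cong (_* f u u) (a-diag u)))
    (cong (2 *_) (sym (sum-edges f)))

  -- The entries of A², that is, the numbers of common neighbours. The search counts these; on
  -- edges, the only pairs that it meets, they agree with the entries `t` of T.
  τ : Fin n → Fin n → ℕ
  τ v u = ∑ λ w → a v w * a w u

  τ-sym : ∀ u v → τ u v ≡ τ v u
  τ-sym u v = ∑-cong λ w → trans (cong₂ _*_ (a-sym u w) (a-sym w v)) (ℕ.*-comm (a w u) (a v w))

  t : Fin n → Fin n → ℕ
  t v u = τ v u * a v u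

  T1 : Fin n → ℕ
  T1 v = ∑ (t v)

  private
    g : Fin n → Fin n → Fin n → ℕ
    g u v w = 𝟙 (u F.<? v) * (𝟙 (v F.<? w) * (a u v * (a v w * a u w)))

    triangle? : (x : Fin n × Fin n × Fin n) → let (u , v , w) = x in
      Dec (u F.< v × v F.< w × u ~ v × v ~ w × u ~ w)
    triangle? (u , v , w) = (u F.<? v) ×-dec (v F.<? w) ×-dec (u ~? v) ×-dec (v ~? w) ×-dec (u ~? w)

    𝟙-triangle : ∀ u v w → 𝟙 (triangle? (u , v , w)) ≡ g u v w
    𝟙-triangle u v w =
      trans (𝟙-× (u F.<? v) ((v F.<? w) ×-dec (u ~? v) ×-dec (v ~? w) ×-dec (u ~? w))) (cong (𝟙 (u F.<? v) *_)
      (trans (𝟙-× (v F.<? w) ((u ~? v) ×-dec (v ~? w) ×-dec (u ~? w))) (cong (𝟙 (v F.<? w) *_)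
      (trans (𝟙-× (u ~? v) ((v ~? w) ×-dec (u ~? w))) (cong (a u v *_) (𝟙-× (v ~? w) (u ~? w)))))))

    sum-triangles : (f : Fin n → Fin n → Fin n → ℕ) →
      sum (map (λ (u , v , w) → f u v w) (triangles G)) ≡ ∑ (λ u → ∑ (λ v → ∑ (λ w → g u v w * f u v w)))
    sum-triangles f = begin
      sum (map f′ (triangles G))
        ≡⟨ sum-filter triangle? f′ (cartesianProduct V (cartesianProduct V V)) ⟩
      sum (map h (cartesianProduct V (cartesianProduct V V)))
        ≡⟨ sum-cartesianProduct h V (cartesianProduct V V) ⟩
      sum (map (λ u → sum (map (λ vw → h (u , vw)) (cartesianProduct V V))) V)
        ≡⟨ sum-allFin (λ u → sum (map (λ vw → h (u , vw)) (cartesianProduct V V))) ⟩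
      ∑ (λ u → sum (map (λ vw → h (u , vw)) (cartesianProduct V V)))
        ≡⟨ ∑-cong (λ u → trans (sum-cartesianProduct (λ vw → h (u , vw)) V V)
             (trans (sum-allFin (λ v → sum (map (λ w → h (u , v , w)) V)))
             (∑-cong λ v → trans (sum-allFin (λ w → h (u , v , w)))
             (∑-cong λ w → cong (_* f u v w) (𝟙-triangle u v w))))) ⟩
      ∑ (λ u → ∑ (λ v → ∑ (λ w → g u v w * f u v w))) ∎
      where
      open ≡-Reasoning
      V : List (Fin n)
      V = allFin n
      f′ h : Fin n × Fin n × Fin n → ℕ
      f′ (u , v , w) = f u v w
      h x = 𝟙 (triangle? x) * f′ x

    -- A sum where `△` has a disjunction, so that the corners can be treated one at a time.
    s : Fin n → Fin n × Fin n × Fin n → ℕ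
    s v (x , y , z) = 𝟙 (v F.≟ x) + (𝟙 (v F.≟ y) + 𝟙 (v F.≟ z))

    △-sum : ∀ v → △ G v ≡ sum (map (s v) (triangles G))
    △-sum v = trans (length≡sum (filter corner? (triangles G))) (trans (sum-filter corner? (const 1) (triangles G))
      (sum-map-cong (triangles G) split))
      where
      corner? : (x : Fin n × Fin n × Fin n) → Dec _
      corner? (x , y , z) = (v F.≟ x) ⊎-dec (v F.≟ y) ⊎-dec (v F.≟ z)
      split : ∀ x → x ∈ triangles G → 𝟙 (corner? x) * 1 ≡ s v x
      -- The corners increase strictly, so at most one of them is `v` and the disjunction agrees
      -- with the sum.
      split (x , y , z) x∈ with proj₂ (∈-filter⁻ triangle? {xs = cartesianProduct (allFin n) (cartesianProduct (allFin n) (allFin n))} x∈)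
      ... | x<y , y<z , _ with v F.≟ x | v F.≟ y | v F.≟ z
      ... | yes refl | yes refl | _ = ⊥-elim (F.<-irrefl refl x<y)
      ... | yes refl | no _ | yes refl = ⊥-elim (F.<-irrefl refl (F.<-trans x<y y<z))
      ... | yes _ | no _ | no _ = refl
      ... | no _ | yes refl | yes refl = ⊥-elim (F.<-irrefl refl y<z)
      ... | no _ | yes _ | no _ = refl
      ... | no _ | no _ | yes _ = refl
      ... | no _ | no _ | no _ = refl

    -- A triangle on v and y < z is listed once, according to the rank of v.
    g-ranks : ∀ v y z → g v y z + (g y v z + g y z v) ≡ 𝟙 (y F.<? z) * (a v y * (a y z * a v z))
    g-ranks v y z with F.<-cmp y z
    ... | tri≈ y≮z refl _ rewrite 𝟙-no (y F.<? y) y≮z | a-diag y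
      | ℕ.*-zeroʳ (𝟙 (v F.<? y)) = lem
      where
      lem : 𝟙 (y F.<? v) * (𝟙 (v F.<? y) * (a y v * (a v y * 0))) + 0 ≡ 0
      lem rewrite ℕ.*-zeroʳ (a v y) | ℕ.*-zeroʳ (a y v) | ℕ.*-zeroʳ (𝟙 (v F.<? y)) | ℕ.*-zeroʳ (𝟙 (y F.<? v)) = refl
    ... | tri> y≮z _ z<y rewrite 𝟙-no (y F.<? z) y≮z | ℕ.*-zeroʳ (𝟙 (v F.<? y)) = lem
      where
      lem : 𝟙 (y F.<? v) * (𝟙 (v F.<? z) * (a y v * (a v z * a y z))) + 0 ≡ 0
      lem with F.<-cmp y v
      ... | tri≈ y≮v _ _ rewrite 𝟙-no (y F.<? v) y≮v = refl
      ... | tri> y≮v _ _ rewrite 𝟙-no (y F.<? v) y≮v = refl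
      ... | tri< y<v _ _ rewrite 𝟙-no (v F.<? z) (λ v<z → y≮z (F.<-trans y<v v<z)) | ℕ.*-zeroʳ (𝟙 (y F.<? v)) = refl
    ... | tri< y<z _ z≮y rewrite 𝟙-yes (y F.<? z) y<z with F.<-cmp v y
    ... | tri< v<y _ y≮v rewrite 𝟙-yes (v F.<? y) v<y | 𝟙-no (y F.<? v) y≮v
      | 𝟙-no (z F.<? v) (λ z<v → z≮y (F.<-trans z<v v<y)) = solve (a v y) (a y z) (a v z)
      where
      solve : ∀ p q r → 1 * (1 * (p * (q * r))) + (0 + (1 * 0)) ≡ 1 * (p * (q * r))
      solve = solve-∀
    ... | tri≈ v≮y refl _ rewrite 𝟙-no (v F.<? v) v≮y | 𝟙-no (z F.<? v) z≮y | a-diag v = refl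
    ... | tri> v≮y _ y<v rewrite 𝟙-no (v F.<? y) v≮y | 𝟙-yes (y F.<? v) y<v with F.<-cmp v z
    ... | tri< v<z _ z≮v rewrite 𝟙-yes (v F.<? z) v<z | 𝟙-no (z F.<? v) z≮v | a-sym y v = solve (a v y) (a y z) (a v z)
      where
      solve : ∀ p q r → 1 * (1 * (p * (r * q))) + 1 * 0 ≡ 1 * (p * (q * r))
      solve = solve-∀
    ... | tri≈ v≮z refl _ rewrite 𝟙-no (v F.<? v) v≮z | a-diag v = solve (a v y) (a y v)
      where
      solve : ∀ p q → 1 * 0 ≡ 1 * (p * (q * 0))
      solve = solve-∀
    ... | tri> v≮z _ z<v rewrite 𝟙-no (v F.<? z) v≮z | 𝟙-yes (z F.<? v) z<v | a-sym y v | a-sym z v = solve (a v y) (a y z) (a v z)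
      where
      solve : ∀ p q r → 1 * 0 + 1 * (1 * (q * (r * p))) ≡ 1 * (p * (q * r))
      solve = solve-∀

    -- Setting each corner in turn equal to `v` leaves three double sums, one for each rank of `v`
    -- in its triangle; `g-ranks` recombines them.
    △≡∑ : ∀ v → △ G v ≡ ∑ (λ y → ∑ (λ z → 𝟙 (y F.<? z) * (a v y * (a y z * a v z))))
    △≡∑ v = begin
      △ G v
        ≡⟨ trans (△-sum v) (sum-triangles λ x y z → s v (x , y , z)) ⟩
      ∑ (λ x → ∑ (λ y → ∑ (λ z → g x y z * s v (x , y , z))))
        ≡⟨ ∑³-+ _ _ _ (λ x y z → solve (g x y z) (𝟙 (v F.≟ x)) (𝟙 (v F.≟ y) + 𝟙 (v F.≟ z))) ⟩
      ∑ (λ x → ∑ (λ y → ∑ (λ z → 𝟙 (v F.≟ x) * g x y z))) + ∑ (λ x → ∑ (λ y → ∑ (λ z → (𝟙 (v F.≟ y) + 𝟙 (v F.≟ z)) * g x y z)))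
        ≡⟨ cong₂ _+_ select₁ (∑³-+ _ _ _ (λ x y z → ℕ.*-distribʳ-+ (g x y z) (𝟙 (v F.≟ y)) (𝟙 (v F.≟ z)))) ⟩
      ∑ (λ y → ∑ (λ z → g v y z)) + (∑ (λ x → ∑ (λ y → ∑ (λ z → 𝟙 (v F.≟ y) * g x y z))) + ∑ (λ x → ∑ (λ y → ∑ (λ z → 𝟙 (v F.≟ z) * g x y z))))
        ≡⟨ cong (∑ (λ y → ∑ (λ z → g v y z)) +_) (cong₂ _+_ select₂ (∑-cong λ x → ∑-cong λ y → ∑-select (g x y) v)) ⟩
      ∑ (λ y → ∑ (λ z → g v y z)) + (∑ (λ y → ∑ (λ z → g y v z)) + ∑ (λ y → ∑ (λ z → g y z v)))
        ≡⟨ sym (trans (∑²-+ _ _) (cong (∑ (λ y → ∑ (λ z → g v y z)) +_) (∑²-+ _ _))) ⟩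
      ∑ (λ y → ∑ (λ z → g v y z + (g y v z + g y z v)))
        ≡⟨ (∑-cong λ y → ∑-cong λ z → g-ranks v y z) ⟩
      ∑ (λ y → ∑ (λ z → 𝟙 (y F.<? z) * (a v y * (a y z * a v z)))) ∎
      where
      open ≡-Reasoning
      solve : ∀ x p q → x * (p + q) ≡ p * x + q * x
      solve = solve-∀
      ∑²-+ : ∀ (f h : Fin n → Fin n → ℕ) → ∑ (λ y → ∑ (λ z → f y z + h y z)) ≡ ∑ (λ y → ∑ (λ z → f y z)) + ∑ (λ y → ∑ (λ z → h y z))
      ∑²-+ f h = trans (∑-cong λ y → ∑-+ (f y) (h y)) (∑-+ (λ y → ∑ (f y)) (λ y → ∑ (h y)))
      ∑³-+ : ∀ (e f h : Fin n → Fin n → Fin n → ℕ) → (∀ x y z → e x y z ≡ f x y z + h x y z) →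
        ∑ (λ x → ∑ (λ y → ∑ (λ z → e x y z))) ≡ ∑ (λ x → ∑ (λ y → ∑ (λ z → f x y z))) + ∑ (λ x → ∑ (λ y → ∑ (λ z → h x y z)))
      ∑³-+ e f h eq = trans (∑-cong λ x → trans (∑-cong λ y → ∑-cong λ z → eq x y z) (∑²-+ (f x) (h x)))
        (∑-+ (λ x → ∑ (λ y → ∑ (f x y))) (λ x → ∑ (λ y → ∑ (h x y))))
      select₁ : ∑ (λ x → ∑ (λ y → ∑ (λ z → 𝟙 (v F.≟ x) * g x y z))) ≡ ∑ (λ y → ∑ (λ z → g v y z))
      select₁ = trans (∑-cong λ x → trans (∑-cong λ y → ∑-* (𝟙 (v F.≟ x)) (g x y)) (∑-* (𝟙 (v F.≟ x)) (λ y → ∑ (g x y))))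
        (∑-select (λ x → ∑ (λ y → ∑ (g x y))) v)
      select₂ : ∑ (λ x → ∑ (λ y → ∑ (λ z → 𝟙 (v F.≟ y) * g x y z))) ≡ ∑ (λ x → ∑ (λ z → g x v z))
      select₂ = ∑-cong λ x → trans (∑-cong λ y → ∑-* (𝟙 (v F.≟ y)) (g x y)) (∑-select (λ y → ∑ (g x y)) v)

  -- A row sum of T counts the ordered pairs (u, w) that complete `v` to a triangle, so each
  -- triangle on `v` is met in both orders.
  T1≡2△ : ∀ v → T1 v ≡ 2 * △ G v
  T1≡2△ v = begin
    ∑ (λ u → τ v u * a v u)
      ≡⟨ ∑-cong (λ u → trans (ℕ.*-comm (τ v u) (a v u)) (sym (∑-* {n} (a v u) (λ w → a v w * a w u)))) ⟩
    ∑ (λ u → ∑ (λ w → a v u * (a v w * a w u)))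
      ≡⟨ (∑-cong λ u → ∑-cong λ w → cong (a v u *_) (trans (ℕ.*-comm (a v w) _) (cong (_* a v w) (a-sym w u)))) ⟩
    ∑ (λ u → ∑ (λ w → a v u * (a u w * a v w)))
      ≡⟨ ∑-symmetric (λ u w → a v u * (a u w * a v w)) f-sym f-diag ⟩
    2 * ∑ (λ u → ∑ (λ w → 𝟙 (u F.<? w) * (a v u * (a u w * a v w))))
      ≡⟨ cong (2 *_) (sym (△≡∑ v)) ⟩
    2 * △ G v ∎
    where
    open ≡-Reasoning
    f-sym : ∀ u w → a v u * (a u w * a v w) ≡ a v w * (a w u * a v u)
    f-sym u w rewrite a-sym w u = solve (a v u) (a u w) (a v w)
      where
      solve : ∀ p q r → p * (q * r) ≡ r * (q * p)
      solve = solve-∀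
    f-diag : ∀ u → a v u * (a u u * a v u) ≡ 0
    f-diag u rewrite a-diag u = ℕ.*-zeroʳ (a v u)

  -- Incidences of vertices with triangles, counted from the side of the triangles, which have three
  -- corners each.
  ∑△≡3△G : ∑ (λ v → △ G v) ≡ 3 * △G G
  ∑△≡3△G = begin
    ∑ (λ v → △ G v)                                   ≡⟨ ∑-cong △-sum ⟩
    ∑ (λ v → sum (map (s v) (triangles G)))           ≡⟨ ∑-sum s (triangles G) ⟩
    sum (map (λ x → ∑ (λ v → s v x)) (triangles G))   ≡⟨ sum-map-cong (triangles G) (λ x _ → ∑s≡3 x) ⟩
    sum (map (const 3) (triangles G))                 ≡⟨ sum-map-const 3 (triangles G) ⟩
    △G G * 3                                          ≡⟨ ℕ.*-comm (△G G) 3 ⟩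
    3 * △G G                                          ∎
    where
    open ≡-Reasoning
    ∑s≡3 : ∀ x → ∑ (λ v → s v x) ≡ 3
    ∑s≡3 (x , y , z) = trans (∑-+ {n} (λ v → 𝟙 (v F.≟ x)) (λ v → 𝟙 (v F.≟ y) + 𝟙 (v F.≟ z))) (cong₂ _+_ (∑-𝟙 x)
      (trans (∑-+ {n} (λ v → 𝟙 (v F.≟ y)) (λ v → 𝟙 (v F.≟ z))) (cong₂ _+_ (∑-𝟙 y) (∑-𝟙 z))))

  ∑T1≡6△G : ∑ T1 ≡ 6 * △G G
  ∑T1≡6△G = trans (∑-cong T1≡2△) (trans (∑-* 2 (△ G)) (trans (cong (2 *_) ∑△≡3△G) (sym (ℕ.*-assoc 2 3 (△G G)))))

-- The matrix formula over ℤ, reduced to sums of naturals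

module _ where
  open import Data.Integer using (+_)

  module Sumℤ = Algebra.Properties.CommutativeMonoid.Sum ℤ.+-0-commutativeMonoid
  open Sumℤ using () renaming (sum to ∑ℤ)

  ∑ℤ-cong : ∀ {n} {f g : Fin n → ℤ} → (∀ i → f i ≡ g i) → ∑ℤ f ≡ ∑ℤ g
  ∑ℤ-cong {n} = Sumℤ.sum-cong-≗ {n}

  ∑ℤ-pos : ∀ {n} (f : Fin n → ℕ) → ∑ℤ (λ i → + f i) ≡ + ∑ f
  ∑ℤ-pos {zero} f = refl
  ∑ℤ-pos {suc n} f = cong (ℤ._+_ (+ f zero)) (∑ℤ-pos (f ∘ suc))

  ∑ℤ-minus : ∀ {n} (f g : Fin n → ℕ) → ∑ℤ (λ i → + f i ℤ.- + g i) ≡ + ∑ f ℤ.- + ∑ g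
  ∑ℤ-minus {zero} f g = refl
  ∑ℤ-minus {suc n} f g = trans (cong (ℤ._+_ (+ f zero ℤ.- + g zero)) (∑ℤ-minus (f ∘ suc) (g ∘ suc)))
    (solve (+ f zero) (+ g zero) (+ ∑ (f ∘ suc)) (+ ∑ (g ∘ suc)))
    where
    solve : ∀ p q r s → p ℤ.- q ℤ.+ (r ℤ.- s) ≡ p ℤ.+ r ℤ.- (q ℤ.+ s)
    solve = ℤ-Solver.solve-∀

  𝟙-ℤ : ∀ {ℓ} {P : Set ℓ} (d : Dec P) → (if does d then 1ℤ else 0ℤ) ≡ + 𝟙 d
  𝟙-ℤ (yes _) = refl
  𝟙-ℤ (no _) = refl

  -- The coefficient has mixed signs. Its positive and negative parts are kept apart, so that a
  -- whole row sum becomes a single difference of naturals, which is what the machine computes.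
  linear : ∀ {α β ι χ p b i x} → α ≡ + p → β ≡ + b → ι ≡ + i → χ ≡ + x →
    (+ 3 ℤ.* α ℤ.- + 2 ℤ.* β ℤ.+ ι) ℤ.* χ ≡ + (3 ℕ.* (p ℕ.* x) ℕ.+ i ℕ.* x) ℤ.- + (2 ℕ.* (b ℕ.* x))
  linear {p = p} {b} {i} {x} refl refl refl refl =
    trans (solve (+ p) (+ b) (+ i) (+ x)) (sym (cong₂ ℤ._-_ (cong₂ ℤ._+_ (scaled 3 p) (ℤ.pos-* i x)) (scaled 2 b)))
    where
    scaled : ∀ k y → + (k ℕ.* (y ℕ.* x)) ≡ + k ℤ.* (+ y ℤ.* + x)
    scaled k y = trans (ℤ.pos-* k (y ℕ.* x)) (cong (ℤ._*_ (+ k)) (ℤ.pos-* y x))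
    solve : ∀ p q r x → (+ 3 ℤ.* p ℤ.- + 2 ℤ.* q ℤ.+ r) ℤ.* x ≡ + 3 ℤ.* (p ℤ.* x) ℤ.+ r ℤ.* x ℤ.- + 2 ℤ.* (q ℤ.* x)
    solve = ℤ-Solver.solve-∀

  module Cast {n} (G : Graph n) where
    open Counting G

    A≡ : ∀ u v → A G u v ≡ + a u v
    A≡ u v = 𝟙-ℤ (Graph._~?_ G u v)

    T≡ : ∀ u v → T G u v ≡ + t u v
    T≡ u v = trans (cong₂ ℤ._*_ (trans (∑ℤ-cong λ w → trans (cong₂ ℤ._*_ (A≡ u w) (A≡ w v)) (sym (ℤ.pos-* (a u w) (a w v))))
      (∑ℤ-pos λ w → a u w ℕ.* a w v)) (A≡ u v)) (sym (ℤ.pos-* (τ u v) (a u v)))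

    T≢0⇒t≢0 : ∀ {u v} → T G u v ≢ 0ℤ → t u v ≢ 0
    T≢0⇒t≢0 {u} {v} T≢ t≡ = T≢ (trans (T≡ u v) (cong +_ t≡))

    t≢0⇒T≢0 : ∀ {u v} → t u v ≢ 0 → T G u v ≢ 0ℤ
    t≢0⇒T≢0 {u} {v} t≢ T≡0 = t≢ (ℤ.+-injective (trans (sym (T≡ u v)) T≡0))

    support : ∀ u v → Dec (t u v ≢ 0)
    support u v = ¬? (t u v ℕ.≟ 0)

    Ť≡ : ∀ u v → Ť G u v ≡ + 𝟙 (support u v)
    Ť≡ u v = go (T G u v ℤ.≟ 0ℤ)
      where
      go : (d : Dec (T G u v ≡ 0ℤ)) → (if does d then 0ℤ else 1ℤ) ≡ + 𝟙 (support u v)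
      go (yes T≡0) = cong +_ (sym (𝟙-no (support u v) λ t≢ → t≢0⇒T≢0 t≢ T≡0))
      go (no T≢0) = cong +_ (sym (𝟙-yes (support u v) (T≢0⇒t≢0 T≢0)))

    T𝟏≡ : ∀ v → T𝟏 G v ≡ + T1 v
    T𝟏≡ v = trans (∑ℤ-cong λ u → trans (ℤ.*-identityʳ (T G v u)) (T≡ v u)) (∑ℤ-pos (t v))

    denominator≡ : denominator G ≡ + ∑ T1
    denominator≡ = trans (∑ℤ-cong λ v → trans (ℤ.*-identityˡ (T𝟏 G v)) (T𝟏≡ v)) (∑ℤ-pos T1)

    S₁ S₂ : Fin n → ℕ
    S₁ v = ∑ (λ u → a v u ℕ.* T1 u)
    S₂ v = ∑ (λ u → 𝟙 (support v u) ℕ.* T1 u)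

    numerator≡ : ∀ v → numerator G v ≡ + (T1 v ℕ.+ 3 ℕ.* S₁ v) ℤ.- + (2 ℕ.* S₂ v)
    numerator≡ v = begin
      numerator G v
        ≡⟨ ∑ℤ-cong term ⟩
      ∑ℤ (λ u → + (3 ℕ.* (a v u ℕ.* T1 u) ℕ.+ 𝟙 (v F.≟ u) ℕ.* T1 u) ℤ.- + (2 ℕ.* (𝟙 (support v u) ℕ.* T1 u)))
        ≡⟨ ∑ℤ-minus (λ u → 3 ℕ.* (a v u ℕ.* T1 u) ℕ.+ 𝟙 (v F.≟ u) ℕ.* T1 u) (λ u → 2 ℕ.* (𝟙 (support v u) ℕ.* T1 u)) ⟩
      + ∑ (λ u → 3 ℕ.* (a v u ℕ.* T1 u) ℕ.+ 𝟙 (v F.≟ u) ℕ.* T1 u) ℤ.- + ∑ (λ u → 2 ℕ.* (𝟙 (support v u) ℕ.* T1 u))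
        ≡⟨ cong₂ (λ p q → + p ℤ.- + q) plus (∑-* 2 (λ u → 𝟙 (support v u) ℕ.* T1 u)) ⟩
      + (T1 v ℕ.+ 3 ℕ.* S₁ v) ℤ.- + (2 ℕ.* S₂ v) ∎
      where
      open ≡-Reasoning
      term : ∀ u → (+ 3 ℤ.* A G v u ℤ.- + 2 ℤ.* Ť G v u ℤ.+ Id v u) ℤ.* T𝟏 G u ≡
        + (3 ℕ.* (a v u ℕ.* T1 u) ℕ.+ 𝟙 (v F.≟ u) ℕ.* T1 u) ℤ.- + (2 ℕ.* (𝟙 (support v u) ℕ.* T1 u))
      term u = linear (A≡ v u) (Ť≡ v u) (𝟙-ℤ (v F.≟ u)) (T𝟏≡ u)
      plus : ∑ (λ u → 3 ℕ.* (a v u ℕ.* T1 u) ℕ.+ 𝟙 (v F.≟ u) ℕ.* T1 u) ≡ T1 v ℕ.+ 3 ℕ.* S₁ v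
      plus = trans (∑-+ (λ u → 3 ℕ.* (a v u ℕ.* T1 u)) (λ u → 𝟙 (v F.≟ u) ℕ.* T1 u))
        (trans (cong₂ ℕ._+_ (∑-* 3 (λ u → a v u ℕ.* T1 u)) (∑-select T1 v)) (ℕ.+-comm (3 ℕ.* S₁ v) (T1 v)))

    S₃ : Fin n → ℕ
    S₃ v = sum (map T1 (N∖N△ G v))

    -- `τ v u` is a sum of products of indicators, hence zero exactly when no `w` is a common
    -- neighbour. The factor `a v u` has to stay, because two vertices that are not adjacent may
    -- share neighbours.
    support-≡ : ∀ u v → 𝟙 (support v u) ≡ a v u ℕ.* 𝟙 (commonNeighbour? G u v)
    support-≡ u v = trans (𝟙-⇔ (support v u) (Graph._~?_ G v u ×-dec commonNeighbour? G u v) to from)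
      (𝟙-× (Graph._~?_ G v u) (commonNeighbour? G u v))
      where
      open Graph G
      to : t v u ≢ 0 → v ~ u × ∃[ w ] (w ~ u × w ~ v)
      to t≢ with v ~? u
      ... | no _ = ⊥-elim (t≢ (ℕ.*-zeroʳ (τ v u)))
      ... | yes v~u = v~u , common (commonNeighbour? G u v)
        where
        common : Dec (∃[ w ] (w ~ u × w ~ v)) → ∃[ w ] (w ~ u × w ~ v)
        common (yes c) = c
        common (no ∄) = ⊥-elim (t≢ (cong (ℕ._* 1) (∑≡0 λ w → zero-term w)))
          where
          zero-term : ∀ w → a v w ℕ.* a w u ≡ 0
          zero-term w = trans (cong₂ ℕ._*_ (a-sym v w) refl) (trans (sym (𝟙-× (w ~? v) (w ~? u)))
            (𝟙-no ((w ~? v) ×-dec (w ~? u)) λ (p , q) → ∄ (w , q , p)))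
      from : v ~ u × ∃[ w ] (w ~ u × w ~ v) → t v u ≢ 0
      from (v~u , w , w~u , w~v) t≡0 = ℕ.<⇒≢ 0<t (sym t≡0)
        where
        1≤τ : 1 ℕ.≤ τ v u
        1≤τ = ℕ.≤-trans (ℕ.≤-reflexive (sym (cong₂ ℕ._*_ (𝟙-yes (v ~? w) (~-sym w~v)) (𝟙-yes (w ~? u) w~u))))
          (term≤∑ (λ w → a v w ℕ.* a w u) w)
        0<t : 0 ℕ.< t v u
        0<t = ℕ.≤-trans 1≤τ (ℕ.≤-reflexive (sym (trans (cong (τ v u ℕ.*_) (𝟙-yes (v ~? u) v~u)) (ℕ.*-identityʳ _))))

    sum-N△ : ∀ f v → sum (map f (N△ G v)) ≡ ∑ (λ u → 𝟙 (support v u) ℕ.* f u)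
    sum-N△ f v = trans (sum-filter (λ u → commonNeighbour? G u v) f (N G v)) (trans (sum-N _ v)
      (∑-cong λ u → trans (sym (ℕ.*-assoc (a v u) _ (f u))) (cong (ℕ._* f u) (sym (support-≡ u v)))))

    sum-N-split : ∀ f v → sum (map f (N G v)) ≡ sum (map f (N△ G v)) ℕ.+ sum (map f (N∖N△ G v))
    sum-N-split f v = go (N G v)
      where
      go : ∀ us → sum (map f us) ≡ sum (map f (filter (λ u → commonNeighbour? G u v) us))
        ℕ.+ sum (map f (filter (λ u → ¬? (commonNeighbour? G u v)) us))
      go [] = refl
      go (u ∷ us) with does (commonNeighbour? G u v)
      ... | true = trans (cong (f u ℕ.+_) (go us)) (sym (ℕ.+-assoc (f u) _ _))
      ... | false = trans (cong (f u ℕ.+_) (go us)) (solve (f u) (sum (map f (filter (λ u → commonNeighbour? G u v) us))) _)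
        where
        solve : ∀ p q r → p ℕ.+ (q ℕ.+ r) ≡ q ℕ.+ (p ℕ.+ r)
        solve = solve-∀

    S₁≡S₂+S₃ : ∀ v → S₁ v ≡ S₂ v ℕ.+ S₃ v
    S₁≡S₂+S₃ v = trans (sym (sum-N T1 v)) (trans (sum-N-split T1 v) (cong (ℕ._+ S₃ v) (sum-N△ T1 v)))

    -- The value left by the machine, with truncated subtraction. Nothing is cut off: S₂ is a part
    -- of S₁, hence 2 S₂ ≤ 3 S₁. `net≡` removes the subtraction altogether.
    net : Fin n → ℕ
    net v = T1 v ℕ.+ 3 ℕ.* S₁ v ℕ.∸ 2 ℕ.* S₂ v

    net≡ : ∀ v → net v ≡ T1 v ℕ.+ S₂ v ℕ.+ 3 ℕ.* S₃ v
    net≡ v = trans (cong (ℕ._∸ 2 ℕ.* S₂ v) (trans (cong (λ s → T1 v ℕ.+ 3 ℕ.* s) (S₁≡S₂+S₃ v)) (solve (T1 v) (S₂ v) (S₃ v))))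
      (ℕ.m+n∸n≡m (T1 v ℕ.+ S₂ v ℕ.+ 3 ℕ.* S₃ v) (2 ℕ.* S₂ v))
      where
      solve : ∀ x p q → x ℕ.+ 3 ℕ.* (p ℕ.+ q) ≡ x ℕ.+ p ℕ.+ 3 ℕ.* q ℕ.+ 2 ℕ.* p
      solve = solve-∀

    numerator≡net : ∀ v → numerator G v ≡ + net v
    numerator≡net v = trans (numerator≡ v) (trans (ℤ.m-n≡m⊖n (T1 v ℕ.+ 3 ℕ.* S₁ v) (2 ℕ.* S₂ v)) (ℤ.⊖-≥ le))
      where
      le : 2 ℕ.* S₂ v ℕ.≤ T1 v ℕ.+ 3 ℕ.* S₁ v
      le = ℕ.≤-trans (ℕ.*-mono-≤ (s≤s (s≤s (z≤n {1}))) (ℕ.≤-trans (ℕ.m≤m+n (S₂ v) (S₃ v)) (ℕ.≤-reflexive (sym (S₁≡S₂+S₃ v)))))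
        (ℕ.m≤n+m _ (T1 v))

    -- The weights 1 and 3 are the weights 1/3 and 1 of `TC` scaled by 3. The factor 2 comes from
    -- `T1≡2△`; together they give the 6 of the denominator.
    net≡2* : ∀ v → net v ≡ 2 ℕ.* (sum (map (△ G) (N△[_] G v)) ℕ.+ 3 ℕ.* sum (map (△ G) (N∖N△ G v)))
    net≡2* v = begin
      net v
        ≡⟨ net≡ v ⟩
      T1 v ℕ.+ S₂ v ℕ.+ 3 ℕ.* S₃ v
        ≡⟨ cong₂ (λ p q → T1 v ℕ.+ p ℕ.+ 3 ℕ.* q) (trans (sym (sum-N△ T1 v)) (double (N△ G v))) (double (N∖N△ G v)) ⟩
      T1 v ℕ.+ 2 ℕ.* sum (map (△ G) (N△ G v)) ℕ.+ 3 ℕ.* (2 ℕ.* sum (map (△ G) (N∖N△ G v)))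
        ≡⟨ cong (λ p → p ℕ.+ 2 ℕ.* sum (map (△ G) (N△ G v)) ℕ.+ 3 ℕ.* (2 ℕ.* sum (map (△ G) (N∖N△ G v)))) (T1≡2△ v) ⟩
      2 ℕ.* △ G v ℕ.+ 2 ℕ.* sum (map (△ G) (N△ G v)) ℕ.+ 3 ℕ.* (2 ℕ.* sum (map (△ G) (N∖N△ G v)))
        ≡⟨ solve (△ G v) (sum (map (△ G) (N△ G v))) (sum (map (△ G) (N∖N△ G v))) ⟩
      2 ℕ.* (△ G v ℕ.+ sum (map (△ G) (N△ G v)) ℕ.+ 3 ℕ.* sum (map (△ G) (N∖N△ G v))) ∎
      where
      open ≡-Reasoning
      double : ∀ us → sum (map T1 us) ≡ 2 ℕ.* sum (map (△ G) us)
      double us = trans (sum-map-cong us λ u _ → T1≡2△ u) (sum-map-* 2 (△ G) us)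
      solve : ∀ x p q → 2 ℕ.* x ℕ.+ 2 ℕ.* p ℕ.+ 3 ℕ.* (2 ℕ.* q) ≡ 2 ℕ.* (x ℕ.+ p ℕ.+ 3 ℕ.* q)
      solve = solve-∀

-- From quotients of naturals to the rational centrality

module _ where
  open import Data.Integer using (+_)

  -- Identities of fractions are proved among unnormalised rationals, where equality is
  -- cross-multiplication and no gcd intervenes.
  toℚᵘ-/ : ∀ k d → toℚᵘ (+ k ℚ./ suc d) ℚᵘ.≃ mkℚᵘ (+ k) d
  toℚᵘ-/ k d = ℚ.toℚᵘ-fromℚᵘ (mkℚᵘ (+ k) d)

  toℚᵘ-÷ : ∀ q d {p} → toℚᵘ q ℚᵘ.≃ p → toℚᵘ (q ÷ suc d) ℚᵘ.≃ p ℚᵘ.* mkℚᵘ 1ℤ d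
  toℚᵘ-÷ q d e = ℚᵘ.≃-trans (ℚ.toℚᵘ-homo-* q (1ℤ ℚ./ suc d)) (ℚᵘ.*-cong e (toℚᵘ-/ 1 d))

  fromℕ-* : ∀ j k → fromℕ j ℚ.* fromℕ k ≡ fromℕ (j ℕ.* k)
  fromℕ-* j k = ℚ.toℚᵘ-injective (ℚᵘ.≃-trans (ℚ.toℚᵘ-homo-* (fromℕ j) (fromℕ k))
    (ℚᵘ.≃-trans (ℚᵘ.*-cong (toℚᵘ-/ j 0) (toℚᵘ-/ k 0))
    (ℚᵘ.≃-trans (*≡* (cong (ℤ._* + 1) (sym (ℤ.pos-* j k)))) (ℚᵘ.≃-sym (toℚᵘ-/ (j ℕ.* k) 0)))))

  fromℕ-mono : ∀ {j k} → j ℕ.≤ k → fromℕ j ℚ.≤ fromℕ k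
  fromℕ-mono {j} {k} j≤k = ℚ.toℚᵘ-cancel-≤ (ℚᵘ.≤-respˡ-≃ (ℚᵘ.≃-sym (toℚᵘ-/ j 0))
    (ℚᵘ.≤-respʳ-≃ (ℚᵘ.≃-sym (toℚᵘ-/ k 0)) (*≤* (ℤ.*-monoʳ-≤-nonNeg (+ 1) (ℤ.+≤+ j≤k)))))

  fromℕ-injective : ∀ {j k} → fromℕ j ≡ fromℕ k → j ≡ k
  fromℕ-injective {j} {k} e with ℚᵘ.≃-trans (ℚᵘ.≃-sym (toℚᵘ-/ j 0)) (ℚᵘ.≃-trans (ℚᵘ.≃-reflexive (cong toℚᵘ e)) (toℚᵘ-/ k 0))
  ... | *≡* h = ℤ.+-injective (trans (sym (ℤ.*-identityʳ (+ j))) (trans h (ℤ.*-identityʳ (+ k))))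

  *-÷ : ∀ k q → 0 ℕ.< k → fromℕ k ℚ.* (q ÷ k) ≡ q
  *-÷ (suc k) q _ = trans (ℚ.*-comm (fromℕ (suc k)) (q ÷ suc k)) (trans (ℚ.*-assoc q (1ℤ ℚ./ suc k) (fromℕ (suc k)))
    (trans (cong (q ℚ.*_) inverse) (ℚ.*-identityʳ q)))
    where
    inverse : (1ℤ ℚ./ suc k) ℚ.* fromℕ (suc k) ≡ ℚ.1ℚ
    inverse = ℚ.toℚᵘ-injective (ℚᵘ.≃-trans (ℚ.toℚᵘ-homo-* (1ℤ ℚ./ suc k) (fromℕ (suc k)))
      (ℚᵘ.≃-trans (ℚᵘ.*-cong (toℚᵘ-/ 1 k) (toℚᵘ-/ (suc k) 0)) (*≡* (solve (+ suc k)))))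
      where
      solve : ∀ x → + 1 ℤ.* x ℤ.* + 1 ≡ + 1 ℤ.* (x ℤ.* + 1)
      solve = ℤ-Solver.solve-∀

  -- The sparse output lists exactly the non-zero centralities, while the machine tests the
  -- numerator; this makes the two conditions agree.
  ÷-≡0 : ∀ k d → 0 ℕ.< d → fromℕ k ÷ d ≡ 0ℚ → k ≡ 0
  ÷-≡0 k d 0<d e = fromℕ-injective (trans (sym (*-÷ d (fromℕ k) 0<d)) (trans (cong (fromℕ d ℚ.*_) e) (ℚ.*-zeroʳ (fromℕ d))))

  0÷ : ∀ d → fromℕ 0 ÷ d ≡ 0ℚ
  0÷ zero = refl
  0÷ (suc d) = ℚ.*-zeroˡ (1ℤ ℚ./ suc d)

  -- Expanding the right-hand fraction by 6 gives the left-hand one. For `g` zero both are 0 by the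
  -- convention of `÷`.
  centrality-fraction : ∀ s r g → fromℕ (2 ℕ.* (s ℕ.+ 3 ℕ.* r)) ÷ (6 ℕ.* g) ≡ ((+ 1 ℚ./ 3) ℚ.* fromℕ s ℚ.+ fromℕ r) ÷ g
  centrality-fraction s r zero = refl
  centrality-fraction s r (suc g) = ℚ.toℚᵘ-injective (ℚᵘ.≃-trans (toℚᵘ-÷ (fromℕ (2 ℕ.* (s ℕ.+ 3 ℕ.* r))) _ (toℚᵘ-/ (2 ℕ.* (s ℕ.+ 3 ℕ.* r)) 0))
    (ℚᵘ.≃-trans (*≡* cross) (ℚᵘ.≃-sym (toℚᵘ-÷ ((+ 1 ℚ./ 3) ℚ.* fromℕ s ℚ.+ fromℕ r) g
      (ℚᵘ.≃-trans (ℚ.toℚᵘ-homo-+ ((+ 1 ℚ./ 3) ℚ.* fromℕ s) (fromℕ r)) (ℚᵘ.+-cong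
        (ℚᵘ.≃-trans (ℚ.toℚᵘ-homo-* (+ 1 ℚ./ 3) (fromℕ s)) (ℚᵘ.*-cong (toℚᵘ-/ 1 2) (toℚᵘ-/ s 0))) (toℚᵘ-/ r 0)))))))
    where
    cross : (+ (2 ℕ.* (s ℕ.+ 3 ℕ.* r)) ℤ.* + 1) ℤ.* ℚᵘ.↧ ((mkℚᵘ (+ 1) 2 ℚᵘ.* mkℚᵘ (+ s) 0 ℚᵘ.+ mkℚᵘ (+ r) 0) ℚᵘ.* mkℚᵘ 1ℤ g) ≡
      ℚᵘ.↥ ((mkℚᵘ (+ 1) 2 ℚᵘ.* mkℚᵘ (+ s) 0 ℚᵘ.+ mkℚᵘ (+ r) 0) ℚᵘ.* mkℚᵘ 1ℤ g) ℤ.* ℚᵘ.↧ (mkℚᵘ (+ (2 ℕ.* (s ℕ.+ 3 ℕ.* r))) 0 ℚᵘ.* mkℚᵘ 1ℤ (ℕ.pred (6 ℕ.* suc g)))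
    cross = trans (cong₂ ℤ._*_ (cong (ℤ._* + 1) (trans (ℤ.pos-* 2 (s ℕ.+ 3 ℕ.* r)) (cong (λ x → + 2 ℤ.* (+ s ℤ.+ x)) (ℤ.pos-* 3 r)))) (ℤ.pos-* 3 (suc g)))
      (trans (solve (+ s) (+ r) (+ suc g)) (cong (λ x → ((+ 1 ℤ.* + s) ℤ.* + 1 ℤ.+ + r ℤ.* + 3) ℤ.* + 1 ℤ.* x)
        (sym (trans (cong +_ (ℕ.+-identityʳ (6 ℕ.* suc g))) (ℤ.pos-* 6 (suc g))))))
      where
      solve : ∀ s r g → (+ 2 ℤ.* (s ℤ.+ + 3 ℤ.* r)) ℤ.* + 1 ℤ.* (+ 3 ℤ.* g) ≡ ((+ 1 ℤ.* s) ℤ.* + 1 ℤ.+ r ℤ.* + 3) ℤ.* + 1 ℤ.* (+ 6 ℤ.* g)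
      solve = ℤ-Solver.solve-∀

-- A program logic with time credits

module Logic {R K : ℕ} (L : Limits) where

  private variable
    σ : State R K
    c c′ : Cmd R K
    b b′ : ℕ
    x y i : Fin R
    e : Fin K
    k l w : ℕ
    o : Op
    Q : ℕ → State R K → Set

  -- With b credits, c halts; the postcondition also sees the credits left over.
  record Runs (c : Cmd R K) (σ : State R K) (b : ℕ) (Q : ℕ → State R K → Set) : Set where
    constructor runs
    field
      {σ′}  : State R K
      {t r} : ℕ
      run   : L ⊢ c , σ ⇓[ t ] σ′
      time  : t + r ≤ b
      post  : Q r σ′

  weaken : b ≤ b′ → Runs c σ b Q → Runs c σ b′ Q
  weaken b≤b′ (runs r t q) = runs r (ℕ.≤-trans t b≤b′) q

  skip-rule : Q b σ → Runs skip σ (suc b) Q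
  skip-rule q = runs ⇓skip ℕ.≤-refl q

  lit-rule : k < words L → Q b (setReg x k σ) → Runs (x ≔ lit k) σ (suc b) Q
  lit-rule k< q = runs (⇓assign ↦lit k<) ℕ.≤-refl q

  -- The equations let the new state hold a chosen expression `w` instead of the computed one, so
  -- that states mention list lengths and partial sums.
  op-rule : reg σ y ≡ k → reg σ i ≡ l → ⟦ o ⟧ k l ≡ w → w < words L →
            Q b (setReg x w σ) → Runs (x ≔ op o y i) σ (suc b) Q
  op-rule refl refl refl w< q = runs (⇓assign ↦op w<) ℕ.≤-refl q

  load-rule : reg σ i ≡ k → k < cells L → arr σ e k ≡ w → w < words L →
              Q b (setReg x w σ) → Runs (x ≔ load e i) σ (suc b) Q
  load-rule refl k< refl w< q = runs (⇓assign (↦load k<) w<) ℕ.≤-refl q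

  store-rule : reg σ i ≡ k → k < cells L → reg σ x ≡ w →
               Q b (setArr e k w σ) → Runs (store e i x) σ (suc b) Q
  store-rule refl k< refl q = runs (⇓store k<) ℕ.≤-refl q

  -- The run of `c′`, with the credits that `c` leaves over, is the postcondition of `c`. A program
  -- is thus verified in the order of its text, without intermediate assertions.
  seq : Runs c σ b (λ b′ σ′ → Runs c′ σ′ b′ Q) → Runs (c ⨾ c′) σ b Q
  seq (runs {t = t} r h (runs {t = t′} {r = s} r′ h′ q)) = runs (⇓seq r r′)
    (ℕ.≤-trans (ℕ.≤-reflexive (ℕ.+-assoc t t′ s)) (ℕ.≤-trans (ℕ.+-monoʳ-≤ t h′) h)) q

  then-rule : reg σ x ≡ suc k → Runs c σ b Q → Runs (if≢0 x then c else c′) σ (suc b) Q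
  then-rule e (runs r h q) = runs (⇓then (λ z → ℕ.0≢1+n (trans (sym z) e)) r) (s≤s h) q

  else-rule : reg σ x ≡ 0 → Runs c′ σ b Q → Runs (if≢0 x then c else c′) σ (suc b) Q
  else-rule e (runs r h q) = runs (⇓else e r) (s≤s h) q

  exit-rule : reg σ x ≡ 0 → Q b σ → Runs (while≢0 x loop c) σ (suc b) Q
  exit-rule e q = runs (⇓exit e) ℕ.≤-refl q

  -- A single unrolling in place of an invariant rule: the rest of the loop is the postcondition of
  -- the body, and each loop is proved by induction on the list or counter that it runs through.
  loop-rule : reg σ x ≡ suc k → Runs c σ b (λ b′ σ′ → Runs (while≢0 x loop c) σ′ b′ Q) →
              Runs (while≢0 x loop c) σ (suc b) Q
  loop-rule e (runs {t = t} r h (runs {t = t′} {r = s} r′ h′ q)) =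
    runs (⇓loop (λ z → ℕ.0≢1+n (trans (sym z) e)) r r′)
      (s≤s (ℕ.≤-trans (ℕ.≤-reflexive (ℕ.+-assoc t t′ s)) (ℕ.≤-trans (ℕ.+-monoʳ-≤ t h′) h))) q

  -- A syntactic over-approximation with boolean values: for a concrete command, `refl` proves that
  -- a register is left alone.
  writesReg : Cmd R K → Fin R → Bool
  writesReg skip x = false
  writesReg (y ≔ e) x = does (x F.≟ y)
  writesReg (store a i y) x = false
  writesReg (c ⨾ c′) x = writesReg c x ∨ writesReg c′ x
  writesReg (if≢0 y then c else c′) x = writesReg c x ∨ writesReg c′ x
  writesReg (while≢0 y loop c) x = writesReg c x

  writesArr : Cmd R K → Fin K → Bool
  writesArr skip a = false
  writesArr (y ≔ e) a = false
  writesArr (store e i y) a = does (a F.≟ e)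
  writesArr (c ⨾ c′) a = writesArr c a ∨ writesArr c′ a
  writesArr (if≢0 y then c else c′) a = writesArr c a ∨ writesArr c′ a
  writesArr (while≢0 y loop c) a = writesArr c a

  private
    ∨-false : ∀ {p q} → p ∨ q ≡ false → p ≡ false × q ≡ false
    ∨-false {false} {false} _ = refl , refl

    does-false : ∀ {m} (x y : Fin m) → does (x F.≟ y) ≡ false → x ≢ y
    does-false x y e x≡y with trans (sym e) (dec-true (x F.≟ y) x≡y)
    ... | ()

  regs-kept : ∀ {t σ σ′} → L ⊢ c , σ ⇓[ t ] σ′ → ∀ x → writesReg c x ≡ false → reg σ′ x ≡ reg σ x
  regs-kept ⇓skip x h = refl
  regs-kept (⇓assign {σ} {y} _ _) x h = updateAt-minimal x y (reg σ) (does-false x y h)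
  regs-kept (⇓store _) x h = refl
  regs-kept (⇓seq r r′) x h =
    let h₁ , h₂ = ∨-false h in trans (regs-kept r′ x h₂) (regs-kept r x h₁)
  regs-kept (⇓then _ r) x h = regs-kept r x (proj₁ (∨-false h))
  regs-kept {c = if≢0 _ then c else _} (⇓else _ r) x h = regs-kept r x (proj₂ (∨-false {writesReg c x} h))
  regs-kept (⇓loop _ r r′) x h = trans (regs-kept r′ x h) (regs-kept r x h)
  regs-kept (⇓exit _) x h = refl

  arrs-kept : ∀ {t σ σ′} → L ⊢ c , σ ⇓[ t ] σ′ → ∀ a → writesArr c a ≡ false → arr σ′ a ≡ arr σ a
  arrs-kept ⇓skip a h = refl
  arrs-kept (⇓assign _ _) a h = refl
  arrs-kept (⇓store {σ} {e} _) a h = updateAt-minimal a e (arr σ) (does-false a e h)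
  arrs-kept (⇓seq r r′) a h =
    let h₁ , h₂ = ∨-false h in trans (arrs-kept r′ a h₂) (arrs-kept r a h₁)
  arrs-kept (⇓then _ r) a h = arrs-kept r a (proj₁ (∨-false h))
  arrs-kept {c = if≢0 _ then c else _} (⇓else _ r) a h = arrs-kept r a (proj₂ (∨-false {writesArr c a} h))
  arrs-kept (⇓loop _ r r′) a h = trans (arrs-kept r′ a h) (arrs-kept r a h)
  arrs-kept (⇓exit _) a h = refl

  record Frame (c : Cmd R K) (σ σ′ : State R K) : Set where
    constructor frame
    field
      reg≡ : ∀ x → writesReg c x ≡ false → reg σ′ x ≡ reg σ x
      arr≡ : ∀ a → writesArr c a ≡ false → arr σ′ a ≡ arr σ a

  -- Lets the lemma about a loop state only what the loop computes; what it preserves is read off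
  -- the program text afterwards.
  framed : Runs c σ b (λ b′ σ′ → Frame c σ σ′ → Q b′ σ′) → Runs c σ b Q
  framed (runs r h q) = runs r h (q (frame (regs-kept r) (arrs-kept r)))

-- Vectors and lists as contents of arrays

write : (ℕ → ℕ) → ℕ → ℕ → ℕ → ℕ
write f i w j = if does (j ℕ.≟ i) then w else f j

write-same : ∀ f i w → write f i w i ≡ w
write-same f i w = cong (if_then w else f i) (dec-true (i ℕ.≟ i) refl)

write-other : ∀ f i w {j} → j ≢ i → write f i w j ≡ f j
write-other f i w {j} j≢i = cong (if_then w else f j) (dec-false (j ℕ.≟ i) j≢i)

infixl 6 _[_↦_]
_[_↦_] : ∀ {n} → (Fin n → ℕ) → Fin n → ℕ → Fin n → ℕ
(F [ u ↦ w ]) v = if does (v F.≟ u) then w else F v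

_holds_ : ∀ {n} → (ℕ → ℕ) → (Fin n → ℕ) → Set
f holds F = ∀ v → f (toℕ v) ≡ F v

-- `write` is the function that `setArr` installs, so this applies to machine states by computation
-- alone.
holds-write : ∀ {n w} {F : Fin n → ℕ} f u → f holds F → write f (toℕ u) w holds (F [ u ↦ w ])
holds-write {w = w} f u h v with v F.≟ u
... | yes refl = write-same f (toℕ v) w
... | no v≢u = trans (write-other f (toℕ u) w (v≢u ∘ F.toℕ-injective)) (h v)

-- The values of the elements of the list at the indices length - 1, …, 0 of f.
Stored : ∀ {ℓ} {B : Set ℓ} → (ℕ → ℕ) → (B → ℕ) → List B → Set
Stored f val [] = ⊤
Stored f val (x ∷ xs) = f (length xs) ≡ val x × Stored f val xs

module _ {ℓ} {B : Set ℓ} {val : B → ℕ} where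

  stored-ext : ∀ {f g} (xs : List B) → (∀ j → j < length xs → g j ≡ f j) → Stored f val xs → Stored g val xs
  stored-ext [] h s = tt
  stored-ext (x ∷ xs) h (e , s) = trans (h _ (ℕ.n<1+n _)) e , stored-ext xs (λ j j< → h j (ℕ.m<n⇒m<1+n j<)) s

  stored-push : ∀ {f w} x (xs : List B) → w ≡ val x → Stored f val xs → Stored (write f (length xs) w) val (x ∷ xs)
  stored-push {f} {w} x xs e s = trans (write-same f (length xs) w) e ,
    stored-ext xs (λ j j< → write-other f (length xs) w (ℕ.<⇒≢ j<)) s

  -- A loop that counts down reads the last entry first, whereas `lookup` numbers the entries from
  -- the front; hence the reversal.
  lookup⇒stored : ∀ {f} (xs : List B) → (∀ p → f (toℕ p) ≡ val (lookup xs p)) → Stored f val (reverse xs)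
  lookup⇒stored {f} xs h = go xs [] h tt
    where
    go : ∀ xs acc → (∀ p → f (length acc + toℕ p) ≡ val (lookup xs p)) → Stored f val acc → Stored f val (xs ʳ++ acc)
    go [] acc h s = s
    go (x ∷ xs) acc h s = go xs (x ∷ acc)
      (λ p → trans (cong f (sym (ℕ.+-suc (length acc) (toℕ p)))) (h (suc p)))
      (trans (cong f (sym (ℕ.+-identityʳ _))) (h zero) , s)

  stored⇒lookup : ∀ {f} (xs : List B) → Stored f val xs → ∀ p → f (toℕ p) ≡ val (lookup (reverse xs) p)
  stored⇒lookup {f} xs s = go xs [] s (λ ())
    where
    go : ∀ xs acc → Stored f val xs → (∀ p → f (length xs + toℕ p) ≡ val (lookup acc p)) →
         ∀ p → f (toℕ p) ≡ val (lookup (xs ʳ++ acc) p)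
    go [] acc s h = h
    go (x ∷ xs) acc (e , s) h = go xs (x ∷ acc) s λ
      { zero → trans (cong f (ℕ.+-identityʳ _)) e
      ; (suc p) → trans (cong f (ℕ.+-suc (length xs) (toℕ p))) (h p) }

-- The program

R K : ℕ
R = 17
K = 14

Command : Set
Command = Cmd (2 + R) (3 + K)

-- reg-one holds 1 throughout and reg-zero is never written.
reg-nnz reg-one reg-zero reg-p reg-u reg-v reg-x reg-y reg-q reg-r
  reg-count reg-du reg-dv reg-k reg-den reg-two reg-three reg-out : Fin (2 + R)
reg-nnz   = F.# 1
reg-one   = F.# 2
reg-zero  = F.# 3
reg-p     = F.# 4
reg-u     = F.# 5
reg-v     = F.# 6
reg-x     = F.# 7
reg-y     = F.# 8
reg-q     = F.# 9
reg-r     = F.# 10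
reg-count = F.# 11
reg-du    = F.# 12
reg-dv    = F.# 13
reg-k     = F.# 14
reg-den   = F.# 15
reg-two   = F.# 16
reg-three = F.# 17
reg-out   = F.# 18

rows cols vals head next deg mark done rowsT colsT valsT ones arrT1 num inds nums dens : Fin (3 + K)
rows  = F.# 0
cols  = F.# 1
vals  = F.# 2
head  = F.# 3
next  = F.# 4
deg   = F.# 5
mark  = F.# 6
done  = F.# 7
rowsT = F.# 8
colsT = F.# 9
valsT = F.# 10
ones  = F.# 11
arrT1 = F.# 12
num   = F.# 13
inds  = F.# 14
nums  = F.# 15
dens  = F.# 16

move : Fin (2 + R) → Fin (2 + R) → Command
move x y = x ≔ op add y reg-zero

-- The counter is decremented before the body, so that inside the body it is both the index of the
-- current entry and the number of entries still to come, as in `Stored`. `loopDown` is separate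
-- because the inductions concern the loop alone.
downFrom : Fin (2 + R) → Command → Command
loopDown : Command → Command
loopDown c = while≢0 reg-p loop (reg-p ≔ op monus reg-p reg-one ⨾ c)
downFrom y c = move reg-p y ⨾ loopDown c

-- The neighbours of v form a linked list: head[v] and next[p] are 1 + the
-- index of an entry in row v, or 0 at the end of the list.
link setMarks count visitNeighbour visit : Command
link =
  reg-x ≔ op add reg-p reg-one ⨾
  reg-u ≔ load rows reg-p ⨾
  reg-y ≔ load head reg-u ⨾
  store next reg-p reg-y ⨾
  store head reg-u reg-x ⨾
  reg-y ≔ load deg reg-u ⨾
  reg-y ≔ op add reg-y reg-one ⨾
  store deg reg-u reg-y
setMarks =
  while≢0 reg-q loop (
    reg-q ≔ op monus reg-q reg-one ⨾
    reg-y ≔ load cols reg-q ⨾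
    store mark reg-y reg-x ⨾
    reg-q ≔ load next reg-q)
count =
  while≢0 reg-r loop (
    reg-r ≔ op monus reg-r reg-one ⨾
    reg-y ≔ load cols reg-r ⨾
    reg-y ≔ load mark reg-y ⨾
    reg-count ≔ op add reg-count reg-y ⨾
    reg-r ≔ load next reg-r)

emit : Fin (2 + R) → Fin (2 + R) → Command
emit i j =
  store rowsT reg-k i ⨾
  store colsT reg-k j ⨾
  store valsT reg-k reg-count ⨾
  reg-k ≔ op add reg-k reg-one

-- With the neighbours of v marked, the entries (v , u) and (u , v) of T are
-- computed by scanning the shorter of the lists of u and v.
visitNeighbour =
  reg-q ≔ op monus reg-q reg-one ⨾
  reg-u ≔ load cols reg-q ⨾
  reg-q ≔ load next reg-q ⨾
  reg-du ≔ load deg reg-u ⨾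
  reg-x ≔ op monus reg-du reg-dv ⨾
  (if≢0 reg-x then skip else (
    reg-count ≔ lit 0 ⨾
    reg-r ≔ load head reg-u ⨾
    count ⨾
    (if≢0 reg-count then (
      emit reg-v reg-u ⨾
      -- A non-zero difference means d(u) < d(v). The visit of `u` then skips `v`, so both entries
      -- are due now. On a tie each of the two visits emits its own entry.
      reg-x ≔ op monus reg-dv reg-du ⨾
      (if≢0 reg-x then emit reg-u reg-v else skip))
     else skip)))

-- The loop goes over entries, so row `v` comes up d(v) times and `done` admits only the first. The
-- marks are removed by walking the same list again, which keeps this cost proportional to d(v).
visit =
  reg-v ≔ load rows reg-p ⨾
  reg-x ≔ load done reg-v ⨾
  (if≢0 reg-x then skip else (
    store done reg-v reg-one ⨾
    reg-dv ≔ load deg reg-v ⨾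
    reg-x ≔ lit 1 ⨾
    reg-q ≔ load head reg-v ⨾
    setMarks ⨾
    reg-q ≔ load head reg-v ⨾
    (while≢0 reg-q loop visitNeighbour) ⨾
    reg-x ≔ lit 0 ⨾
    reg-q ≔ load head reg-v ⨾
    setMarks))

fillOnes sumRow sumAll copyRow addRow subtractRow output : Command
fillOnes = store ones reg-p reg-one
sumRow =
  reg-v ≔ load rowsT reg-p ⨾
  reg-x ≔ load valsT reg-p ⨾
  reg-y ≔ load arrT1 reg-v ⨾
  reg-y ≔ op add reg-y reg-x ⨾
  store arrT1 reg-v reg-y
sumAll =
  reg-x ≔ load valsT reg-p ⨾
  reg-den ≔ op add reg-den reg-x
-- The summand from the identity matrix. Copying once per entry repeats the same assignment; a
-- vertex without entries in T has row sum 0, which its cell already contains.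
copyRow =
  reg-v ≔ load rowsT reg-p ⨾
  reg-x ≔ load arrT1 reg-v ⨾
  store num reg-v reg-x
addRow =
  reg-v ≔ load rows reg-p ⨾
  reg-u ≔ load cols reg-p ⨾
  reg-x ≔ load arrT1 reg-u ⨾
  reg-x ≔ op mul reg-three reg-x ⨾
  reg-y ≔ load num reg-v ⨾
  reg-y ≔ op add reg-y reg-x ⨾
  store num reg-v reg-y
subtractRow =
  reg-v ≔ load rowsT reg-p ⨾
  reg-u ≔ load colsT reg-p ⨾
  reg-x ≔ load arrT1 reg-u ⨾
  reg-x ≔ op mul reg-two reg-x ⨾
  reg-y ≔ load num reg-v ⨾
  reg-y ≔ op monus reg-y reg-x ⨾
  store num reg-v reg-y

-- Clearing num[v] ensures that v is output only once.
output =
  reg-v ≔ load rows reg-p ⨾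
  reg-x ≔ load num reg-v ⨾
  (if≢0 reg-x then (
    store inds reg-out reg-v ⨾
    store nums reg-out reg-x ⨾
    store dens reg-out reg-den ⨾
    reg-out ≔ op add reg-out reg-one ⨾
    store num reg-v reg-zero)
   else skip)

algorithm : Algorithm
algorithm = record
  { R = R
  ; K = K
  ; makeT           = reg-one ≔ lit 1 ⨾ downFrom reg-nnz link ⨾ downFrom reg-nnz visit
  ; makeŤ           = downFrom reg-k fillOnes
  ; makeT𝟏          = downFrom reg-k sumRow
  ; makeDenominator = downFrom reg-k sumAll
  ; makeNumerator   = reg-two ≔ lit 2 ⨾ reg-three ≔ lit 3 ⨾
      -- All additions precede the subtractions, since a truncated difference is exact only once
      -- enough has been added.
      downFrom reg-k copyRow ⨾ downFrom reg-nnz addRow ⨾ downFrom reg-k subtractRow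
  -- The rows of A and not those of T: a vertex in no triangle may have a neighbour in one, and then
  -- its centrality is non-zero.
  ; divide          = downFrom reg-nnz output
  ; atT             = sparseMatrix rowsT colsT valsT reg-k
  -- Ť has the pattern of T, so it shares the index arrays and only its values are new.
  ; atŤ             = sparseMatrix rowsT colsT ones reg-k
  ; atT𝟏            = arrT1
  ; atNumerator     = num
  ; atDenominator   = reg-den
  ; atOutput        = sparseFractions inds nums dens reg-out
  }

-- Construction of the linked adjacency lists

nbrs : ∀ {n} → Fin n → List (Fin n × Fin n) → List (Fin n)
nbrs v [] = []
nbrs v ((i , j) ∷ es) = if does (v F.≟ i) then j ∷ nbrs v es else nbrs v es

length-nbrs : ∀ {n} (v : Fin n) es → length (nbrs v es) ≤ length es
length-nbrs v [] = z≤n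
length-nbrs v ((i , j) ∷ es) with does (v F.≟ i)
... | true = s≤s (length-nbrs v es)
... | false = ℕ.m≤n⇒m≤1+n (length-nbrs v es)

-- The common step of all passes that accumulate by rows: a new entry in row `i` alters the list of
-- `i` alone, as one write alters one cell.
holds-nbrs : ∀ {n w} (E : Fin n → List (Fin n) → ℕ) f i j acc → f holds (λ v → E v (nbrs v acc)) →
  w ≡ E i (j ∷ nbrs i acc) → write f (toℕ i) w holds (λ v → E v (nbrs v ((i , j) ∷ acc)))
holds-nbrs {w = w} E f i j acc h w≡ v = trans (holds-write f i h v) lem
  where
  lem : ((λ v → E v (nbrs v acc)) [ i ↦ w ]) v ≡ E v (nbrs v ((i , j) ∷ acc))
  lem with v F.≟ i
  ... | yes refl = w≡
  ... | no _ = refl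

nbrs-same : ∀ {n} (i j : Fin n) acc → nbrs i ((i , j) ∷ acc) ≡ j ∷ nbrs i acc
nbrs-same i j acc = cong (if_then j ∷ nbrs i acc else nbrs i acc) (dec-true (i F.≟ i) refl)

-- Links are shifted by one so that 0, the initial content of memory, is the empty list. The nodes
-- lie in [lo, hi). During construction `lo` counts the entries not yet linked, so the cell written
-- next belongs to no chain.
data Chain {n} (C X : ℕ → ℕ) (lo hi : ℕ) : ℕ → List (Fin n) → Set where
  []   : Chain C X lo hi 0 []
  node : ∀ {i u us} → lo ≤ i → i < hi → C i ≡ toℕ u → Chain C X lo hi (X i) us → Chain C X lo hi (suc i) (u ∷ us)

chain-bound : ∀ {n C X lo hi q} {us : List (Fin n)} → Chain C X lo hi q us → q ≤ hi
chain-bound [] = z≤n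
chain-bound (node _ i<hi _ _) = i<hi

chain-write : ∀ {n C X lo hi q w} {us : List (Fin n)} →
  Chain C X (suc lo) hi q us → Chain C (write X lo w) lo hi q us
chain-write [] = []
chain-write {X = X} {lo} {hi} {w = w} (node lo<i i<hi e ch) =
  node (ℕ.<⇒≤ lo<i) i<hi e (subst (λ q → Chain _ _ lo hi q _) (sym (write-other X lo w (ℕ.>⇒≢ lo<i))) (chain-write ch))

module Correctness {n} (es : List (Fin n × Fin n)) (L : Limits)
  (n≤words : n ≤ words L) (n≤cells : n ≤ cells L)
  (es<words : length es < words L) (es≤cells : length es ≤ cells L) (3<words : 3 < words L) where

  open Logic {2 + R} {3 + K} L

  private variable
    b : ℕ
    Q : ℕ → State (2 + R) (3 + K) → Set

  vertex-word : (v : Fin n) → toℕ v < words L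
  vertex-word v = ℕ.<-≤-trans (F.toℕ<n v) n≤words

  vertex-cell : (v : Fin n) → toℕ v < cells L
  vertex-cell v = ℕ.<-≤-trans (F.toℕ<n v) n≤cells

  small : ∀ {k} → k ≤ length es → k < words L
  small k≤ = ℕ.≤-<-trans k≤ es<words

  row col : Fin n × Fin n → ℕ
  row (i , j) = toℕ i
  col (i , j) = toℕ j

  -- Each entry is prepended to the list of its row, which matches `nbrs v` under reverse
  -- accumulation. The ten steps for an entry are the test, the decrement and the eight commands of
  -- `link`.
  link-correct : ∀ rem acc σ → reg σ reg-one ≡ 1 → reg σ reg-zero ≡ 0 → reg σ reg-p ≡ length rem →
    length rem + length acc ≡ length es →
    Stored (arr σ rows) row rem → Stored (arr σ cols) col rem →
    (∀ v → Chain (arr σ cols) (arr σ next) (length rem) (length es) (arr σ head (toℕ v)) (nbrs v acc)) →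
    (arr σ deg holds λ v → length (nbrs v acc)) →
    (∀ σ′ → (∀ v → Chain (arr σ cols) (arr σ′ next) 0 (length es) (arr σ′ head (toℕ v)) (nbrs v (rem ʳ++ acc))) →
            (arr σ′ deg holds λ v → length (nbrs v (rem ʳ++ acc))) → Q b σ′) →
    Runs (loopDown link) σ (length rem * 10 + suc b) Q
  link-correct [] acc σ one zer p len rs cs chains degs post = exit-rule p (post σ chains degs)
  link-correct ((i , j) ∷ rem) acc σ one zer p len (r , rs) (c , cs) chains degs post =
    loop-rule p $
    seq $ op-rule p one refl (small (ℕ.<⇒≤ k<)) $
    seq $ op-rule refl one (ℕ.+-comm k 1) (small k<) $
    seq $ load-rule refl k<c r (vertex-word i) $
    seq $ load-rule refl (vertex-cell i) refl (small (chain-bound (chains i))) $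
    seq $ store-rule refl k<c refl $
    seq $ store-rule refl (vertex-cell i) refl $
    seq $ load-rule refl (vertex-cell i) (degs i) (small (ℕ.≤-trans (length-nbrs i acc) acc≤)) $
    seq $ op-rule refl one (ℕ.+-comm _ 1) (small (ℕ.≤-<-trans (length-nbrs i acc) acc<)) $
    store-rule refl (vertex-cell i) refl $
    link-correct rem ((i , j) ∷ acc) _ one zer refl (trans (ℕ.+-suc k (length acc)) len) rs cs chains′ degs′ post
    where
    k = length rem
    k< : k < length es
    k< = subst (k <_) len (ℕ.m≤m+n (suc k) (length acc))
    k<c = ℕ.<-≤-trans k< es≤cells
    acc< : length acc < length es
    acc< = subst (length acc <_) len (s≤s (ℕ.m≤n+m (length acc) k))
    acc≤ = ℕ.<⇒≤ acc<
    chains′ : ∀ v → Chain (arr σ cols) (write (arr σ next) k (arr σ head (toℕ i))) k (length es)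
      (write (arr σ head) (toℕ i) (suc k) (toℕ v)) (nbrs v ((i , j) ∷ acc))
    chains′ v = subst (λ q → Chain (arr σ cols) (write (arr σ next) k (arr σ head (toℕ i))) k (length es) q (nbrs v ((i , j) ∷ acc)))
      (sym (holds-write {F = λ v → arr σ head (toℕ v)} (arr σ head) i (λ _ → refl) v)) lem
      where
      lem : Chain (arr σ cols) (write (arr σ next) k (arr σ head (toℕ i))) k (length es)
        (((λ v → arr σ head (toℕ v)) [ i ↦ suc k ]) v) (nbrs v ((i , j) ∷ acc))
      lem with v F.≟ i
      ... | yes refl = node ℕ.≤-refl k< c 
        (subst (λ q → Chain (arr σ cols) (write (arr σ next) k (arr σ head (toℕ i))) k (length es) q (nbrs v acc))
          (sym (write-same (arr σ next) k _)) (chain-write (chains v)))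
      ... | no _ = chain-write (chains v)
    degs′ : write (arr σ deg) (toℕ i) (suc (length (nbrs i acc))) holds λ v → length (nbrs v ((i , j) ∷ acc))
    degs′ = holds-nbrs (λ _ us → length us) (arr σ deg) i j acc degs refl

-- The search for triangles as run by the machine

marked : ∀ {n} → List (Fin n) → ℕ → (Fin n → ℕ) → Fin n → ℕ
marked [] w F = F
marked (u ∷ us) w F = marked us w (F [ u ↦ w ])

marked-∈ : ∀ {n} (us : List (Fin n)) w F v → (v ∈ us → marked us w F v ≡ w) × (v ∉ us → marked us w F v ≡ F v)
marked-∈ [] w F v = (λ ()) , λ _ → refl
marked-∈ {n} (u ∷ us) w F v = in′ , out
  where
  ih = marked-∈ us w (F [ u ↦ w ]) v
  in′ : v ∈ u ∷ us → marked us w (F [ u ↦ w ]) v ≡ w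
  in′ v∈ with v ∈? us
  ... | yes v∈us = proj₁ ih v∈us
  in′ (there v∈us) | no v∉us = ⊥-elim (v∉us v∈us)
  in′ (here refl) | no v∉us = trans (proj₂ ih v∉us) (cong (if_then w else F v) (dec-true (v F.≟ v) refl))
  out : v ∉ u ∷ us → marked us w (F [ u ↦ w ]) v ≡ F v
  out v∉ = trans (proj₂ ih (v∉ ∘ there)) (cong (if_then w else F v) (dec-false (v F.≟ u) (v∉ ∘ here)))

-- One step of `collect`, which keeps first occurrences with non-zero value: with the constant 1 it
-- lists the visited vertices, with `net` the vertices of the output. The decision is an argument so
-- that it can be matched on by itself.
extend : ∀ {n ℓ} {P : Set ℓ} → Dec P → ℕ → Fin n → List (Fin n) → List (Fin n)
extend (yes _) _ v D = D
extend (no _) zero v D = D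
extend (no _) (suc _) v D = v ∷ D

collect : ∀ {n} → (Fin n → ℕ) → List (Fin n × Fin n) → List (Fin n) → List (Fin n)
collect F [] D = D
collect F ((v , _) ∷ es) D = collect F es (extend (v ∈? D) (F v) v D)

-- Partial sums never exceed the final one, so only the latter has to be compared with the word
-- limit.
sum-map-≤-ʳ++ : ∀ {ℓ} {B : Set ℓ} (f : B → ℕ) xs ys → sum (map f ys) ≤ sum (map f (xs ʳ++ ys))
sum-map-≤-ʳ++ f [] ys = ℕ.≤-refl
sum-map-≤-ʳ++ f (x ∷ xs) ys = ℕ.≤-trans (ℕ.m≤n+m _ (f x)) (sum-map-≤-ʳ++ f xs (x ∷ ys))

sum-nbrs-≤-ʳ++ : ∀ {n} (f : Fin n → ℕ) v (xs ys : List (Fin n × Fin n)) →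
  sum (map f (nbrs v ys)) ≤ sum (map f (nbrs v (xs ʳ++ ys)))
sum-nbrs-≤-ʳ++ f v [] ys = ℕ.≤-refl
sum-nbrs-≤-ʳ++ f v ((i , j) ∷ xs) ys = ℕ.≤-trans lem (sum-nbrs-≤-ʳ++ f v xs ((i , j) ∷ ys))
  where
  lem : sum (map f (nbrs v ys)) ≤ sum (map f (nbrs v ((i , j) ∷ ys)))
  lem with does (v F.≟ i)
  ... | true = ℕ.m≤n+m _ (f j)
  ... | false = ℕ.≤-refl

record Linked {n} (nb : Fin n → List (Fin n)) (hi : ℕ) (C X H D : ℕ → ℕ) : Set where
  constructor linked
  field
    chains  : ∀ v → Chain C X 0 hi (H (toℕ v)) (nb v)
    degrees : D holds (λ v → length (nb v))

record Emitted {n} (τ : Fin n → Fin n → ℕ) (I J X : ℕ → ℕ) (k : ℕ) (l : List (Fin n × Fin n)) : Set where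
  constructor emitted
  field
    storedI : Stored I (λ (i , j) → toℕ i) l
    storedJ : Stored J (λ (i , j) → toℕ j) l
    storedX : Stored X (λ (i , j) → τ i j) l
    len     : k ≡ length l

emitted-push : ∀ {n} {τ : Fin n → Fin n → ℕ} {I J X k l w} (i j : Fin n) → w ≡ τ i j → Emitted τ I J X k l →
  Emitted τ (write I k (toℕ i)) (write J k (toℕ j)) (write X k w) (suc k) ((i , j) ∷ l)
emitted-push i j e (emitted si sj sx refl) =
  emitted (stored-push (i , j) _ refl si) (stored-push (i , j) _ refl sj) (stored-push (i , j) _ e sx) refl

-- The entries of T found from v by its neighbour u, given the signs of
-- d u - d v, the number of common neighbours, and d v - d u.
entries : ∀ {n} → ℕ → ℕ → ℕ → Fin n → Fin n → List (Fin n × Fin n) → List (Fin n × Fin n)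
entries (suc _) _ _ v u l = l
entries zero zero _ v u l = l
entries zero (suc _) zero v u l = (v , u) ∷ l
entries zero (suc _) (suc _) v u l = (u , v) ∷ (v , u) ∷ l

-- The list of emitted entries only grows; a bound on its final length therefore covers every index
-- written on the way.
length-entries : ∀ {n} x y z (v u : Fin n) l → length l ≤ length (entries x y z v u l)
length-entries (suc _) _ _ v u l = ℕ.≤-refl
length-entries zero zero _ v u l = ℕ.≤-refl
length-entries zero (suc _) zero v u l = ℕ.n≤1+n _
length-entries zero (suc _) (suc _) v u l = ℕ.m≤n⇒m≤1+n (ℕ.n≤1+n _)

module Search {n} (es : List (Fin n × Fin n)) (τ : Fin n → Fin n → ℕ) where

  nb : Fin n → List (Fin n)
  nb v = nbrs v es

  dg : Fin n → ℕ
  dg v = length (nb v)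

  dg≤ : ∀ v → dg v ≤ length es
  dg≤ v = length-nbrs v es

  found : Fin n → Fin n → List (Fin n × Fin n) → List (Fin n × Fin n)
  found v u = entries (dg u ∸ dg v) (τ v u) (dg v ∸ dg u) v u

  founds : Fin n → List (Fin n) → List (Fin n × Fin n) → List (Fin n × Fin n)
  founds v [] l = l
  founds v (u ∷ us) l = founds v us (found v u l)

  allFound : List (Fin n) → List (Fin n × Fin n) → List (Fin n × Fin n)
  allFound [] l = l
  allFound (v ∷ D) l = founds v (nb v) (allFound D l)

  length-founds : ∀ v us l → length l ≤ length (founds v us l)
  length-founds v [] l = ℕ.≤-refl
  length-founds v (u ∷ us) l = ℕ.≤-trans (length-entries (dg u ∸ dg v) (τ v u) _ v u l) (length-founds v us (found v u l))

  -- The costs are functions of the credits b left at the end, so that they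
  -- unfold along a run.
  neighboursCost : Fin n → List (Fin n) → ℕ → ℕ
  neighboursCost v [] b = suc b
  neighboursCost v (u ∷ us) b = 9 + ((dg u ⊓ dg v) * 6 + suc (11 + neighboursCost v us b))

  length-allFound-collect : ∀ F rem D → length (allFound D []) ≤ length (allFound (collect F rem D) [])
  length-allFound-collect F [] D = ℕ.≤-refl
  length-allFound-collect F ((v , _) ∷ rem) D = ℕ.≤-trans (grow (v ∈? D) (F v)) (length-allFound-collect F rem _)
    where
    grow : (d : Dec (v ∈ D)) → ∀ k → length (allFound D []) ≤ length (allFound (extend d k v D) [])
    grow (yes _) k = ℕ.≤-refl
    grow (no _) zero = ℕ.≤-refl
    grow (no _) (suc _) = length-founds v (nb v) _

  branchCost : ∀ {ℓ} {P : Set ℓ} → Dec P → Fin n → ℕ → ℕ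
  branchCost (yes _) v b = 2 + b
  branchCost (no _) v b = 5 + (dg v * 5 + suc (1 + neighboursCost v (nb v) (2 + (dg v * 5 + suc b))))

  visitCost : List (Fin n × Fin n) → List (Fin n) → ℕ → ℕ
  visitCost [] D b = suc b
  visitCost ((v , _) ∷ rem) D b = 4 + branchCost (v ∈? D) v (visitCost rem (extend (v ∈? D) 1 v D) b)

module Visit {n} (es : List (Fin n × Fin n)) (L : Limits)
  (n≤words : n ≤ words L) (n≤cells : n ≤ cells L)
  (es<words : length es < words L) (es≤cells : length es ≤ cells L) (3<words : 3 < words L)
  (τ : Fin n → Fin n → ℕ) (τ<words : ∀ v u → τ v u < words L) (τ-sym : ∀ v u → τ v u ≡ τ u v)
  (τ-count : ∀ v u → sum (map (λ w → 𝟙 (w ∈? nbrs v es)) (nbrs u es)) ≡ τ v u) where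

  open Logic {2 + R} {3 + K} L
  open Correctness es L n≤words n≤cells es<words es≤cells 3<words
  open Search es τ

  private variable
    b : ℕ
    Q : ℕ → State (2 + R) (3 + K) → Set

  LinkedAt : State (2 + R) (3 + K) → Set
  LinkedAt σ = Linked nb (length es) (arr σ cols) (arr σ next) (arr σ head) (arr σ deg)

  EmittedAt : State (2 + R) (3 + K) → List (Fin n × Fin n) → Set
  EmittedAt σ = Emitted τ (arr σ rowsT) (arr σ colsT) (arr σ valsT) (reg σ reg-k)

  1<words : 1 < words L
  1<words = ℕ.<-trans (s≤s (s≤s z≤n)) 3<words

  0<words : 0 < words L
  0<words = ℕ.<-trans (s≤s z≤n) 1<words

  setMarks-correct : ∀ {q} (us : List (Fin n)) σ (F : Fin n → ℕ) w → reg σ reg-one ≡ 1 → reg σ reg-x ≡ w → reg σ reg-q ≡ q →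
    Chain (arr σ cols) (arr σ next) 0 (length es) q us → arr σ mark holds F →
    (∀ σ′ → arr σ′ mark holds marked us w F → Q b σ′) →
    Runs setMarks σ (length us * 5 + suc b) Q
  setMarks-correct [] σ F w one x q [] m post = exit-rule q (post σ m)
  setMarks-correct (u ∷ us) σ F w one x q (node {i} _ i< c ch) m post =
    loop-rule q $
    seq $ op-rule q one refl (small (ℕ.<⇒≤ i<)) $
    seq $ load-rule refl (ℕ.<-≤-trans i< es≤cells) c (vertex-word u) $
    seq $ store-rule refl (vertex-cell u) x $
    load-rule refl (ℕ.<-≤-trans i< es≤cells) refl (small (chain-bound ch)) $
    setMarks-correct us _ (F [ u ↦ w ]) w one x refl ch (holds-write (arr σ mark) u m) post

  count-correct : ∀ {q} (us : List (Fin n)) σ (M : Fin n → ℕ) c → reg σ reg-one ≡ 1 → reg σ reg-count ≡ c → reg σ reg-r ≡ q →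
    Chain (arr σ cols) (arr σ next) 0 (length es) q us → arr σ mark holds M →
    c + sum (map M us) < words L →
    (∀ σ′ → reg σ′ reg-count ≡ c + sum (map M us) → Q b σ′) →
    Runs count σ (length us * 6 + suc b) Q
  count-correct [] σ M c one cnt q [] m bound post = exit-rule q (post σ (trans cnt (sym (ℕ.+-identityʳ c))))
  count-correct (u ∷ us) σ M c one cnt q (node {i} _ i< e ch) m bound post =
    loop-rule q $
    seq $ op-rule q one refl (small (ℕ.<⇒≤ i<)) $
    seq $ load-rule refl (ℕ.<-≤-trans i< es≤cells) e (vertex-word u) $
    seq $ load-rule refl (vertex-cell u) (m u) (ℕ.≤-<-trans (ℕ.≤-trans (ℕ.m≤m+n (M u) _) (ℕ.m≤n+m _ c)) bound) $
    seq $ op-rule cnt refl refl (ℕ.≤-<-trans (ℕ.m≤m+n _ _) bound′) $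
    load-rule refl (ℕ.<-≤-trans i< es≤cells) refl (small (chain-bound ch)) $
    count-correct us _ M (c + M u) one refl refl ch m bound′ λ σ′ h → post σ′ (trans h (ℕ.+-assoc c (M u) _))
    where
    bound′ : c + M u + sum (map M us) < words L
    bound′ = subst (_< words L) (sym (ℕ.+-assoc c (M u) _)) bound

  linked-kept : ∀ {c σ σ′} → Frame c σ σ′ →
    writesArr c cols ≡ false → writesArr c next ≡ false → writesArr c head ≡ false → writesArr c deg ≡ false →
    LinkedAt σ → LinkedAt σ′
  linked-kept fr p q r s lk rewrite Frame.arr≡ fr cols p | Frame.arr≡ fr next q | Frame.arr≡ fr head r | Frame.arr≡ fr deg s = lk

  emitted-kept : ∀ {c σ σ′ l} → Frame c σ σ′ →
    writesArr c rowsT ≡ false → writesArr c colsT ≡ false → writesArr c valsT ≡ false → writesReg c reg-k ≡ false →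
    EmittedAt σ l → EmittedAt σ′ l
  emitted-kept fr p q r s em rewrite Frame.arr≡ fr rowsT p | Frame.arr≡ fr colsT q | Frame.arr≡ fr valsT r | Frame.reg≡ fr reg-k s = em

  emit-correct : ∀ ri rj (i j : Fin n) σ l → reg σ reg-one ≡ 1 → reg σ ri ≡ toℕ i → reg σ rj ≡ toℕ j →
    reg σ reg-count ≡ τ i j → EmittedAt σ l → length l < length es →
    (let σ′ = setReg reg-k (suc (length l)) (setArr valsT (length l) (τ i j)
                (setArr colsT (length l) (toℕ j) (setArr rowsT (length l) (toℕ i) σ)))
     in EmittedAt σ′ ((i , j) ∷ l) → Q b σ′) →
    Runs (emit ri rj) σ (4 + b) Q
  emit-correct ri rj i j σ l one i≡ j≡ cnt em l< post =
    seq $ store-rule k l<c i≡ $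
    seq $ store-rule k l<c j≡ $
    seq $ store-rule k l<c cnt $
    op-rule k one (ℕ.+-comm _ 1) (small l<) $
    post (emitted-push i j refl (subst (λ k → Emitted τ _ _ _ k l) k em))
    where
    k = Emitted.len em
    l<c = ℕ.<-≤-trans l< es≤cells

  -- Induction along the list of `v`. Lists, degrees and marks reach the next neighbour through
  -- frames; only the emitted entries change.
  neighbours-correct : ∀ {q} v us l σ → reg σ reg-one ≡ 1 → reg σ reg-v ≡ toℕ v → reg σ reg-dv ≡ dg v →
    reg σ reg-q ≡ q → Chain (arr σ cols) (arr σ next) 0 (length es) q us →
    LinkedAt σ → arr σ mark holds (λ w → 𝟙 (w ∈? nb v)) →
    EmittedAt σ l → length (founds v us l) ≤ length es →
    (∀ σ′ → EmittedAt σ′ (founds v us l) → Q b σ′) →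
    Runs (while≢0 reg-q loop visitNeighbour) σ (neighboursCost v us b) Q
  neighbours-correct v [] l σ one v≡ dv q [] lk m em bound post = exit-rule q (post σ em)
  neighbours-correct {Q = Q} {b = b} v (u ∷ us) l σ one v≡ dv q (node {i} _ i< c ch) lk m em bound post =
    loop-rule q $
    seq $ op-rule q one refl (small (ℕ.<⇒≤ i<)) $
    seq $ load-rule refl (ℕ.<-≤-trans i< es≤cells) c (vertex-word u) $
    seq $ load-rule refl (ℕ.<-≤-trans i< es≤cells) refl (small (chain-bound ch)) $
    seq $ load-rule refl (vertex-cell u) (Linked.degrees lk u) (small (dg≤ u)) $
    seq $ op-rule refl dv refl (small (ℕ.≤-trans (ℕ.m∸n≤m (dg u) (dg v)) (dg≤ u))) $
    branch (dg u ∸ dg v) refl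
    where
    σ₁ : State (2 + R) (3 + K)
    σ₁ = setReg reg-x (dg u ∸ dg v) (setReg reg-du (dg u) (setReg reg-q (arr σ next i) (setReg reg-u (toℕ u) (setReg reg-q i σ))))

    Post : ℕ → State (2 + R) (3 + K) → Set
    Post b′ σ′ = Runs (while≢0 reg-q loop visitNeighbour) σ′ b′ Q

    continue : ∀ {c σ′ x y z} → Frame c σ₁ σ′ →
      writesReg c reg-one ≡ false → writesReg c reg-v ≡ false → writesReg c reg-dv ≡ false → writesReg c reg-q ≡ false →
      writesArr c cols ≡ false → writesArr c next ≡ false → writesArr c head ≡ false → writesArr c deg ≡ false →
      writesArr c mark ≡ false →
      x ≡ dg u ∸ dg v → y ≡ τ v u → z ≡ dg v ∸ dg u →
      EmittedAt σ′ (entries x y z v u l) → Post (neighboursCost v us b) σ′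
    continue {c} {σ′} fr w₁ w₂ w₃ w₄ w₅ w₆ w₇ w₈ w₉ refl refl refl em′ =
      neighbours-correct v us (found v u l) σ′
        (trans (Frame.reg≡ fr reg-one w₁) one) (trans (Frame.reg≡ fr reg-v w₂) v≡) (trans (Frame.reg≡ fr reg-dv w₃) dv)
        (Frame.reg≡ fr reg-q w₄)
        (subst₂ (λ C X → Chain C X 0 (length es) (arr σ next i) us) (sym (Frame.arr≡ fr cols w₅)) (sym (Frame.arr≡ fr next w₆)) ch)
        (linked-kept fr w₅ w₆ w₇ w₈ lk)
        (subst (_holds (λ w → 𝟙 (w ∈? nb v))) (sym (Frame.arr≡ fr mark w₉)) m) em′ bound post

    bound′ : ∀ {x y z} → x ≡ dg u ∸ dg v → y ≡ τ v u → z ≡ dg v ∸ dg u → length (entries x y z v u l) ≤ length es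
    bound′ refl refl refl = ℕ.≤-trans (length-founds v us _) bound

    test : Command
    test = if≢0 reg-x then emit reg-u reg-v else skip

    compare : Command
    compare = if≢0 reg-count then (emit reg-v reg-u ⨾ reg-x ≔ op monus reg-dv reg-du ⨾ test) else skip

    scan : Command
    scan = reg-count ≔ lit 0 ⨾ reg-r ≔ load head reg-u ⨾ count ⨾ compare

    -- The tested value is a variable with an equation: matching on it leaves the difference
    -- untouched in the states.
    branch : ∀ x → x ≡ dg u ∸ dg v →
      Runs (if≢0 reg-x then skip else scan) σ₁ (3 + ((dg u ⊓ dg v) * 6 + suc (11 + neighboursCost v us b))) Post
    -- The list of `u` is the longer one and is not scanned; the credits set aside for it are
    -- dropped.
    branch (suc x) x≡ = weaken (ℕ.≤-trans (ℕ.m≤n+m _ 10) (ℕ.≤-trans (ℕ.m≤n+m _ ((dg u ⊓ dg v) * 6)) (ℕ.m≤n+m _ 3))) $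
      then-rule (sym x≡) $ framed $ skip-rule λ fr →
      continue fr refl refl refl refl refl refl refl refl refl x≡ refl refl em
    branch zero x≡ = weaken fewer $
      else-rule (sym x≡) $ framed $
      seq $ lit-rule 0<words $
      seq $ load-rule refl (vertex-cell u) refl (small (chain-bound (Linked.chains lk u))) $
      seq $ framed $ count-correct (nb u) σ₂ (λ w → 𝟙 (w ∈? nb v)) 0 one refl refl (Linked.chains lk u) m
        (subst (_< words L) (sym (τ-count v u)) (τ<words v u)) λ σ₃ cnt fr → nonzero σ₃ (trans cnt (τ-count v u)) fr (τ v u) refl
      where
      rest : ℕ
      rest = suc (11 + neighboursCost v us b)

      -- A zero difference means dg u ≤ dg v, so the scanned list has exactly the length that is
      -- charged.
      fewer : 3 + (dg u * 6 + rest) ≤ 3 + ((dg u ⊓ dg v) * 6 + rest)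
      fewer = ℕ.≤-reflexive (cong (λ k → 3 + (k * 6 + rest)) (sym (ℕ.m≤n⇒m⊓n≡m (ℕ.m∸n≡0⇒m≤n {dg u} {dg v} (sym x≡)))))

      σ₂ : State (2 + R) (3 + K)
      σ₂ = setReg reg-r (arr σ head (toℕ u)) (setReg reg-count 0 σ₁)

      nonzero : ∀ σ₃ → reg σ₃ reg-count ≡ τ v u → Frame count σ₂ σ₃ → ∀ y → y ≡ τ v u →
        Runs compare σ₃ (11 + neighboursCost v us b) (λ b′ σ′ → Frame scan σ₁ σ′ → Post b′ σ′)
      nonzero σ₃ cnt fr zero y≡ = weaken (ℕ.m≤n+m _ 9) $ else-rule (trans cnt (sym y≡)) $ skip-rule λ fr′ →
        continue fr′ refl refl refl refl refl refl refl refl refl x≡ y≡ refl (emitted-kept fr refl refl refl refl em)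
      nonzero σ₃ cnt fr (suc y) y≡ =
        then-rule (trans cnt (sym y≡)) $
        seq $ emit-correct reg-v reg-u v u σ₃ l one₃ v₃ u₃ cnt (emitted-kept fr refl refl refl refl em) (room (dg v ∸ dg u) refl) λ em₄ →
        seq $ op-rule (trans (Frame.reg≡ fr reg-dv refl) dv) (Frame.reg≡ fr reg-du refl) refl
          (small (ℕ.≤-trans (ℕ.m∸n≤m (dg v) (dg u)) (dg≤ v))) $
        swapped em₄ (dg v ∸ dg u) refl
        where
        one₃ : reg σ₃ reg-one ≡ 1
        one₃ = trans (Frame.reg≡ fr reg-one refl) one
        v₃ : reg σ₃ reg-v ≡ toℕ v
        v₃ = trans (Frame.reg≡ fr reg-v refl) v≡
        u₃ : reg σ₃ reg-u ≡ toℕ u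
        u₃ = Frame.reg≡ fr reg-u refl

        room : ∀ z → z ≡ dg v ∸ dg u → length l < length es
        room zero z≡ = bound′ x≡ y≡ z≡
        room (suc z) z≡ = ℕ.≤-trans (ℕ.n≤1+n _) (bound′ x≡ y≡ z≡)

        σ₄ : State (2 + R) (3 + K)
        σ₄ = setReg reg-x (dg v ∸ dg u) (setReg reg-k (suc (length l)) (setArr valsT (length l) (τ v u)
          (setArr colsT (length l) (toℕ u) (setArr rowsT (length l) (toℕ v) σ₃))))

        swapped : EmittedAt σ₄ ((v , u) ∷ l) → ∀ z → z ≡ dg v ∸ dg u →
          Runs test σ₄ (5 + neighboursCost v us b) (λ b′ σ′ → Frame scan σ₁ σ′ → Post b′ σ′)
        swapped em₄ zero z≡ = weaken (ℕ.m≤n+m _ 3) $ else-rule (sym z≡) $ skip-rule λ fr′ →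
          continue fr′ refl refl refl refl refl refl refl refl refl x≡ y≡ z≡ em₄
        swapped em₄ (suc z) z≡ = then-rule (sym z≡) $
          emit-correct reg-u reg-v u v σ₄ ((v , u) ∷ l) one₃ u₃ v₃ (trans cnt (τ-sym v u)) em₄ (bound′ x≡ y≡ z≡) λ em₅ fr′ →
          continue fr′ refl refl refl refl refl refl refl refl refl x≡ y≡ z≡ em₅

  zeros : Fin n → ℕ
  zeros v = 0

  𝟙-extend : ∀ v (D : List (Fin n)) w → ((λ w → 𝟙 (w ∈? D)) [ v ↦ 1 ]) w ≡ 𝟙 (w ∈? (v ∷ D))
  𝟙-extend v D w with w F.≟ v
  ... | yes refl = refl
  ... | no _ = refl

  -- Between visits no vertex is marked and `done` is the indicator of `D`, the list of visited
  -- vertices; these two facts are what a visit must restore.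
  visit-correct : ∀ rem D σ → reg σ reg-one ≡ 1 → reg σ reg-p ≡ length rem → length rem ≤ length es →
    Stored (arr σ rows) row rem → LinkedAt σ →
    arr σ done holds (λ w → 𝟙 (w ∈? D)) → arr σ mark holds zeros →
    EmittedAt σ (allFound D []) → length (allFound (collect (const 1) rem D) []) ≤ length es →
    (∀ σ′ → EmittedAt σ′ (allFound (collect (const 1) rem D) []) → Q b σ′) →
    Runs (loopDown visit) σ (visitCost rem D b) Q
  visit-correct [] D σ one p rem≤ rs lk dn mk em bound post = exit-rule p (post σ em)
  visit-correct {Q = Q} {b = b} ((v , j) ∷ rem) D σ one p rem≤ (r , rs) lk dn mk em bound post =
    loop-rule p $
    seq $ op-rule p one refl (small (ℕ.<⇒≤ rem≤)) $
    seq $ load-rule refl (ℕ.<-≤-trans rem≤ es≤cells) r (vertex-word v) $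
    seq $ load-rule refl (vertex-cell v) (dn v) (ℕ.≤-<-trans (𝟙≤1 (v ∈? D)) 1<words) $
    branch (v ∈? D) refl
    where
    𝟙≤1 : ∀ {ℓ} {P : Set ℓ} (d : Dec P) → 𝟙 d ≤ 1
    𝟙≤1 (yes _) = ℕ.≤-refl
    𝟙≤1 (no _) = z≤n

    k : ℕ
    k = length rem

    σ₁ : State (2 + R) (3 + K)
    σ₁ = setReg reg-x (𝟙 (v ∈? D)) (setReg reg-v (toℕ v) (setReg reg-p k σ))

    c : ℕ
    c = visitCost rem (extend (v ∈? D) 1 v D) b

    Post : ℕ → State (2 + R) (3 + K) → Set
    Post b′ σ′ = Runs (loopDown visit) σ′ b′ Q

    continue : ∀ {c′ σ′ D′} → D′ ≡ extend (v ∈? D) 1 v D → Frame c′ σ₁ σ′ →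
      writesReg c′ reg-one ≡ false → writesReg c′ reg-p ≡ false → writesArr c′ rows ≡ false →
      writesArr c′ cols ≡ false → writesArr c′ next ≡ false → writesArr c′ head ≡ false → writesArr c′ deg ≡ false →
      arr σ′ done holds (λ w → 𝟙 (w ∈? D′)) → arr σ′ mark holds zeros → EmittedAt σ′ (allFound D′ []) → Post c σ′
    continue {σ′ = σ′} refl fr w₁ w₂ w₃ w₄ w₅ w₆ w₇ dn′ mk′ em′ =
      visit-correct rem _ σ′ (trans (Frame.reg≡ fr reg-one w₁) one) (Frame.reg≡ fr reg-p w₂) (ℕ.<⇒≤ rem≤)
        (subst (λ f → Stored f row rem) (sym (Frame.arr≡ fr rows w₃)) rs) (linked-kept fr w₄ w₅ w₆ w₇ lk)
        dn′ mk′ em′ bound post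

    fresh : Command
    fresh =
      store done reg-v reg-one ⨾ reg-dv ≔ load deg reg-v ⨾ reg-x ≔ lit 1 ⨾ reg-q ≔ load head reg-v ⨾ setMarks ⨾
      reg-q ≔ load head reg-v ⨾ (while≢0 reg-q loop visitNeighbour) ⨾
      reg-x ≔ lit 0 ⨾ reg-q ≔ load head reg-v ⨾ setMarks

    branch : (d : Dec (v ∈ D)) → d ≡ (v ∈? D) → Runs (if≢0 reg-x then skip else fresh) σ₁ (branchCost d v c) Post
    branch (yes v∈) d≡ = then-rule (cong 𝟙 (sym d≡)) $ framed $ skip-rule λ fr →
      continue (cong (λ d → extend d 1 v D) d≡) fr refl refl refl refl refl refl refl dn mk em
    branch (no v∉) d≡ =
      else-rule (cong 𝟙 (sym d≡)) $ framed $
      seq $ store-rule refl (vertex-cell v) one $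
      seq $ load-rule refl (vertex-cell v) (Linked.degrees lk v) (small (dg≤ v)) $
      seq $ lit-rule 1<words $
      seq $ load-rule refl (vertex-cell v) refl (small (chain-bound (Linked.chains lk v))) $
      seq $ framed $ setMarks-correct (nb v) _ zeros 1 one refl refl (Linked.chains lk v) mk λ σ₂ mk₂ fr₂ →
      let lk₂ = linked-kept fr₂ refl refl refl refl lk
          v₂  = Frame.reg≡ fr₂ reg-v refl
          one₂ = trans (Frame.reg≡ fr₂ reg-one refl) one
      in
      seq $ load-rule v₂ (vertex-cell v) refl (small (chain-bound (Linked.chains lk₂ v))) $
      seq $ framed $ neighbours-correct v (nb v) (allFound D []) _ one₂ v₂ (Frame.reg≡ fr₂ reg-dv refl) refl
        (Linked.chains lk₂ v) lk₂ (λ w → trans (mk₂ w) (marked-𝟙 w)) (emitted-kept fr₂ refl refl refl refl em) bound′ λ σ₃ em₃ fr₃ →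
      let lk₃ = linked-kept fr₃ refl refl refl refl lk₂
          v₃  = trans (Frame.reg≡ fr₃ reg-v refl) v₂
          one₃ = trans (Frame.reg≡ fr₃ reg-one refl) one₂
      in
      seq $ lit-rule 0<words $
      seq $ load-rule v₃ (vertex-cell v) refl (small (chain-bound (Linked.chains lk₃ v))) $
      framed $ setMarks-correct (nb v) _ (λ w → 𝟙 (w ∈? nb v)) 0 one₃ refl refl (Linked.chains lk₃ v)
        (λ w → trans (cong (_$ toℕ w) (Frame.arr≡ fr₃ mark refl)) (trans (mk₂ w) (marked-𝟙 w))) λ σ₄ mk₄ fr₄ fr →
      continue (cong (λ d → extend d 1 v D) d≡) fr refl refl refl refl refl refl refl
        (λ w → trans (cong (_$ toℕ w) (trans (Frame.arr≡ fr₄ done refl) (trans (Frame.arr≡ fr₃ done refl) (Frame.arr≡ fr₂ done refl))))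
          (trans (holds-write (arr σ done) v dn w) (𝟙-extend v D w)))
        (λ w → trans (mk₄ w) (unmarked w)) (emitted-kept fr₄ refl refl refl refl em₃)
      where
      bound′ : length (founds v (nb v) (allFound D [])) ≤ length es
      bound′ = ℕ.≤-trans (length-allFound-collect (const 1) rem (v ∷ D))
        (subst (λ d → length (allFound (collect (const 1) rem (extend d 1 v D)) []) ≤ length es) (sym d≡) bound)

      marked-𝟙 : ∀ w → marked (nb v) 1 zeros w ≡ 𝟙 (w ∈? nb v)
      marked-𝟙 w with w ∈? nb v
      ... | yes w∈ = proj₁ (marked-∈ (nb v) 1 zeros w) w∈
      ... | no w∉ = proj₂ (marked-∈ (nb v) 1 zeros w) w∉

      unmarked : ∀ w → marked (nb v) 0 (λ w → 𝟙 (w ∈? nb v)) w ≡ 0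
      unmarked w with w ∈? nb v in eq
      ... | yes w∈ = proj₁ (marked-∈ (nb v) 0 (λ w → 𝟙 (w ∈? nb v)) w) w∈
      ... | no w∉ = trans (proj₂ (marked-∈ (nb v) 0 (λ w → 𝟙 (w ∈? nb v)) w) w∉) (cong 𝟙 eq)

-- The passes that evaluate the formula

copied : ∀ {n} → (Fin n → ℕ) → List (Fin n × Fin n) → (Fin n → ℕ) → Fin n → ℕ
copied F [] G = G
copied F ((i , _) ∷ es) G = copied F es (G [ i ↦ F i ])

-- The content of `num` during the output pass. A vertex already output reads as zero, like one with
-- zero numerator, so one test covers both cases.
residue : ∀ {n} → (Fin n → ℕ) → List (Fin n) → Fin n → ℕ
residue F D v = if does (v ∈? D) then 0 else F v

residue-∷ : ∀ {n} (F : Fin n → ℕ) v D w → (residue F D [ v ↦ 0 ]) w ≡ residue F (v ∷ D) w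
residue-∷ F v D w with w F.≟ v
... | yes _ = refl
... | no _ = refl

module Stages {n} (es : List (Fin n × Fin n)) (L : Limits)
  (n≤words : n ≤ words L) (n≤cells : n ≤ cells L)
  (es<words : length es < words L) (es≤cells : length es ≤ cells L) (3<words : 3 < words L) where

  open Logic {2 + R} {3 + K} L
  open Correctness es L n≤words n≤cells es<words es≤cells 3<words

  private variable
    b : ℕ
    Q : ℕ → State (2 + R) (3 + K) → Set

  fillOnes-correct : ∀ k l σ → reg σ reg-one ≡ 1 → reg σ reg-p ≡ k → k ≤ l → l ≤ length es →
    (∀ j → k ≤ j → j < l → arr σ ones j ≡ 1) →
    (∀ σ′ → (∀ j → j < l → arr σ′ ones j ≡ 1) → Q b σ′) →
    Runs (loopDown fillOnes) σ (k * 3 + suc b) Q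
  fillOnes-correct zero l σ one p k≤ l≤ h post = exit-rule p (post σ λ j j< → h j z≤n j<)
  fillOnes-correct (suc k) l σ one p k≤ l≤ h post =
    loop-rule p $
    seq $ op-rule p one refl (small (ℕ.<⇒≤ (ℕ.≤-trans k≤ l≤))) $
    store-rule refl (ℕ.≤-trans (ℕ.≤-trans k≤ l≤) es≤cells) one $
    fillOnes-correct k l _ one refl (ℕ.<⇒≤ k≤) l≤ h′ post
    where
    h′ : ∀ j → k ≤ j → j < l → write (arr σ ones) k 1 j ≡ 1
    h′ j k≤j j< with k ℕ.≟ j
    ... | yes refl = write-same (arr σ ones) k 1
    ... | no k≢j = trans (write-other (arr σ ones) k 1 (k≢j ∘ sym)) (h j (ℕ.≤∧≢⇒< k≤j k≢j) j<)

  sumRow-correct : ∀ (h : Fin n → Fin n → ℕ) rem acc σ → reg σ reg-one ≡ 1 → reg σ reg-p ≡ length rem →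
    length rem ≤ length es →
    Stored (arr σ rowsT) row rem → Stored (arr σ valsT) (λ (i , j) → h i j) rem →
    arr σ arrT1 holds (λ v → sum (map (h v) (nbrs v acc))) →
    (∀ v → sum (map (h v) (nbrs v (rem ʳ++ acc))) < words L) →
    (∀ σ′ → arr σ′ arrT1 holds (λ v → sum (map (h v) (nbrs v (rem ʳ++ acc)))) → Q b σ′) →
    Runs (loopDown sumRow) σ (length rem * 7 + suc b) Q
  sumRow-correct h [] acc σ one p len rs xs t bound post = exit-rule p (post σ t)
  sumRow-correct h ((i , j) ∷ rem) acc σ one p len (r , rs) (x , xs) t bound post =
    loop-rule p $
    seq $ op-rule p one refl (small (ℕ.<⇒≤ len)) $
    seq $ load-rule refl k<c r (vertex-word i) $
    seq $ load-rule refl k<c x (ℕ.≤-<-trans (ℕ.m≤m+n _ _) sum<) $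
    seq $ load-rule refl (vertex-cell i) (t i) (ℕ.≤-<-trans (ℕ.m≤n+m _ _) sum<) $
    seq $ op-rule refl refl (ℕ.+-comm _ (h i j)) sum< $
    store-rule refl (vertex-cell i) refl $
    sumRow-correct h rem ((i , j) ∷ acc) _ one refl (ℕ.<⇒≤ len) rs xs
      (holds-nbrs (λ v us → sum (map (h v) us)) (arr σ arrT1) i j acc t refl) bound post
    where
    k<c = ℕ.<-≤-trans len es≤cells
    sum< : h i j + sum (map (h i) (nbrs i acc)) < words L
    sum< = ℕ.≤-<-trans (ℕ.≤-trans (ℕ.≤-reflexive (cong (sum ∘ map (h i)) (sym (nbrs-same i j acc))))
      (sum-nbrs-≤-ʳ++ (h i) i rem ((i , j) ∷ acc))) (bound i)

  sumAll-correct : ∀ (h : Fin n × Fin n → ℕ) rem acc σ → reg σ reg-one ≡ 1 → reg σ reg-p ≡ length rem →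
    length rem ≤ length es → Stored (arr σ valsT) h rem →
    reg σ reg-den ≡ sum (map h acc) → sum (map h (rem ʳ++ acc)) < words L →
    (∀ σ′ → reg σ′ reg-den ≡ sum (map h (rem ʳ++ acc)) → Q b σ′) →
    Runs (loopDown sumAll) σ (length rem * 4 + suc b) Q
  sumAll-correct h [] acc σ one p len xs den bound post = exit-rule p (post σ den)
  sumAll-correct h (x ∷ rem) acc σ one p len (x≡ , xs) den bound post =
    loop-rule p $
    seq $ op-rule p one refl (small (ℕ.<⇒≤ len)) $
    seq $ load-rule refl (ℕ.<-≤-trans len es≤cells) x≡ (ℕ.≤-<-trans (ℕ.m≤m+n _ _) sum<) $
    op-rule den refl (ℕ.+-comm _ (h x)) sum< $
    sumAll-correct h rem (x ∷ acc) _ one refl (ℕ.<⇒≤ len) xs refl bound post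
    where
    sum< : h x + sum (map h acc) < words L
    sum< = ℕ.≤-<-trans (sum-map-≤-ʳ++ h rem (x ∷ acc)) bound

  copyRow-correct : ∀ (F G : Fin n → ℕ) rem σ → reg σ reg-one ≡ 1 → reg σ reg-p ≡ length rem →
    length rem ≤ length es → Stored (arr σ rowsT) row rem →
    arr σ arrT1 holds F → (∀ v → F v < words L) → arr σ num holds G →
    (∀ σ′ → arr σ′ num holds copied F rem G → Q b σ′) →
    Runs (loopDown copyRow) σ (length rem * 5 + suc b) Q
  copyRow-correct F G [] σ one p len rs f F< g post = exit-rule p (post σ g)
  copyRow-correct F G ((i , j) ∷ rem) σ one p len (r , rs) f F< g post =
    loop-rule p $
    seq $ op-rule p one refl (small (ℕ.<⇒≤ len)) $
    seq $ load-rule refl (ℕ.<-≤-trans len es≤cells) r (vertex-word i) $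
    seq $ load-rule refl (vertex-cell i) (f i) (F< i) $
    store-rule refl (vertex-cell i) refl $
    copyRow-correct F (G [ i ↦ F i ]) rem _ one refl (ℕ.<⇒≤ len) rs f F< (holds-write (arr σ num) i g) post

  addRow-correct : ∀ (F G : Fin n → ℕ) rem acc σ → reg σ reg-one ≡ 1 → reg σ reg-three ≡ 3 → reg σ reg-p ≡ length rem →
    length rem ≤ length es → Stored (arr σ rows) row rem → Stored (arr σ cols) col rem →
    arr σ arrT1 holds F → arr σ num holds (λ v → G v + sum (map (λ u → 3 * F u) (nbrs v acc))) →
    (∀ v → G v + sum (map (λ u → 3 * F u) (nbrs v (rem ʳ++ acc))) < words L) →
    (∀ σ′ → arr σ′ num holds (λ v → G v + sum (map (λ u → 3 * F u) (nbrs v (rem ʳ++ acc)))) → Q b σ′) →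
    Runs (loopDown addRow) σ (length rem * 9 + suc b) Q
  addRow-correct F G [] acc σ one three p len rs cs f g bound post = exit-rule p (post σ g)
  addRow-correct F G ((i , j) ∷ rem) acc σ one three p len (r , rs) (c , cs) f g bound post =
    loop-rule p $
    seq $ op-rule p one refl (small (ℕ.<⇒≤ len)) $
    seq $ load-rule refl k<c r (vertex-word i) $
    seq $ load-rule refl k<c c (vertex-word j) $
    seq $ load-rule refl (vertex-cell j) (f j) (ℕ.≤-<-trans (ℕ.m≤n*m (F j) 3) 3F<) $
    seq $ op-rule three refl refl 3F< $
    seq $ load-rule refl (vertex-cell i) (g i) (ℕ.≤-<-trans (ℕ.+-monoʳ-≤ (G i) (ℕ.m≤n+m _ (3 * F j))) sum<) $
    seq $ op-rule refl refl shift sum< $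
    store-rule refl (vertex-cell i) refl $
    addRow-correct F G rem ((i , j) ∷ acc) _ one three refl (ℕ.<⇒≤ len) rs cs f
      (holds-nbrs (λ v us → G v + sum (map (λ u → 3 * F u) us)) (arr σ num) i j acc g refl) bound post
    where
    k<c = ℕ.<-≤-trans len es≤cells
    s = sum (map (λ u → 3 * F u) (nbrs i acc))
    shift : G i + s + 3 * F j ≡ G i + (3 * F j + s)
    shift = trans (ℕ.+-assoc (G i) s _) (cong (G i +_) (ℕ.+-comm s _))
    sum< : G i + (3 * F j + s) < words L
    sum< = ℕ.≤-<-trans (ℕ.+-monoʳ-≤ (G i) (ℕ.≤-trans (ℕ.≤-reflexive (cong (sum ∘ map (λ u → 3 * F u)) (sym (nbrs-same i j acc))))
      (sum-nbrs-≤-ʳ++ (λ u → 3 * F u) i rem ((i , j) ∷ acc)))) (bound i)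
    3F< : 3 * F j < words L
    3F< = ℕ.≤-<-trans (ℕ.≤-trans (ℕ.m≤m+n _ s) (ℕ.m≤n+m _ (G i))) sum<

  subtractRow-correct : ∀ (F G : Fin n → ℕ) rem acc σ → reg σ reg-one ≡ 1 → reg σ reg-two ≡ 2 → reg σ reg-p ≡ length rem →
    length rem ≤ length es → Stored (arr σ rowsT) row rem → Stored (arr σ colsT) col rem →
    arr σ arrT1 holds F → arr σ num holds (λ v → G v ∸ sum (map (λ u → 2 * F u) (nbrs v acc))) →
    (∀ v → 2 * F v < words L) → (∀ v → G v < words L) →
    (∀ σ′ → arr σ′ num holds (λ v → G v ∸ sum (map (λ u → 2 * F u) (nbrs v (rem ʳ++ acc)))) → Q b σ′) →
    Runs (loopDown subtractRow) σ (length rem * 9 + suc b) Q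
  subtractRow-correct F G [] acc σ one two p len rs cs f g F< G< post = exit-rule p (post σ g)
  subtractRow-correct F G ((i , j) ∷ rem) acc σ one two p len (r , rs) (c , cs) f g F< G< post =
    loop-rule p $
    seq $ op-rule p one refl (small (ℕ.<⇒≤ len)) $
    seq $ load-rule refl k<c r (vertex-word i) $
    seq $ load-rule refl k<c c (vertex-word j) $
    seq $ load-rule refl (vertex-cell j) (f j) (ℕ.≤-<-trans (ℕ.m≤n*m (F j) 2) (F< j)) $
    seq $ op-rule two refl refl (F< j) $
    seq $ load-rule refl (vertex-cell i) (g i) (ℕ.≤-<-trans (ℕ.m∸n≤m (G i) s) (G< i)) $
    seq $ op-rule refl refl shift (ℕ.≤-<-trans (ℕ.m∸n≤m (G i) (2 * F j + s)) (G< i)) $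
    store-rule refl (vertex-cell i) refl $
    subtractRow-correct F G rem ((i , j) ∷ acc) _ one two refl (ℕ.<⇒≤ len) rs cs f
      (holds-nbrs (λ v us → G v ∸ sum (map (λ u → 2 * F u) us)) (arr σ num) i j acc g refl) F< G< post
    where
    k<c = ℕ.<-≤-trans len es≤cells
    s = sum (map (λ u → 2 * F u) (nbrs i acc))
    -- Truncated subtractions compose, so the pass amounts to one subtraction of the total; that
    -- this total does not exceed `G i` is settled separately, with `net`.
    shift : G i ∸ s ∸ 2 * F j ≡ G i ∸ (2 * F j + s)
    shift = trans (ℕ.∸-+-assoc (G i) s (2 * F j)) (cong (G i ∸_) (ℕ.+-comm s (2 * F j)))

  record Output (F : Fin n → ℕ) (den : ℕ) (I N D : ℕ → ℕ) (k : ℕ) (vs : List (Fin n)) : Set where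
    constructor outputs
    field
      storedI : Stored I toℕ vs
      storedN : Stored N F vs
      storedD : Stored D (const den) vs
      len     : k ≡ length vs

  OutputAt : (Fin n → ℕ) → ℕ → State (2 + R) (3 + K) → List (Fin n) → Set
  OutputAt F den σ = Output F den (arr σ inds) (arr σ nums) (arr σ dens) (reg σ reg-out)

  length-collect : ∀ (F : Fin n → ℕ) rem D → length D ≤ length (collect F rem D)
  length-collect F [] D = ℕ.≤-refl
  length-collect F ((v , _) ∷ rem) D = ℕ.≤-trans (grow (v ∈? D) (F v)) (length-collect F rem _)
    where
    grow : (d : Dec (v ∈ D)) → ∀ k → length D ≤ length (extend d k v D)
    grow (yes _) k = ℕ.≤-refl
    grow (no _) zero = ℕ.≤-refl
    grow (no _) (suc _) = ℕ.n≤1+n _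

  output-correct : ∀ (F : Fin n → ℕ) den rem D σ → reg σ reg-one ≡ 1 → reg σ reg-zero ≡ 0 → reg σ reg-den ≡ den →
    reg σ reg-p ≡ length rem → length rem ≤ length es → Stored (arr σ rows) row rem →
    arr σ num holds residue F D → (∀ v → F v < words L) → OutputAt F den σ D →
    length (collect F rem D) ≤ cells L → length (collect F rem D) < words L →
    (∀ σ′ → OutputAt F den σ′ (collect F rem D) → Q b σ′) →
    Runs (loopDown output) σ (length rem * 10 + suc b) Q
  output-correct F den [] D σ one zer dn p len rs g F< out cap cap′ post = exit-rule p (post σ out)
  output-correct {Q = Q} {b = b} F den ((v , j) ∷ rem) D σ one zer dn p len (r , rs) g F< out cap cap′ post =
    loop-rule p $
    seq $ op-rule p one refl (small (ℕ.<⇒≤ len)) $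
    seq $ load-rule refl (ℕ.<-≤-trans len es≤cells) r (vertex-word v) $
    seq $ load-rule refl (vertex-cell v) (g v) (ℕ.≤-<-trans (residue≤ (v ∈? D)) (F< v)) $
    branch (v ∈? D) refl (F v) refl
    where
    residue≤ : (d : Dec (v ∈ D)) → (if does d then 0 else F v) ≤ F v
    residue≤ (yes _) = z≤n
    residue≤ (no _) = ℕ.≤-refl

    σ₁ : State (2 + R) (3 + K)
    σ₁ = setReg reg-x (residue F D v) (setReg reg-v (toℕ v) (setReg reg-p (length rem) σ))

    x≡ : ∀ {d : Dec (v ∈ D)} {y} → d ≡ (v ∈? D) → y ≡ F v → residue F D v ≡ (if does d then 0 else y)
    x≡ refl refl = refl

    D≡ : ∀ {d : Dec (v ∈ D)} {y} → d ≡ (v ∈? D) → y ≡ F v → extend d y v D ≡ extend (v ∈? D) (F v) v D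
    D≡ refl refl = refl

    store-output : Command
    store-output =
      store inds reg-out reg-v ⨾ store nums reg-out reg-x ⨾ store dens reg-out reg-den ⨾
      reg-out ≔ op add reg-out reg-one ⨾ store num reg-v reg-zero

    continue : ∀ {σ′ D′} → D′ ≡ extend (v ∈? D) (F v) v D → reg σ′ reg-one ≡ 1 → reg σ′ reg-zero ≡ 0 → reg σ′ reg-den ≡ den →
      reg σ′ reg-p ≡ length rem → Stored (arr σ′ rows) row rem → arr σ′ num holds residue F D′ → OutputAt F den σ′ D′ →
      Runs (loopDown output) σ′ (length rem * 10 + suc b) Q
    continue refl one zer dn p rs g out = output-correct F den rem _ _ one zer dn p (ℕ.<⇒≤ len) rs g F< out cap cap′ post

    branch : (d : Dec (v ∈ D)) → d ≡ (v ∈? D) → ∀ y → y ≡ F v →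
      Runs (if≢0 reg-x then store-output else skip) σ₁ (6 + (length rem * 10 + suc b))
        (λ b′ σ′ → Runs (loopDown output) σ′ b′ Q)
    branch (yes v∈) d≡ y y≡ = weaken (ℕ.m≤n+m _ 4) $ else-rule (x≡ d≡ y≡) $ skip-rule $
      continue (D≡ d≡ y≡) one zer dn refl rs g out
    branch (no v∉) d≡ zero y≡ = weaken (ℕ.m≤n+m _ 4) $ else-rule (x≡ d≡ y≡) $ skip-rule $
      continue (D≡ d≡ y≡) one zer dn refl rs g out
    branch (no v∉) d≡ (suc y) y≡ =
      then-rule (x≡ d≡ y≡) $
      seq $ store-rule k k<c refl $
      seq $ store-rule k k<c (trans (x≡ d≡ y≡) y≡) $
      seq $ store-rule k k<c dn $
      seq $ op-rule k one (ℕ.+-comm _ 1) k<w $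
      store-rule refl (vertex-cell v) zer $
      continue (D≡ d≡ y≡) one zer dn refl rs
        (λ w → trans (holds-write (arr σ num) v g w) (residue-∷ F v D w))
        (outputs (stored-push v D refl (Output.storedI out)) (stored-push v D refl (Output.storedN out))
                 (stored-push v D refl (Output.storedD out)) refl)
      where
      k = Output.len out
      grown : suc (length D) ≤ length (collect F ((v , j) ∷ rem) D)
      grown = ℕ.≤-trans (ℕ.≤-reflexive (cong length (D≡ d≡ y≡))) (length-collect F rem _)
      k<c : length D < cells L
      k<c = ℕ.≤-trans grown cap
      k<w : suc (length D) < words L
      k<w = ℕ.≤-<-trans grown cap′

-- The entries of A and T

unique-∷ : ∀ {ℓ} {B : Set ℓ} {x : B} {xs} → x ∉ xs → Unique xs → Unique (x ∷ xs)
unique-∷ {x = x} x∉ u = All.tabulate (λ y∈ x≡y → x∉ (subst (_∈ _) (sym x≡y) y∈)) ∷ u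

unique-∉ : ∀ {ℓ} {B : Set ℓ} {x : B} {xs} → Unique (x ∷ xs) → x ∉ xs
unique-∉ (x# ∷ _) x∈ = All.lookup x# x∈ refl

∈-nbrs⁺ : ∀ {n} {v u : Fin n} l → (v , u) ∈ l → u ∈ nbrs v l
∈-nbrs⁺ {v = v} ((i , j) ∷ l) p with v F.≟ i
∈-nbrs⁺ ((i , j) ∷ l) (here refl) | yes _ = here refl
∈-nbrs⁺ ((i , j) ∷ l) (there p) | yes _ = there (∈-nbrs⁺ l p)
∈-nbrs⁺ ((i , j) ∷ l) (here refl) | no v≢i = ⊥-elim (v≢i refl)
∈-nbrs⁺ ((i , j) ∷ l) (there p) | no _ = ∈-nbrs⁺ l p

∈-nbrs⁻ : ∀ {n} {v u : Fin n} l → u ∈ nbrs v l → (v , u) ∈ l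
∈-nbrs⁻ {v = v} ((i , j) ∷ l) p with v F.≟ i
∈-nbrs⁻ ((i , j) ∷ l) (here refl) | yes refl = here refl
∈-nbrs⁻ ((i , j) ∷ l) (there p) | yes _ = there (∈-nbrs⁻ l p)
∈-nbrs⁻ ((i , j) ∷ l) p | no _ = there (∈-nbrs⁻ l p)

nbrs-unique : ∀ {n} {v : Fin n} l → Unique l → Unique (nbrs v l)
nbrs-unique [] u = []
nbrs-unique {v = v} ((i , j) ∷ l) u@(_ ∷ u′) with v F.≟ i
... | yes refl = unique-∷ (unique-∉ u ∘ ∈-nbrs⁻ l) (nbrs-unique l u′)
... | no _ = nbrs-unique l u′

-- Row sums of a stored matrix, used with adjacency for the entries of A and with `support` for
-- those of T.
sum-nbrs : ∀ {n ℓ} {P : Fin n → Fin n → Set ℓ} (P? : ∀ v u → Dec (P v u)) l → Unique l →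
  (∀ v u → (v , u) ∈ l → P v u) → (∀ v u → P v u → (v , u) ∈ l) →
  ∀ f v → sum (map f (nbrs v l)) ≡ ∑ (λ u → 𝟙 (P? v u) * f u)
sum-nbrs P? l uq p⁺ p⁻ f v = sum-unique (P? v) f (nbrs v l) (nbrs-unique l uq)
  (λ u → p⁺ v u ∘ ∈-nbrs⁻ l) (λ u → ∈-nbrs⁺ l ∘ p⁻ v u)

∑-nbrs : ∀ {n} (f : Fin n → Fin n → ℕ) l → ∑ (λ v → sum (map (f v) (nbrs v l))) ≡ sum (map (λ (i , j) → f i j) l)
∑-nbrs {n} f [] = ∑≡0 {n} λ _ → refl
∑-nbrs {n} f ((i , j) ∷ l) = begin
  ∑ (λ v → sum (map (f v) (nbrs v ((i , j) ∷ l))))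
    ≡⟨ ∑-cong step ⟩
  ∑ (λ v → 𝟙 (i F.≟ v) * f v j + sum (map (f v) (nbrs v l)))
    ≡⟨ ∑-+ (λ v → 𝟙 (i F.≟ v) * f v j) _ ⟩
  ∑ (λ v → 𝟙 (i F.≟ v) * f v j) + ∑ (λ v → sum (map (f v) (nbrs v l)))
    ≡⟨ cong₂ _+_ (∑-select (λ v → f v j) i) (∑-nbrs f l) ⟩
  f i j + sum (map (λ (i , j) → f i j) l) ∎
  where
  open ≡-Reasoning
  step : ∀ v → sum (map (f v) (nbrs v ((i , j) ∷ l))) ≡ 𝟙 (i F.≟ v) * f v j + sum (map (f v) (nbrs v l))
  step v with v F.≟ i
  ... | yes refl rewrite dec-true (v F.≟ v) refl = cong (_+ sum (map (f v) (nbrs v l))) (sym (ℕ.+-identityʳ (f v j)))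
  ... | no v≢i rewrite dec-false (i F.≟ v) (v≢i ∘ sym) = refl

-- Overwriting a vertex repeatedly with the same value is harmless, so agreement beforehand matters
-- only at vertices that head no entry.
copied-≡ : ∀ {n} (F : Fin n → ℕ) l G → (∀ v → nbrs v l ≡ [] → F v ≡ G v) → ∀ v → copied F l G v ≡ F v
copied-≡ F [] G h v = sym (h v refl)
copied-≡ F ((i , j) ∷ l) G h v = copied-≡ F l (G [ i ↦ F i ]) h′ v
  where
  h′ : ∀ v → nbrs v l ≡ [] → F v ≡ (G [ i ↦ F i ]) v
  h′ v e with v F.≟ i | h v
  ... | yes refl | _ = refl
  ... | no _ | hv = hv e

module _ {n} (F : Fin n → ℕ) where

  extend-⊇ : ∀ {ℓ} {P : Set ℓ} (d : Dec P) k v {w} {D : List (Fin n)} → w ∈ D → w ∈ extend d k v D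
  extend-⊇ (yes _) k v w∈ = w∈
  extend-⊇ (no _) zero v w∈ = w∈
  extend-⊇ (no _) (suc _) v w∈ = there w∈

  collect-⊇ : ∀ rem D {w} → w ∈ D → w ∈ collect F rem D
  collect-⊇ [] D w∈ = w∈
  collect-⊇ ((v , _) ∷ rem) D w∈ = collect-⊇ rem _ (extend-⊇ (v ∈? D) (F v) v w∈)

  collect-∈⁺ : ∀ rem D {w j} → (w , j) ∈ rem → F w ≢ 0 → w ∈ collect F rem D
  collect-∈⁺ ((v , _) ∷ rem) D (here refl) F≢ = collect-⊇ rem _ (new (v ∈? D) (F v) F≢)
    where
    new : (d : Dec (v ∈ D)) → ∀ k → k ≢ 0 → v ∈ extend d k v D
    new (yes v∈) k k≢ = v∈
    new (no _) zero k≢ = ⊥-elim (k≢ refl)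
    new (no _) (suc _) k≢ = here refl
  collect-∈⁺ ((v , _) ∷ rem) D (there p) F≢ = collect-∈⁺ rem _ p F≢

  collect-∈⁻ : ∀ rem D {w} → w ∈ collect F rem D → w ∈ D ⊎ F w ≢ 0
  collect-∈⁻ [] D w∈ = inj₁ w∈
  collect-∈⁻ ((v , _) ∷ rem) D w∈ with collect-∈⁻ rem _ w∈
  ... | inj₂ h = inj₂ h
  ... | inj₁ h = old (v ∈? D) (F v) refl h
    where
    old : ∀ (d : Dec (v ∈ D)) k {w} → k ≡ F v → w ∈ extend d k v D → w ∈ D ⊎ F w ≢ 0
    old (yes _) k e h = inj₁ h
    old (no _) zero e h = inj₁ h
    old (no _) (suc _) e (here refl) = inj₂ λ z → ℕ.0≢1+n (sym (trans e z))
    old (no _) (suc _) e (there h) = inj₁ h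

  collect-unique : ∀ rem D → Unique D → Unique (collect F rem D)
  collect-unique [] D u = u
  collect-unique ((v , _) ∷ rem) D u = collect-unique rem _ (step (v ∈? D) (F v))
    where
    step : (d : Dec (v ∈ D)) → ∀ k → Unique (extend d k v D)
    step (yes _) k = u
    step (no _) zero = u
    step (no v∉) (suc _) = unique-∷ v∉ u

length-unique : ∀ {n} (xs : List (Fin n)) → Unique xs → length xs ≤ n
length-unique {n} xs u = ℕ.≤-trans (ℕ.≤-reflexive (trans (length≡sum xs)
  (sum-unique (_∈? xs) (const 1) xs u (λ _ h → h) (λ _ h → h))))
  (ℕ.≤-trans (∑-bounded {n} {b = 1} (λ i → bit (i ∈? xs))) (ℕ.≤-reflexive (ℕ.*-identityʳ n)))
  where
  bit : ∀ {ℓ} {P : Set ℓ} (d : Dec P) → 𝟙 d * 1 ≤ 1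
  bit (yes _) = ℕ.≤-refl
  bit (no _) = z≤n

-- What the search finds, and its amortised cost

module SearchProperties {n} (es : List (Fin n × Fin n)) (τ : Fin n → Fin n → ℕ) (es-unique : Unique es) where
  open Search es τ

  -- The pair v , u whose visit emits the entry p.
  Origin : Fin n × Fin n → Fin n → Fin n → Set
  Origin (i , j) v u = (i ≡ v × j ≡ u × dg u ≤ dg v) ⊎ (i ≡ u × j ≡ v × dg u < dg v)

  -- The degrees of its two ends tell which visit an entry comes from, ties going to the visit of
  -- its row. This is why no entry is emitted twice.
  origin-functional : ∀ {p v u v′ u′} → Origin p v u → Origin p v′ u′ → v ≡ v′ × u ≡ u′
  origin-functional (inj₁ (refl , refl , _)) (inj₁ (refl , refl , _)) = refl , refl
  origin-functional (inj₁ (refl , refl , p)) (inj₂ (refl , refl , q)) = ⊥-elim (ℕ.<⇒≱ q p)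
  origin-functional (inj₂ (refl , refl , q)) (inj₁ (refl , refl , p)) = ⊥-elim (ℕ.<⇒≱ q p)
  origin-functional (inj₂ (refl , refl , _)) (inj₂ (refl , refl , _)) = refl , refl

  found-⊇ : ∀ v u l {p} → p ∈ l → p ∈ found v u l
  found-⊇ v u l = go (dg u ∸ dg v) (τ v u) (dg v ∸ dg u)
    where
    go : ∀ x y z {p} → p ∈ l → p ∈ entries x y z v u l
    go (suc _) y z p∈ = p∈
    go zero zero z p∈ = p∈
    go zero (suc _) zero p∈ = there p∈
    go zero (suc _) (suc _) p∈ = there (there p∈)

  found-∈⁻ : ∀ v u l {p} → p ∈ found v u l → p ∈ l ⊎ (Origin p v u × τ v u ≢ 0)
  found-∈⁻ v u l = go (dg u ∸ dg v) (τ v u) (dg v ∸ dg u) refl refl refl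
    where
    go : ∀ x y z {p} → x ≡ dg u ∸ dg v → y ≡ τ v u → z ≡ dg v ∸ dg u →
      p ∈ entries x y z v u l → p ∈ l ⊎ (Origin p v u × τ v u ≢ 0)
    go (suc _) y z ex ey ez p∈ = inj₁ p∈
    go zero zero z ex ey ez p∈ = inj₁ p∈
    go zero (suc _) zero ex ey ez (here refl) = inj₂ (inj₁ (refl , refl , ℕ.m∸n≡0⇒m≤n (sym ex)) , λ e → ℕ.0≢1+n (sym (trans ey e)))
    go zero (suc _) zero ex ey ez (there p∈) = inj₁ p∈
    go zero (suc _) (suc _) ex ey ez (here refl) =
      inj₂ (inj₂ (refl , refl , ℕ.m∸n≢0⇒n<m λ e → ℕ.0≢1+n (sym (trans ez e))) , λ e → ℕ.0≢1+n (sym (trans ey e)))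
    go zero (suc _) (suc _) ex ey ez (there (here refl)) =
      inj₂ (inj₁ (refl , refl , ℕ.m∸n≡0⇒m≤n (sym ex)) , λ e → ℕ.0≢1+n (sym (trans ey e)))
    go zero (suc _) (suc _) ex ey ez (there (there p∈)) = inj₁ p∈

  found-∈⁺ : ∀ v u l {p} → Origin p v u → τ v u ≢ 0 → p ∈ found v u l
  found-∈⁺ v u l = go (dg u ∸ dg v) (τ v u) (dg v ∸ dg u) refl refl
    where
    go : ∀ x y z {p} → x ≡ dg u ∸ dg v → z ≡ dg v ∸ dg u → Origin p v u → y ≢ 0 → p ∈ entries x y z v u l
    go (suc _) y z ex ez (inj₁ (refl , refl , le)) y≢ = ⊥-elim (ℕ.0≢1+n (trans (sym (ℕ.m≤n⇒m∸n≡0 le)) (sym ex)))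
    go (suc _) y z ex ez (inj₂ (refl , refl , lt)) y≢ = ⊥-elim (ℕ.0≢1+n (trans (sym (ℕ.m≤n⇒m∸n≡0 (ℕ.<⇒≤ lt))) (sym ex)))
    go zero zero z ex ez o y≢ = ⊥-elim (y≢ refl)
    go zero (suc _) zero ex ez (inj₁ (refl , refl , _)) y≢ = here refl
    go zero (suc _) zero ex ez (inj₂ (refl , refl , lt)) y≢ = ⊥-elim (ℕ.<⇒≱ lt (ℕ.m∸n≡0⇒m≤n (sym ez)))
    go zero (suc _) (suc _) ex ez (inj₁ (refl , refl , _)) y≢ = there (here refl)
    go zero (suc _) (suc _) ex ez (inj₂ (refl , refl , _)) y≢ = here refl

  found-unique : ∀ v u l → Unique l → (∀ {p} → p ∈ l → ¬ Origin p v u) → Unique (found v u l)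
  found-unique v u l uq old = go (dg u ∸ dg v) (τ v u) (dg v ∸ dg u) refl refl
    where
    go : ∀ x y z → x ≡ dg u ∸ dg v → z ≡ dg v ∸ dg u → Unique (entries x y z v u l)
    go (suc _) y z ex ez = uq
    go zero zero z ex ez = uq
    go zero (suc _) zero ex ez = unique-∷ (λ p∈ → old p∈ (inj₁ (refl , refl , ℕ.m∸n≡0⇒m≤n (sym ex)))) uq
    go zero (suc _) (suc _) ex ez = unique-∷ swapped∉ (unique-∷ (λ p∈ → old p∈ (inj₁ (refl , refl , ℕ.m∸n≡0⇒m≤n (sym ex)))) uq)
      where
      lt : dg u < dg v
      lt = ℕ.m∸n≢0⇒n<m λ e → ℕ.0≢1+n (sym (trans ez e))
      -- Equality of the two pairs would force u = v, against the strict inequality of degrees.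
      swapped∉ : (u , v) ∉ (v , u) ∷ l
      swapped∉ (here refl) = ℕ.<-irrefl refl lt
      swapped∉ (there p∈) = old p∈ (inj₂ (refl , refl , lt))

  founds-⊇ : ∀ v us l {p} → p ∈ l → p ∈ founds v us l
  founds-⊇ v [] l p∈ = p∈
  founds-⊇ v (u ∷ us) l p∈ = founds-⊇ v us (found v u l) (found-⊇ v u l p∈)

  founds-∈⁻ : ∀ v us l {p} → p ∈ founds v us l → p ∈ l ⊎ ∃[ u ] (u ∈ us × Origin p v u × τ v u ≢ 0)
  founds-∈⁻ v [] l p∈ = inj₁ p∈
  founds-∈⁻ v (u ∷ us) l p∈ with founds-∈⁻ v us (found v u l) p∈
  ... | inj₂ (w , w∈ , h) = inj₂ (w , there w∈ , h)
  ... | inj₁ p∈′ with found-∈⁻ v u l p∈′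
  ... | inj₁ h = inj₁ h
  ... | inj₂ h = inj₂ (u , here refl , h)

  founds-∈⁺ : ∀ v us l {p u} → u ∈ us → Origin p v u → τ v u ≢ 0 → p ∈ founds v us l
  founds-∈⁺ v (u ∷ us) l (here refl) o τ≢ = founds-⊇ v us (found v u l) (found-∈⁺ v u l o τ≢)
  founds-∈⁺ v (u ∷ us) l (there u∈) o τ≢ = founds-∈⁺ v us (found v u l) u∈ o τ≢

  founds-unique : ∀ v us l → Unique us → Unique l → (∀ {p u} → p ∈ l → u ∈ us → ¬ Origin p v u) → Unique (founds v us l)
  founds-unique v [] l uqs uq old = uq
  founds-unique v (u ∷ us) l uqs@(_ ∷ uqs′) uq old = founds-unique v us (found v u l) uqs′
    (found-unique v u l uq λ p∈ → old p∈ (here refl)) old′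
    where
    old′ : ∀ {p w} → p ∈ found v u l → w ∈ us → ¬ Origin p v w
    old′ p∈ w∈ o with found-∈⁻ v u l p∈
    ... | inj₁ p∈l = old p∈l (there w∈) o
    ... | inj₂ (o′ , _) = unique-∉ uqs (subst (_∈ us) (proj₂ (origin-functional o o′)) w∈)

  allFound-∈⁻ : ∀ D {p} → p ∈ allFound D [] → ∃[ v ] ∃[ u ] (v ∈ D × u ∈ nb v × Origin p v u × τ v u ≢ 0)
  allFound-∈⁻ (v ∷ D) p∈ with founds-∈⁻ v (nb v) (allFound D []) p∈
  ... | inj₂ (u , u∈ , h) = v , u , here refl , u∈ , h
  ... | inj₁ p∈′ with allFound-∈⁻ D p∈′
  ... | w , u , w∈ , h = w , u , there w∈ , h

  allFound-∈⁺ : ∀ D {p v u} → v ∈ D → u ∈ nb v → Origin p v u → τ v u ≢ 0 → p ∈ allFound D []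
  allFound-∈⁺ (v ∷ D) (here refl) u∈ o τ≢ = founds-∈⁺ v (nb v) (allFound D []) u∈ o τ≢
  allFound-∈⁺ (v ∷ D) (there v∈) u∈ o τ≢ = founds-⊇ v (nb v) (allFound D []) (allFound-∈⁺ D v∈ u∈ o τ≢)

  -- An entry emitted in two visits would have two origins, hence the two visits would be of the
  -- same vertex; but `D` lists each vertex once.
  allFound-unique : ∀ D → Unique D → Unique (allFound D [])
  allFound-unique [] uq = []
  allFound-unique (v ∷ D) uq@(_ ∷ uq′) = founds-unique v (nb v) (allFound D []) (nbrs-unique es es-unique) (allFound-unique D uq′) old
    where
    old : ∀ {p u} → p ∈ allFound D [] → u ∈ nb v → ¬ Origin p v u
    old p∈ u∈ o with allFound-∈⁻ D p∈
    ... | w , _ , w∈ , _ , o′ , _ = unique-∉ uq (subst (_∈ D) (sym (proj₁ (origin-functional o o′))) w∈)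

  -- Bounds the cost of the visit of v. All of it is charged to the neighbours
  -- of v, because isolated vertices must cost nothing.
  weight : Fin n → ℕ
  weight v = sum (map (λ u → 42 + (dg u ⊓ dg v) * 6) (nb v))

  private
    -- Apart from the scan a neighbour costs 21 steps: 9 before it, 1 for its final test, and 11 to
    -- test the count and emit up to two entries.
    neighboursCost≡ : ∀ v us b → neighboursCost v us b ≡ sum (map (λ u → 21 + (dg u ⊓ dg v) * 6) us) + suc b
    neighboursCost≡ v [] b = refl
    neighboursCost≡ v (u ∷ us) b rewrite neighboursCost≡ v us b =
      solve ((dg u ⊓ dg v) * 6) (sum (map (λ u → 21 + (dg u ⊓ dg v) * 6) us)) b
      where
      solve : ∀ x s b → 9 + (x + suc (11 + (s + suc b))) ≡ 21 + x + s + suc b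
      solve = solve-∀

    split-weight : ∀ v us → sum (map (λ u → 42 + (dg u ⊓ dg v) * 6) us) ≡ length us * 21 + sum (map (λ u → 21 + (dg u ⊓ dg v) * 6) us)
    split-weight v [] = refl
    split-weight v (u ∷ us) rewrite split-weight v us =
      solve ((dg u ⊓ dg v) * 6) (length us * 21) (sum (map (λ u → 21 + (dg u ⊓ dg v) * 6) us))
      where
      solve : ∀ x k s → 42 + x + (k + s) ≡ 21 + k + (21 + x + s)
      solve = solve-∀

    -- Besides the neighbours, a visit costs 11 fixed steps and 10 per neighbour for setting and
    -- clearing marks. Since dg v ≥ 1, the 11 can be charged to each neighbour as well, which gives
    -- the other 21 in the 42 of `weight`. The proposition `⊥` is a dummy: `branchCost` inspects
    -- only the constructor.
    fresh≤weight : ∀ v c → 1 ≤ dg v → branchCost {P = ⊥} (no λ ()) v c ≤ weight v + c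
    fresh≤weight v c 1≤ = begin
      5 + (dg v * 5 + suc (1 + neighboursCost v (nb v) (2 + (dg v * 5 + suc c))))
        ≡⟨ cong (λ x → 5 + (dg v * 5 + suc (1 + x))) (neighboursCost≡ v (nb v) _) ⟩
      5 + (dg v * 5 + suc (1 + (s + suc (2 + (dg v * 5 + suc c)))))
        ≡⟨ solve (dg v) s c ⟩
      11 * 1 + dg v * 10 + s + c
        ≤⟨ ℕ.+-monoˡ-≤ c (ℕ.+-monoˡ-≤ s (ℕ.+-monoˡ-≤ (dg v * 10) (ℕ.*-monoʳ-≤ 11 1≤))) ⟩
      11 * dg v + dg v * 10 + s + c
        ≡⟨ solve′ (dg v) s c ⟩
      dg v * 21 + s + c
        ≡⟨ cong (_+ c) (sym (split-weight v (nb v))) ⟩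
      weight v + c ∎
      where
      open ℕ.≤-Reasoning
      s = sum (map (λ u → 21 + (dg u ⊓ dg v) * 6) (nb v))
      solve : ∀ d s c → 5 + (d * 5 + suc (1 + (s + suc (2 + (d * 5 + suc c))))) ≡ 11 * 1 + d * 10 + s + c
      solve = solve-∀
      solve′ : ∀ d s c → 11 * d + d * 10 + s + c ≡ d * 21 + s + c
      solve′ = solve-∀

  -- The total weight of `D` is a potential: visiting a new `v` raises it by `weight v`, which pays
  -- for the visit. Six steps per entry cover the loop itself and the rows already visited.
  visitCost-bound : ∀ rem D b → (∀ {v j} → (v , j) ∈ rem → 1 ≤ dg v) →
    visitCost rem D b + sum (map weight D) ≤ length rem * 6 + sum (map weight (collect (const 1) rem D)) + suc b
  visitCost-bound [] D b 1≤ = ℕ.≤-reflexive (ℕ.+-comm (suc b) _)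
  visitCost-bound ((v , j) ∷ rem) D b 1≤ = ℕ.≤-trans (step (v ∈? D) D′ (visitCost rem D′ b) refl)
    (ℕ.+-monoʳ-≤ 6 (visitCost-bound rem D′ b (1≤ ∘ there)))
    where
    D′ : List (Fin n)
    D′ = extend (v ∈? D) 1 v D
    step : (d : Dec (v ∈ D)) → ∀ D′ c → D′ ≡ extend d 1 v D →
      4 + branchCost d v c + sum (map weight D) ≤ 6 + (c + sum (map weight D′))
    step (yes _) D′ c refl = ℕ.≤-reflexive (ℕ.+-assoc 6 c _)
    step (no _) D′ c refl = begin
      4 + branchCost {P = ⊥} (no λ ()) v c + s   ≤⟨ ℕ.+-monoˡ-≤ s (ℕ.+-monoʳ-≤ 4 (fresh≤weight v c (1≤ (here refl)))) ⟩
      4 + (weight v + c) + s                     ≤⟨ ℕ.m≤n+m _ 2 ⟩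
      6 + (weight v + c + s)                     ≡⟨ solve (weight v) c s ⟩
      6 + (c + (weight v + s))                   ∎
      where
      open ℕ.≤-Reasoning
      s = sum (map weight D)
      solve : ∀ w c s → 6 + (w + c + s) ≡ 6 + (c + (w + s))
      solve = solve-∀

unique-reverse : ∀ {ℓ} {B : Set ℓ} {xs : List B} → Unique xs → Unique (reverse xs)
unique-reverse {B = B} {xs} = ↭ₛ.Unique-resp-↭ (setoid B) (↭⇒↭ₛ (↭-sym (↭-reverse xs)))

∈-reverse⁺ : ∀ {ℓ} {B : Set ℓ} {x : B} {xs} → x ∈ xs → x ∈ reverse xs
∈-reverse⁺ {xs = xs} = ∈-resp-↭ (↭-sym (↭-reverse xs))

∈-reverse⁻ : ∀ {ℓ} {B : Set ℓ} {x : B} {xs} → x ∈ reverse xs → x ∈ xs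
∈-reverse⁻ {xs = xs} = ∈-resp-↭ (↭-reverse xs)

-- The stored entries of a graph: sums, bounds, and the list of T

module InputProperties {n} (G : Graph n) (es : List (Fin n × Fin n)) (es-unique : Unique es)
  (es-mem : ∀ i j → (i , j) ∈ es ⇔ A G i j ≢ 0ℤ) where

  open Graph G
  open Counting G
  open Cast G
  open Search es τ
  open SearchProperties es τ es-unique

  es⁻ : ∀ i j → (i , j) ∈ es → i ~ j
  es⁻ i j p with i ~? j | Equivalence.to (es-mem i j) p
  ... | yes h | _ = h
  ... | no _ | z = ⊥-elim (z refl)

  es⁺ : ∀ i j → i ~ j → (i , j) ∈ es
  es⁺ i j h = Equivalence.from (es-mem i j) nonzero
    where
    nonzero : A G i j ≢ 0ℤ
    nonzero with i ~? j
    ... | yes _ = λ ()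
    ... | no ≁ = λ _ → ≁ h

  sum-nb : ∀ f v → sum (map f (nb v)) ≡ ∑ (λ u → a v u * f u)
  sum-nb = sum-nbrs _~?_ es es-unique es⁻ es⁺

  ∑-es : (f : Fin n → Fin n → ℕ) → sum (map (λ (i , j) → f i j) es) ≡ ∑ (λ v → ∑ (λ u → a v u * f v u))
  ∑-es f = trans (sym (∑-nbrs f es)) (∑-cong λ v → sum-nb (f v) v)

  dg≡d : ∀ v → dg v ≡ d G v
  dg≡d v = trans (length≡sum (nb v)) (trans (sum-nb (const 1) v) (trans (∑-cong {n} λ u → ℕ.*-identityʳ (a v u)) (sym (d≡∑ v))))

  W : ℕ
  W = minDegreeSum G

  length-es : length es ≡ 2 * m G
  length-es = trans (length≡sum es) (trans (∑-es λ _ _ → 1)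
    (trans (sum-arcs (λ _ _ → 1) λ _ _ → refl) (cong (2 *_) (sym (length≡sum (edges G))))))

  sum-min : sum (map (λ (i , j) → dg j ⊓ dg i) es) ≡ 2 * W
  sum-min = trans (∑-es λ i j → dg j ⊓ dg i)
    (trans (∑-cong λ v → ∑-cong λ u → cong (a v u *_) (trans (ℕ.⊓-comm (dg u) (dg v)) (cong₂ _⊓_ (dg≡d v) (dg≡d u))))
    (sum-arcs (λ u v → d G u ⊓ d G v) λ u v → ℕ.⊓-comm (d G u) (d G v)))

  1≤dg : ∀ {v j} → (v , j) ∈ es → 1 ≤ dg v
  1≤dg {v} p = nonempty (∈-nbrs⁺ es p)
    where
    nonempty : ∀ {x} {xs : List (Fin n)} → x ∈ xs → 1 ≤ length xs
    nonempty (here _) = s≤s z≤n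
    nonempty (there _) = s≤s z≤n

  -- Both ends of an edge have degree at least 1, so each minimum is at least 1. This is what
  -- absorbs a cost proportional to m into m δ̄.
  es≤2W : length es ≤ 2 * W
  es≤2W = ℕ.≤-trans (ℕ.≤-reflexive (length≡sum es)) (ℕ.≤-trans
    (sum-map-mono es λ (i , j) p → ℕ.⊓-glb (1≤dg (es⁺ j i (~-sym (es⁻ i j p)))) (1≤dg p))
    (ℕ.≤-reflexive sum-min))

  -- The marks are the indicator of N(v), so adding them along the list of `u` counts common
  -- neighbours.
  τ-count : ∀ v u → sum (map (λ w → 𝟙 (w ∈? nb v)) (nb u)) ≡ τ v u
  τ-count v u = trans (sum-nb (λ w → 𝟙 (w ∈? nb v)) u) (∑-cong λ w →
    trans (cong₂ _*_ (a-sym u w) (𝟙-⇔ (w ∈? nb v) (v ~? w) (es⁻ v w ∘ ∈-nbrs⁻ es) (∈-nbrs⁺ es ∘ es⁺ v w))) (ℕ.*-comm (a w u) (a v w)))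

  a≤1 : ∀ u v → a u v ≤ 1
  a≤1 u v with u ~? v
  ... | yes _ = ℕ.≤-refl
  ... | no _ = z≤n

  τ≤n : ∀ v u → τ v u ≤ n
  τ≤n v u = ℕ.≤-trans (∑-bounded λ w → ℕ.*-mono-≤ (a≤1 v w) (a≤1 w u)) (ℕ.≤-reflexive (ℕ.*-identityʳ n))

  t≤n : ∀ v u → t v u ≤ n
  t≤n v u = ℕ.≤-trans (ℕ.*-mono-≤ (τ≤n v u) (a≤1 v u)) (ℕ.≤-reflexive (ℕ.*-identityʳ n))

  T1≤ : ∀ v → T1 v ≤ n * n
  T1≤ v = ∑-bounded (t≤n v)

  t≢0⇒~ : ∀ {v u} → t v u ≢ 0 → v ~ u
  t≢0⇒~ {v} {u} t≢ with v ~? u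
  ... | yes h = h
  ... | no _ = ⊥-elim (t≢ (ℕ.*-zeroʳ (τ v u)))

  ~⇒t≡τ : ∀ {v u} → v ~ u → t v u ≡ τ v u
  ~⇒t≡τ {v} {u} h = trans (cong (τ v u *_) (𝟙-yes (v ~? u) h)) (ℕ.*-identityʳ _)

  D : List (Fin n)
  D = collect (const 1) (reverse es) []

  lT : List (Fin n × Fin n)
  lT = allFound D []

  lT-unique : Unique lT
  lT-unique = allFound-unique D (collect-unique (const 1) (reverse es) [] [])

  lT⁻ : ∀ i j → (i , j) ∈ lT → t i j ≢ 0
  lT⁻ i j p with allFound-∈⁻ D p
  ... | v , u , _ , u∈ , inj₁ (refl , refl , _) , τ≢ = τ≢ ∘ trans (sym (~⇒t≡τ (es⁻ v u (∈-nbrs⁻ es u∈))))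
  ... | v , u , _ , u∈ , inj₂ (refl , refl , _) , τ≢ =
    τ≢ ∘ trans (τ-sym v u) ∘ trans (sym (~⇒t≡τ (~-sym (es⁻ v u (∈-nbrs⁻ es u∈)))))

  -- The visit of the end of larger degree produces the entry. Every vertex with a neighbour is
  -- visited, and the case distinction mirrors the two alternatives of `Origin`.
  lT⁺ : ∀ i j → t i j ≢ 0 → (i , j) ∈ lT
  lT⁺ i j t≢ = by-degree (dg j ℕ.≤? dg i)
    where
    i~j : i ~ j
    i~j = t≢0⇒~ t≢
    visited : ∀ {v u} → v ~ u → v ∈ D
    visited {v} {u} h = collect-∈⁺ (const 1) (reverse es) [] (∈-reverse⁺ (es⁺ v u h)) (λ ())
    by-degree : Dec (dg j ≤ dg i) → (i , j) ∈ lT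
    by-degree (yes le) = allFound-∈⁺ D (visited i~j) (∈-nbrs⁺ es (es⁺ i j i~j)) (inj₁ (refl , refl , le))
      (t≢ ∘ trans (~⇒t≡τ i~j))
    by-degree (no ≰) = allFound-∈⁺ D (visited (~-sym i~j)) (∈-nbrs⁺ es (es⁺ j i (~-sym i~j))) (inj₂ (refl , refl , ℕ.≰⇒> ≰))
      (t≢ ∘ trans (~⇒t≡τ i~j) ∘ trans (τ-sym i j))

  sum-nbT : ∀ f v → sum (map f (nbrs v (reverse lT))) ≡ ∑ (λ u → 𝟙 (support v u) * f u)
  sum-nbT = sum-nbrs support (reverse lT) (unique-reverse lT-unique)
    (λ v u → lT⁻ v u ∘ ∈-reverse⁻) (λ v u → ∈-reverse⁺ ∘ lT⁺ v u)

  𝟙t≤a : ∀ v u → 𝟙 (support v u) ≤ a v u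
  𝟙t≤a v u = bound (support v u)
    where
    bound : (d : Dec (t v u ≢ 0)) → 𝟙 d ≤ a v u
    bound (yes t≢) = ℕ.≤-reflexive (sym (𝟙-yes (v ~? u) (t≢0⇒~ t≢)))
    bound (no _) = z≤n

  -- T vanishes off the edges, so its entries fit into the cells reserved for those of A.
  length-lT : length lT ≤ length es
  length-lT = begin
    length lT                                              ≡⟨ sym (L.length-reverse lT) ⟩
    length (reverse lT)                                    ≡⟨ length≡sum (reverse lT) ⟩
    sum (map (const 1) (reverse lT))                       ≡⟨ sym (∑-nbrs (λ _ _ → 1) (reverse lT)) ⟩
    ∑ (λ v → sum (map (const 1) (nbrs v (reverse lT))))    ≡⟨ ∑-cong (λ v → sum-nbT (const 1) v) ⟩
    ∑ (λ v → ∑ (λ u → 𝟙 (support v u) * 1))                   ≤⟨ ∑-mono (λ v → ∑-mono λ u → ℕ.*-monoˡ-≤ 1 (𝟙t≤a v u)) ⟩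
    ∑ (λ v → ∑ (λ u → a v u * 1))                          ≡⟨ sym (∑-es λ _ _ → 1) ⟩
    sum (map (const 1) es)                                 ≡⟨ sym (length≡sum es) ⟩
    length es                                              ∎
    where open ℕ.≤-Reasoning

  -- On the support the stored `τ` equals `t`; elsewhere `t` contributes nothing to the row sum.
  sum-τ : ∀ v → sum (map (τ v) (nbrs v (reverse lT))) ≡ T1 v
  sum-τ v = trans (sum-nbT (τ v) v) (∑-cong λ u → entry u (support v u))
    where
    entry : ∀ u (d : Dec (t v u ≢ 0)) → 𝟙 d * τ v u ≡ t v u
    entry u (yes t≢) = trans (ℕ.+-identityʳ _) (sym (~⇒t≡τ (t≢0⇒~ t≢)))
    entry u (no ¬t≢) = sym (decidable-stable (t v u ℕ.≟ 0) ¬t≢)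

  sum-all-τ : sum (map (λ (i , j) → τ i j) (reverse lT)) ≡ ∑ T1
  sum-all-τ = trans (sym (∑-nbrs τ (reverse lT))) (∑-cong sum-τ)

  copied-T1 : ∀ v → copied T1 lT (λ _ → 0) v ≡ T1 v
  copied-T1 = copied-≡ T1 lT (λ _ → 0) empty
    where
    empty : ∀ v → nbrs v lT ≡ [] → T1 v ≡ 0
    empty v e = ∑≡0 λ u → zero-entry u (support v u)
      where
      zero-entry : ∀ u → Dec (t v u ≢ 0) → t v u ≡ 0
      zero-entry u (no ¬t≢) = decidable-stable (t v u ℕ.≟ 0) ¬t≢
      zero-entry u (yes t≢) with subst (u ∈_) e (∈-nbrs⁺ lT (lT⁺ v u t≢))
      ... | ()

  -- The content of `num` between additions and subtractions; its bound dictates the word size.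
  gross : Fin n → ℕ
  gross v = T1 v + sum (map (λ u → 3 * T1 u) (nb v))

  gross≡ : ∀ v → gross v ≡ T1 v + 3 * ∑ (λ u → a v u * T1 u)
  gross≡ v = cong (T1 v +_) (trans (sum-map-* 3 T1 (nb v)) (cong (3 *_) (sum-nb T1 v)))

  net-loop : ∀ v → gross v ∸ sum (map (λ u → 2 * T1 u) (nbrs v (reverse lT))) ≡ net v
  net-loop v = cong₂ _∸_ (gross≡ v) (trans (sum-map-* 2 T1 (nbrs v (reverse lT))) (cong (2 *_) (sum-nbT T1 v)))

  gross≤ : ∀ v → gross v ≤ n * n + 3 * (n * (n * n))
  gross≤ v = ℕ.≤-trans (ℕ.≤-reflexive (gross≡ v)) (ℕ.+-mono-≤ (T1≤ v) (ℕ.*-monoʳ-≤ 3 (∑-bounded λ u →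
    ℕ.≤-trans (ℕ.*-mono-≤ (a≤1 v u) (T1≤ u)) (ℕ.≤-reflexive (ℕ.+-identityʳ (n * n))))))

  -- Justifies an output pass over the rows of A alone: the isolated vertices that it never meets
  -- have centrality 0.
  no-nbrs⇒net≡0 : ∀ v → nb v ≡ [] → net v ≡ 0
  no-nbrs⇒net≡0 v e = trans (cong (ℕ._∸ 2 ℕ.* S₂ v) (trans (sym (gross≡ v)) gross≡0)) (ℕ.0∸n≡0 (2 * S₂ v))
    where
    T1≡0 : T1 v ≡ 0
    T1≡0 = trans (∑-cong λ u → ℕ.*-comm (τ v u) (a v u)) (trans (sym (sum-nb (τ v) v)) (cong (sum ∘ map (τ v)) e))
    gross≡0 : gross v ≡ 0
    gross≡0 = cong₂ _+_ T1≡0 (cong (sum ∘ map (λ u → 3 * T1 u)) e)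

  net≤gross : ∀ v → net v ≤ gross v
  net≤gross v = ℕ.≤-trans (ℕ.m∸n≤m _ (2 * S₂ v)) (ℕ.≤-reflexive (sym (gross≡ v)))

  -- Of the 48 steps per entry, 6 belong to the loop and 42 to the weights. The 12 W are six steps
  -- per scanned cell, with each edge charged from both of its ends.
  visit-time : visitCost (reverse es) [] 0 ≤ length es * 48 + 12 * W + 1
  visit-time = begin
    visitCost (reverse es) [] 0
      ≡⟨ sym (ℕ.+-identityʳ _) ⟩
    visitCost (reverse es) [] 0 + 0
      ≤⟨ visitCost-bound (reverse es) [] 0 (λ p → 1≤dg (∈-reverse⁻ p)) ⟩
    length (reverse es) * 6 + sum (map weight D) + 1
      ≤⟨ ℕ.+-monoˡ-≤ 1 (ℕ.+-mono-≤ (ℕ.≤-reflexive (cong (_* 6) (L.length-reverse es))) weights) ⟩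
    length es * 6 + (length es * 42 + 6 * (2 * W)) + 1
      ≡⟨ solve (length es) W ⟩
    length es * 48 + 12 * W + 1 ∎
    where
    open ℕ.≤-Reasoning
    solve : ∀ e w → e * 6 + (e * 42 + 6 * (2 * w)) + 1 ≡ e * 48 + 12 * w + 1
    solve = solve-∀
    bit : ∀ {ℓ} {P : Set ℓ} (d : Dec P) k → 𝟙 d * k ≤ k
    bit (yes _) k = ℕ.≤-reflexive (ℕ.+-identityʳ k)
    bit (no _) k = z≤n
    split : ∀ l → sum (map (λ (i , j) → 42 + (dg j ⊓ dg i) * 6) l) ≡ length l * 42 + 6 * sum (map (λ (i , j) → dg j ⊓ dg i) l)
    split [] = refl
    split ((i , j) ∷ l) rewrite split l = solve′ (dg j ⊓ dg i) (length l) (sum (map (λ (i , j) → dg j ⊓ dg i) l))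
      where
      solve′ : ∀ x k s → 42 + x * 6 + (k * 42 + 6 * s) ≡ 42 + k * 42 + 6 * (x + s)
      solve′ = solve-∀
    weights : sum (map weight D) ≤ length es * 42 + 6 * (2 * W)
    weights = begin
      sum (map weight D)
        ≡⟨ sum-unique (_∈? D) weight D (collect-unique (const 1) (reverse es) [] []) (λ _ h → h) (λ _ h → h) ⟩
      ∑ (λ v → 𝟙 (v ∈? D) * weight v)
        -- Extending the sum to all vertices is harmless: the weight of an isolated vertex is an
        -- empty sum.
        ≤⟨ ∑-mono (λ v → bit (v ∈? D) (weight v)) ⟩
      ∑ (λ v → weight v)
        ≡⟨ ∑-nbrs (λ v u → 42 + (dg u ⊓ dg v) * 6) es ⟩
      sum (map (λ (i , j) → 42 + (dg j ⊓ dg i) * 6) es)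
        ≡⟨ split es ⟩
      length es * 42 + 6 * sum (map (λ (i , j) → dg j ⊓ dg i) es)
        ≡⟨ cong (λ s → length es * 42 + 6 * s) sum-min ⟩
      length es * 42 + 6 * (2 * W) ∎

-- Execution of the program on an input

module Execution {n} (G : Graph n) (0<△G : 0 < △G G) (σ₀ : State (2 + R) (3 + K)) (initial : Initial G σ₀)
  (X : ℕ) (n≤X : n ≤ X) (m≤X : m G ≤ X) (1≤X : 1 ≤ X) (L : Limits)
  (room : 4 * (X * (X * X)) < words L) (n≤cells : n ≤ cells L) (2m≤cells : 2 * m G ≤ cells L) where

  open Initial initial

  es : List (Fin n × Fin n)
  es = proj₁ input

  es-unique : Unique es
  es-unique = proj₁ (proj₂ input)

  es-mem : ∀ i j → (i , j) ∈ es ⇔ A G i j ≢ 0ℤ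
  es-mem = proj₁ (proj₂ (proj₂ input))

  open Counting G
  open Cast G
  open InputProperties G es es-unique es-mem
  open Search es τ

  X≤ : X ≤ X * (X * X)
  X≤ = ℕ.≤-trans (ℕ.≤-reflexive (sym (ℕ.*-identityʳ X))) (ℕ.*-monoʳ-≤ X (ℕ.*-mono-≤ 1≤X 1≤X))

  n²≤ : n * n ≤ X * (X * X)
  n²≤ = ℕ.*-mono-≤ n≤X (ℕ.≤-trans n≤X (ℕ.≤-trans (ℕ.≤-reflexive (sym (ℕ.*-identityʳ X))) (ℕ.*-monoʳ-≤ X 1≤X)))

  n³≤ : n * (n * n) ≤ X * (X * X)
  n³≤ = ℕ.*-mono-≤ n≤X (ℕ.*-mono-≤ n≤X n≤X)

  -- All values are at most X³ up to a factor `c`. The worst case is `gross`, at most n² + 3n³,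
  -- which accounts for the 4.
  fits : ∀ {k} c → c ≤ 4 → k ≤ c * (X * (X * X)) → k < words L
  fits c c≤4 k≤ = ℕ.≤-<-trans k≤ (ℕ.≤-<-trans (ℕ.*-monoˡ-≤ (X * (X * X)) c≤4) room)

  fits₁ : ∀ {k} → k ≤ X * (X * X) → k < words L
  fits₁ k≤ = fits 1 (s≤s z≤n) (ℕ.≤-trans k≤ (ℕ.≤-reflexive (sym (ℕ.*-identityˡ _))))

  n<words : n < words L
  n<words = fits₁ (ℕ.≤-trans n≤X X≤)

  es<words : length es < words L
  es<words = fits 2 (s≤s (s≤s z≤n)) (ℕ.≤-trans (ℕ.≤-reflexive length-es) (ℕ.*-monoʳ-≤ 2 (ℕ.≤-trans m≤X X≤)))

  es≤cells : length es ≤ cells L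
  es≤cells = ℕ.≤-trans (ℕ.≤-reflexive length-es) 2m≤cells

  3<words : 3 < words L
  3<words = fits 3 (ℕ.n≤1+n 3) (ℕ.*-monoʳ-≤ 3 (ℕ.≤-trans 1≤X X≤))

  τ<words : ∀ v u → τ v u < words L
  τ<words v u = fits₁ (ℕ.≤-trans (τ≤n v u) (ℕ.≤-trans n≤X X≤))

  T1<words : ∀ v → T1 v < words L
  T1<words v = fits₁ (ℕ.≤-trans (T1≤ v) n²≤)

  ∑T1<words : ∑ T1 < words L
  ∑T1<words = fits₁ (ℕ.≤-trans (∑-bounded T1≤) n³≤)

  2T1<words : ∀ v → 2 * T1 v < words L
  2T1<words v = fits 2 (s≤s (s≤s z≤n)) (ℕ.*-monoʳ-≤ 2 (ℕ.≤-trans (T1≤ v) n²≤))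

  gross<words : ∀ v → gross v < words L
  gross<words v = fits 4 ℕ.≤-refl (ℕ.≤-trans (gross≤ v) (ℕ.+-mono-≤ n²≤ (ℕ.*-monoʳ-≤ 3 n³≤)))

  open Logic {2 + R} {3 + K} L
  open Correctness es L (ℕ.<⇒≤ n<words) n≤cells es<words es≤cells 3<words
  open Visit es L (ℕ.<⇒≤ n<words) n≤cells es<words es≤cells 3<words τ τ<words τ-sym τ-count
  open Stages es L (ℕ.<⇒≤ n<words) n≤cells es<words es≤cells 3<words

  open Algorithm algorithm using (makeT; makeŤ; makeT𝟏; makeDenominator; makeNumerator; divide; atT; atŤ)

  -- The facts that hold once `makeT` is done and that no later stage disturbs; each later stage
  -- then has to establish only its own result.
  record Common (σ : State (2 + R) (3 + K)) : Set where
    field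
      nnz  : reg σ reg-nnz ≡ length es
      one  : reg σ reg-one ≡ 1
      zer  : reg σ reg-zero ≡ 0
      entry : ∀ p → let (i , j) = lookup es p in
        arr σ rows (toℕ p) ≡ toℕ i × arr σ cols (toℕ p) ≡ toℕ j × ℤ.+ arr σ vals (toℕ p) ≡ A G i j
      entriesT : EmittedAt σ lT

    storedA : StoresMatrix σ inputMatrix (A G)
    storedA = es , es-unique , es-mem , nnz , entry

    rows-stored : Stored (arr σ rows) row (reverse es)
    rows-stored = lookup⇒stored es (proj₁ ∘ entry)

    cols-stored : Stored (arr σ cols) col (reverse es)
    cols-stored = lookup⇒stored es (proj₁ ∘ proj₂ ∘ entry)

    nnz′ : reg σ reg-nnz ≡ length (reverse es)
    nnz′ = trans nnz (sym (L.length-reverse es))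

    lenT : reg σ reg-k ≡ length lT
    lenT = Emitted.len entriesT

    lenT′ : reg σ reg-k ≡ length (reverse lT)
    lenT′ = trans lenT (sym (L.length-reverse lT))

    lookupT : ∀ p → let (i , j) = lookup (reverse lT) p in arr σ rowsT (toℕ p) ≡ toℕ i × arr σ colsT (toℕ p) ≡ toℕ j
    lookupT p = stored⇒lookup lT (Emitted.storedI entriesT) p , stored⇒lookup lT (Emitted.storedJ entriesT) p

    storedT : StoresMatrix σ atT (T G)
    storedT = reverse lT , unique-reverse lT-unique , mem , lenT′ , λ p →
      let r , c = lookupT p in r , c , trans (cong ℤ.+_ (stored⇒lookup lT (Emitted.storedX entriesT) p)) (val p)
      where
      mem : ∀ i j → (i , j) ∈ reverse lT ⇔ T G i j ≢ 0ℤ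
      mem i j = mk⇔ (t≢0⇒T≢0 ∘ lT⁻ i j ∘ ∈-reverse⁻) (∈-reverse⁺ ∘ lT⁺ i j ∘ T≢0⇒t≢0)
      val : ∀ p → let (i , j) = lookup (reverse lT) p in ℤ.+ τ i j ≡ T G i j
      val p = let (i , j) = lookup (reverse lT) p in
        trans (cong ℤ.+_ (sym (~⇒t≡τ (t≢0⇒~ (lT⁻ i j (∈-reverse⁻ (∈-lookup p))))))) (sym (T≡ i j))

  common-kept : ∀ {c σ σ′} → Frame c σ σ′ →
    writesReg c reg-nnz ≡ false → writesReg c reg-one ≡ false → writesReg c reg-zero ≡ false → writesReg c reg-k ≡ false →
    writesArr c rows ≡ false → writesArr c cols ≡ false → writesArr c vals ≡ false →
    writesArr c rowsT ≡ false → writesArr c colsT ≡ false → writesArr c valsT ≡ false →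
    Common σ → Common σ′
  common-kept fr w₁ w₂ w₃ w₄ w₅ w₆ w₇ w₈ w₉ w₀ cm = record
    { nnz = trans (Frame.reg≡ fr reg-nnz w₁) nnz
    ; one = trans (Frame.reg≡ fr reg-one w₂) one
    ; zer = trans (Frame.reg≡ fr reg-zero w₃) zer
    ; entry = λ p → let r , c , v = entry p in
        trans (cong (_$ toℕ p) (Frame.arr≡ fr rows w₅)) r , trans (cong (_$ toℕ p) (Frame.arr≡ fr cols w₆)) c ,
        trans (cong (λ f → ℤ.+ f (toℕ p)) (Frame.arr≡ fr vals w₇)) v
    ; entriesT = emitted-kept fr w₈ w₉ w₀ w₄ entriesT
    }
    where open Common cm

  private variable
    σ : State (2 + R) (3 + K)

  abstract
    -- Abstract, so that later stages never unfold the run. Linking goes from the last entry to the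
    -- first and prepends, so the lists end up in the order of `es`; this is where
    -- `reverse-involutive` enters.
    runs-T : Runs makeT σ₀ (2 + (length (reverse es) * 10 + suc (1 + visitCost (reverse es) [] 0))) (λ _ σ → Frame makeT σ₀ σ → Common σ)
    runs-T =
      seq $ lit-rule (ℕ.<-trans (s≤s (s≤s z≤n)) 3<words) $
      framed $ seq $ seq $ op-rule nnz (zeroRegs (F.# 1)) (ℕ.+-identityʳ _) es<words $
      framed $ link-correct (reverse es) [] _ refl (zeroRegs (F.# 1)) (sym len) (trans (ℕ.+-identityʳ _) len)
        (lookup⇒stored es (proj₁ ∘ entry)) (lookup⇒stored es (proj₁ ∘ proj₂ ∘ entry))
        (λ v → subst (λ q → Chain (arr σ₀ cols) (arr σ₀ next) (length (reverse es)) (length es) q []) (sym (zeroArrs (F.# 0) (toℕ v))) []) (λ v → zeroArrs (F.# 2) (toℕ v)) λ σ₁ chains degs fr →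
      let one₁ = Frame.reg≡ fr reg-one refl
          fresh = λ a w i → trans (cong (_$ i) (Frame.arr≡ fr (suc (suc (suc a))) w)) (zeroArrs a i)
      in
      seq $ op-rule (trans (Frame.reg≡ fr reg-nnz refl) nnz) (trans (Frame.reg≡ fr reg-zero refl) (zeroRegs (F.# 1))) (ℕ.+-identityʳ _) es<words $
      visit-correct (reverse es) [] _ one₁ (sym len) (ℕ.≤-reflexive len)
        (subst (λ f → Stored f row (reverse es)) (sym (Frame.arr≡ fr rows refl)) (lookup⇒stored es (proj₁ ∘ entry)))
        (linked (λ v → subst₂ (λ C l → Chain C (arr σ₁ next) 0 (length es) (arr σ₁ head (toℕ v)) (nbrs v l)) (sym (Frame.arr≡ fr cols refl)) (L.reverse-involutive es) (chains v))
                (λ v → trans (degs v) (cong (length ∘ nbrs v) (L.reverse-involutive es))))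
        (λ v → fresh (F.# 4) refl (toℕ v)) (λ v → fresh (F.# 3) refl (toℕ v))
        (emitted tt tt tt (trans (Frame.reg≡ fr reg-k refl) (zeroRegs (F.# 12)))) length-lT λ σ₂ em fr″ fr′ →
      record
        { nnz = trans (Frame.reg≡ fr′ reg-nnz refl) nnz
        ; one = Frame.reg≡ fr″ reg-one refl
        ; zer = trans (Frame.reg≡ fr′ reg-zero refl) (zeroRegs (F.# 1))
        ; entry = λ p → let r , c , v = entry p in
            trans (cong (_$ toℕ p) (Frame.arr≡ fr′ rows refl)) r , trans (cong (_$ toℕ p) (Frame.arr≡ fr′ cols refl)) c ,
            trans (cong (λ f → ℤ.+ f (toℕ p)) (Frame.arr≡ fr′ vals refl)) v
        ; entriesT = em
        }
      where
      nnz : reg σ₀ reg-nnz ≡ length es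
      nnz = proj₁ (proj₂ (proj₂ (proj₂ input)))
      entry : ∀ p → let (i , j) = lookup es p in
        arr σ₀ rows (toℕ p) ≡ toℕ i × arr σ₀ cols (toℕ p) ≡ toℕ j × ℤ.+ arr σ₀ vals (toℕ p) ≡ A G i j
      entry = proj₂ (proj₂ (proj₂ (proj₂ input)))
      len : length (reverse es) ≡ length es
      len = L.length-reverse es

  abstract
    runs-Ť : Common σ → Runs makeŤ σ (1 + (length lT * 3 + 1)) (λ _ σ′ → ∀ j → j < length lT → arr σ′ ones j ≡ 1)
    runs-Ť {σ} cm =
      seq $ op-rule lenT zer (ℕ.+-identityʳ _) (small length-lT) $
      fillOnes-correct (length lT) (length lT) _ one refl ℕ.≤-refl length-lT
        (λ j k≤ j< → ⊥-elim (ℕ.<⇒≱ j< k≤)) λ σ′ h → h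
      where open Common cm

  storedŤ : Common σ → (∀ j → j < length lT → arr σ ones j ≡ 1) → StoresMatrix σ atŤ (Ť G)
  storedŤ {σ} cm h = reverse lT , unique-reverse lT-unique , mem , lenT′ , λ p →
    let r , c = lookupT p in r , c , val p
    where
    open Common cm
    Ť≡1 : ∀ i j → t i j ≢ 0 → Ť G i j ≡ ℤ.+ 1
    Ť≡1 i j t≢ = trans (Ť≡ i j) (cong ℤ.+_ (𝟙-yes (support i j) t≢))
    mem : ∀ i j → (i , j) ∈ reverse lT ⇔ Ť G i j ≢ 0ℤ
    mem i j = mk⇔ to from
      where
      to : (i , j) ∈ reverse lT → Ť G i j ≢ 0ℤ
      to p Ť≡0 with trans (sym (Ť≡1 i j (lT⁻ i j (∈-reverse⁻ p)))) Ť≡0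
      ... | ()
      from : Ť G i j ≢ 0ℤ → (i , j) ∈ reverse lT
      from Ť≢0 = ∈-reverse⁺ (lT⁺ i j λ t≡0 → Ť≢0 (trans (Ť≡ i j) (cong ℤ.+_ (𝟙-no (support i j) λ t≢ → t≢ t≡0))))
    val : ∀ p → let (i , j) = lookup (reverse lT) p in ℤ.+ arr σ ones (toℕ p) ≡ Ť G i j
    val p = let (i , j) = lookup (reverse lT) p in
      trans (cong ℤ.+_ (h (toℕ p) (subst (toℕ p <_) (L.length-reverse lT) (F.toℕ<n p))))
        (sym (Ť≡1 i j (lT⁻ i j (∈-reverse⁻ (∈-lookup p)))))

  abstract
    runs-T𝟏 : Common σ → arr σ arrT1 holds zeros → Runs makeT𝟏 σ (1 + (length lT * 7 + 1)) (λ _ σ′ → arr σ′ arrT1 holds T1)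
    runs-T𝟏 {σ} cm z =
      seq $ op-rule lenT zer (ℕ.+-identityʳ _) (small length-lT) $
      sumRow-correct τ lT [] _ one refl length-lT (Emitted.storedI entriesT) (Emitted.storedX entriesT) z
        (λ v → subst (_< words L) (sym (sum-τ v)) (T1<words v)) λ σ′ h v → trans (h v) (sum-τ v)
      where open Common cm

  abstract
    runs-denominator : Common σ → reg σ reg-den ≡ 0 → Runs makeDenominator σ (1 + (length lT * 4 + 1)) (λ _ σ′ → reg σ′ reg-den ≡ ∑ T1)
    runs-denominator {σ} cm z =
      seq $ op-rule lenT zer (ℕ.+-identityʳ _) (small length-lT) $
      sumAll-correct (λ (i , j) → τ i j) lT [] _ one refl length-lT (Emitted.storedX entriesT) z
        (subst (_< words L) (sym sum-all-τ) ∑T1<words) λ σ′ h → trans h sum-all-τ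
      where open Common cm

  abstract
    runs-numerator : Common σ → arr σ arrT1 holds T1 → arr σ num holds zeros →
      Runs makeNumerator σ (3 + (length lT * 5 + suc (1 + (length (reverse es) * 9 + suc (1 + (length lT * 9 + 1))))))
        (λ _ σ′ → arr σ′ num holds net)
    runs-numerator {σ} cm t1 z =
      seq $ lit-rule (ℕ.<-trans (s≤s (s≤s (s≤s z≤n))) 3<words) $
      seq $ lit-rule 3<words $
      seq $ seq $ op-rule lenT zer (ℕ.+-identityʳ _) (small length-lT) $
      framed $ copyRow-correct T1 zeros lT _ one refl length-lT (Emitted.storedI entriesT) t1 T1<words z λ σ₁ h₁ fr₁ →
      -- The record is rebuilt because `Common` is indexed by the state; its fields fit the new
      -- state by computation, as the registers just assigned do not occur in it.
      let cm₁ = common-kept fr₁ refl refl refl refl refl refl refl refl refl refl (record { Common cm })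
          t1₁ = subst (_holds T1) (sym (Frame.arr≡ fr₁ arrT1 refl)) t1
          two₁ = Frame.reg≡ fr₁ reg-two refl
          three₁ = Frame.reg≡ fr₁ reg-three refl
      in
      seq $ seq $ op-rule (Common.nnz′ cm₁) (Common.zer cm₁) (ℕ.+-identityʳ _) (small (ℕ.≤-reflexive len)) $
      framed $ addRow-correct T1 T1 (reverse es) [] _ (Common.one cm₁) three₁ refl (ℕ.≤-reflexive len)
        (Common.rows-stored cm₁) (Common.cols-stored cm₁) t1₁
        (λ v → trans (h₁ v) (trans (copied-T1 v) (sym (ℕ.+-identityʳ _))))
        (λ v → subst (_< words L) (sym (gross-loop v)) (gross<words v)) λ σ₂ h₂ fr₂ →
      let cm₂ = common-kept fr₂ refl refl refl refl refl refl refl refl refl refl (record { Common cm₁ })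
          t1₂ = subst (_holds T1) (sym (Frame.arr≡ fr₂ arrT1 refl)) t1₁
      in
      seq $ op-rule (Common.lenT cm₂) (Common.zer cm₂) (ℕ.+-identityʳ _) (small length-lT) $
      subtractRow-correct T1 gross lT [] _ (Common.one cm₂) (trans (Frame.reg≡ fr₂ reg-two refl) two₁) refl length-lT
        (Emitted.storedI (Common.entriesT cm₂)) (Emitted.storedJ (Common.entriesT cm₂)) t1₂
        (λ v → trans (h₂ v) (gross-loop v)) 2T1<words gross<words λ σ₃ h₃ v → trans (h₃ v) (net-loop v)
      where
      open Common cm
      len : length (reverse es) ≡ length es
      len = L.length-reverse es
      gross-loop : ∀ v → T1 v + sum (map (λ u → 3 * T1 u) (nbrs v (reverse es ʳ++ []))) ≡ gross v
      gross-loop v = cong (λ l → T1 v + sum (map (λ u → 3 * T1 u) (nbrs v l))) (L.reverse-involutive es)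

  outputOrder : List (Fin n)
  outputOrder = collect net (reverse es) []

  outputOrder-unique : Unique outputOrder
  outputOrder-unique = collect-unique net (reverse es) [] []

  abstract
    runs-divide : Common σ → arr σ num holds net → reg σ reg-den ≡ ∑ T1 → reg σ reg-out ≡ 0 →
      Runs divide σ (1 + (length (reverse es) * 10 + 1)) (λ _ σ′ → OutputAt net (∑ T1) σ′ outputOrder)
    runs-divide {σ} cm h den out≡ =
      seq $ op-rule nnz′ zer (ℕ.+-identityʳ _) (small (ℕ.≤-reflexive len)) $
      output-correct net (∑ T1) (reverse es) [] _ one zer den refl (ℕ.≤-reflexive len) rows-stored h
        (λ v → ℕ.≤-<-trans (net≤gross v) (gross<words v)) (outputs tt tt tt out≡)
        (ℕ.≤-trans short n≤cells) (ℕ.≤-<-trans short n<words) λ σ′ out → out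
      where
      open Common cm
      len : length (reverse es) ≡ length es
      len = L.length-reverse es
      short : length outputOrder ≤ n
      short = length-unique outputOrder outputOrder-unique

  TC≡ : ∀ v → fromℕ (net v) ÷ ∑ T1 ≡ TC G v
  TC≡ v = trans (cong₂ (λ k d → fromℕ k ÷ d) (net≡2* v) ∑T1≡6△G)
    (centrality-fraction (sum (map (△ G) (N△[_] G v))) (sum (map (△ G) (N∖N△ G v))) (△G G))

  0<∑T1 : 0 < ∑ T1
  0<∑T1 = subst (0 <_) (sym ∑T1≡6△G) (ℕ.≤-trans 0<△G (ℕ.m≤n*m (△G G) 6))

  storedTC : OutputAt net (∑ T1) σ outputOrder → StoresFractions σ (Algorithm.atOutput algorithm) (TC G)
  storedTC {σ} out = reverse outputOrder , unique-reverse outputOrder-unique , mem ,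
    trans len (sym (L.length-reverse outputOrder)) , λ p →
      let den = stored⇒lookup outputOrder storedD p in
      stored⇒lookup outputOrder storedI p ,
      (λ z → ℕ.<⇒≢ 0<∑T1 (trans (sym z) den)) ,
      trans (cong₂ (λ k d → fromℕ k ÷ d) (stored⇒lookup outputOrder storedN p) den) (TC≡ (lookup (reverse outputOrder) p))
    where
    open Output out
    net≢0⇒TC≢0 : ∀ v → net v ≢ 0 → TC G v ≢ 0ℚ
    net≢0⇒TC≢0 v net≢ TC≡0 = net≢ (÷-≡0 (net v) (∑ T1) 0<∑T1 (trans (TC≡ v) TC≡0))
    TC≢0⇒net≢0 : ∀ v → TC G v ≢ 0ℚ → net v ≢ 0
    TC≢0⇒net≢0 v TC≢ net≡0 = TC≢ (trans (sym (TC≡ v)) (trans (cong (λ k → fromℕ k ÷ ∑ T1) net≡0) (0÷ (∑ T1))))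
    to : ∀ v → v ∈ outputOrder → net v ≢ 0
    to v v∈ with collect-∈⁻ net (reverse es) [] v∈
    ... | inj₂ h = h
    from : ∀ v → net v ≢ 0 → v ∈ outputOrder
    from v net≢ = go (nb v) refl
      where
      go : ∀ us → nb v ≡ us → v ∈ outputOrder
      go [] e = ⊥-elim (net≢ (no-nbrs⇒net≡0 v e))
      go (u ∷ us) e = collect-∈⁺ net (reverse es) [] (∈-reverse⁺ (∈-nbrs⁻ es (subst (u ∈_) (sym e) (here refl)))) net≢
    mem : ∀ v → v ∈ reverse outputOrder ⇔ TC G v ≢ 0ℚ
    mem v = mk⇔ (net≢0⇒TC≢0 v ∘ to v ∘ ∈-reverse⁻) (∈-reverse⁺ ∘ from v ∘ TC≢0⇒net≢0 v)

  -- A positive total of T needs an entry of T, and T has no more entries than A. Through `1≤W` this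
  -- absorbs the additive constants of the running time.
  1≤es : 1 ≤ length es
  1≤es = ℕ.≤-trans (nonempty (reverse lT) (subst (0 <_) (sym sum-all-τ) 0<∑T1))
    (ℕ.≤-trans (ℕ.≤-reflexive (L.length-reverse lT)) length-lT)
    where
    nonempty : ∀ l → 0 < sum (map (λ (i , j) → τ i j) l) → 1 ≤ length l
    nonempty (_ ∷ _) _ = s≤s z≤n

  1≤W : 1 ≤ W
  1≤W = half (ℕ.≤-trans 1≤es es≤2W)
    where
    half : ∀ {k} → 1 ≤ 2 * k → 1 ≤ k
    half {suc k} _ = s≤s z≤n

  module Stage₁ = Runs runs-T

  common₁ : Common Stage₁.σ′
  common₁ = Stage₁.post (frame (regs-kept Stage₁.run) (arrs-kept Stage₁.run))

  module Stage₂ = Runs (runs-Ť common₁)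

  frame₂ : Frame makeŤ Stage₁.σ′ Stage₂.σ′
  frame₂ = frame (regs-kept Stage₂.run) (arrs-kept Stage₂.run)

  common₂ : Common Stage₂.σ′
  common₂ = common-kept frame₂ refl refl refl refl refl refl refl refl refl refl common₁

  module Stage₃ = Runs (runs-T𝟏 common₂ λ v → trans (cong (_$ toℕ v)
    (trans (Frame.arr≡ frame₂ arrT1 refl) (arrs-kept Stage₁.run arrT1 refl))) (zeroArrs (F.# 9) (toℕ v)))

  frame₃ : Frame makeT𝟏 Stage₂.σ′ Stage₃.σ′
  frame₃ = frame (regs-kept Stage₃.run) (arrs-kept Stage₃.run)

  common₃ : Common Stage₃.σ′
  common₃ = common-kept frame₃ refl refl refl refl refl refl refl refl refl refl common₂

  module Stage₄ = Runs (runs-denominator common₃ (trans (Frame.reg≡ frame₃ reg-den refl)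
    (trans (Frame.reg≡ frame₂ reg-den refl) (trans (regs-kept Stage₁.run reg-den refl) (zeroRegs (F.# 13))))))

  frame₄ : Frame makeDenominator Stage₃.σ′ Stage₄.σ′
  frame₄ = frame (regs-kept Stage₄.run) (arrs-kept Stage₄.run)

  common₄ : Common Stage₄.σ′
  common₄ = common-kept frame₄ refl refl refl refl refl refl refl refl refl refl common₃

  T1₄ : arr Stage₄.σ′ arrT1 holds T1
  T1₄ v = trans (cong (_$ toℕ v) (Frame.arr≡ frame₄ arrT1 refl)) (Stage₃.post v)

  module Stage₅ = Runs (runs-numerator common₄ T1₄ λ v → trans (cong (_$ toℕ v) (trans (Frame.arr≡ frame₄ num refl)
    (trans (Frame.arr≡ frame₃ num refl) (trans (Frame.arr≡ frame₂ num refl) (arrs-kept Stage₁.run num refl))))) (zeroArrs (F.# 10) (toℕ v)))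

  frame₅ : Frame makeNumerator Stage₄.σ′ Stage₅.σ′
  frame₅ = frame (regs-kept Stage₅.run) (arrs-kept Stage₅.run)

  common₅ : Common Stage₅.σ′
  common₅ = common-kept frame₅ refl refl refl refl refl refl refl refl refl refl common₄

  module Stage₆ = Runs (runs-divide common₅ Stage₅.post (trans (Frame.reg≡ frame₅ reg-den refl) Stage₄.post)
    (trans (Frame.reg≡ frame₅ reg-out refl) (trans (Frame.reg≡ frame₄ reg-out refl) (trans (Frame.reg≡ frame₃ reg-out refl)
    (trans (Frame.reg≡ frame₂ reg-out refl) (trans (regs-kept Stage₁.run reg-out refl) (zeroRegs (F.# 16))))))))

  ones-kept : ∀ {c σ σ′} → Frame c σ σ′ → writesArr c ones ≡ false → (∀ j → j < length lT → arr σ ones j ≡ 1) →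
    ∀ j → j < length lT → arr σ′ ones j ≡ 1
  ones-kept fr w h j j< = trans (cong (_$ j) (Frame.arr≡ fr ones w)) (h j j<)

  ones₃ : ∀ j → j < length lT → arr Stage₃.σ′ ones j ≡ 1
  ones₃ = ones-kept frame₃ refl Stage₂.post

  evaluation : Evaluation L algorithm G σ₀
  evaluation = record
    { matrixFits     = 2m≤cells
    ; vectorFits     = n≤cells
    ; runT           = Stage₁.run
    ; A₁             = Common.storedA common₁
    ; T₁             = Common.storedT common₁
    ; runŤ           = Stage₂.run
    ; A₂             = Common.storedA common₂
    ; T₂             = Common.storedT common₂
    ; Ť₂             = storedŤ common₂ Stage₂.post
    ; runT𝟏          = Stage₃.run
    ; A₃             = Common.storedA common₃
    ; Ť₃             = storedŤ common₃ ones₃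
    ; T𝟏₃            = λ v → trans (cong ℤ.+_ (Stage₃.post v)) (sym (T𝟏≡ v))
    ; runDenominator = Stage₄.run
    ; A₄             = Common.storedA common₄
    ; Ť₄             = storedŤ common₄ (ones-kept frame₄ refl ones₃)
    ; T𝟏₄            = λ v → trans (cong ℤ.+_ (T1₄ v)) (sym (T𝟏≡ v))
    ; denominator₄   = trans (cong ℤ.+_ Stage₄.post) (sym denominator≡)
    ; runNumerator   = Stage₅.run
    ; denominator₅   = trans (cong ℤ.+_ (trans (Frame.reg≡ frame₅ reg-den refl) Stage₄.post)) (sym denominator≡)
    ; numerator₅     = λ v → trans (cong ℤ.+_ (Stage₅.post v)) (sym (numerator≡net v))
    ; runDivide      = Stage₆.run
    }

  time-bound : Evaluation.time evaluation ≤ 300 * W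
  time-bound = begin
    Stage₁.t + (Stage₂.t + (Stage₃.t + (Stage₄.t + (Stage₅.t + Stage₆.t))))
      ≤⟨ ℕ.+-mono-≤ b₁ (ℕ.+-mono-≤ b₂ (ℕ.+-mono-≤ b₃ (ℕ.+-mono-≤ b₄ (ℕ.+-mono-≤ b₅ b₆)))) ⟩
    2 + (e * 10 + suc (1 + (e * 48 + 12 * W + 1))) + (1 + (e * 3 + 1) + (1 + (e * 7 + 1) + (1 + (e * 4 + 1) +
      (3 + (e * 5 + suc (1 + (e * 9 + suc (1 + (e * 9 + 1))))) + (1 + (e * 10 + 1))))))
      ≡⟨ collected e W ⟩
    e * 105 + 12 * W + 21 * 1
      -- All passes together take 105 steps per entry besides the scans, and 21 steps once; `es≤2W`
      -- and `1≤W` turn both into multiples of W.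
      ≤⟨ ℕ.+-mono-≤ (ℕ.+-monoˡ-≤ (12 * W) (ℕ.*-monoˡ-≤ 105 es≤2W)) (ℕ.*-monoʳ-≤ 21 1≤W) ⟩
    2 * W * 105 + 12 * W + 21 * W
      ≡⟨ total W ⟩
    243 * W
      ≤⟨ ℕ.*-monoˡ-≤ W (ℕ.m≤m+n 243 57) ⟩
    300 * W ∎
    where
    open ℕ.≤-Reasoning
    e = length es
    collected : ∀ e w → 2 + (e * 10 + suc (1 + (e * 48 + 12 * w + 1))) + (1 + (e * 3 + 1) + (1 + (e * 7 + 1) + (1 + (e * 4 + 1) +
      (3 + (e * 5 + suc (1 + (e * 9 + suc (1 + (e * 9 + 1))))) + (1 + (e * 10 + 1)))))) ≡ e * 105 + 12 * w + 21 * 1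
    collected = solve-∀
    total : ∀ w → 2 * w * 105 + 12 * w + 21 * w ≡ 243 * w
    total = solve-∀
    spent : ∀ {t r b} → t + r ≤ b → t ≤ b
    spent = ℕ.≤-trans (ℕ.m≤m+n _ _)
    es-len : ∀ k → length (reverse es) * k ≤ e * k
    es-len k = ℕ.*-monoˡ-≤ k (ℕ.≤-reflexive (L.length-reverse es))
    lT-len : ∀ k → length lT * k ≤ e * k
    lT-len k = ℕ.*-monoˡ-≤ k length-lT
    b₁ : Stage₁.t ≤ 2 + (e * 10 + suc (1 + (e * 48 + 12 * W + 1)))
    b₁ = ℕ.≤-trans (spent Stage₁.time) (ℕ.+-monoʳ-≤ 2 (ℕ.+-mono-≤ (es-len 10) (ℕ.+-monoʳ-≤ 2 visit-time)))
    b₂ : Stage₂.t ≤ 1 + (e * 3 + 1)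
    b₂ = ℕ.≤-trans (spent Stage₂.time) (ℕ.+-monoʳ-≤ 1 (ℕ.+-monoˡ-≤ 1 (lT-len 3)))
    b₃ : Stage₃.t ≤ 1 + (e * 7 + 1)
    b₃ = ℕ.≤-trans (spent Stage₃.time) (ℕ.+-monoʳ-≤ 1 (ℕ.+-monoˡ-≤ 1 (lT-len 7)))
    b₄ : Stage₄.t ≤ 1 + (e * 4 + 1)
    b₄ = ℕ.≤-trans (spent Stage₄.time) (ℕ.+-monoʳ-≤ 1 (ℕ.+-monoˡ-≤ 1 (lT-len 4)))
    b₅ : Stage₅.t ≤ 3 + (e * 5 + suc (1 + (e * 9 + suc (1 + (e * 9 + 1)))))
    b₅ = ℕ.≤-trans (spent Stage₅.time) (ℕ.+-monoʳ-≤ 3 (ℕ.+-mono-≤ (lT-len 5) (ℕ.+-monoʳ-≤ 2 (ℕ.+-mono-≤ (es-len 9)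
      (ℕ.+-monoʳ-≤ 2 (ℕ.+-monoˡ-≤ 1 (lT-len 9)))))))
    b₆ : Stage₆.t ≤ 1 + (e * 10 + 1)
    b₆ = ℕ.≤-trans (spent Stage₆.time) (ℕ.+-monoʳ-≤ 1 (ℕ.+-monoˡ-≤ 1 (es-len 10)))

-- Choice of constants and conclusion

∈⇒1≤length : ∀ {ℓ} {B : Set ℓ} {x : B} {xs} → x ∈ xs → 1 ≤ length xs
∈⇒1≤length (here _) = s≤s z≤n
∈⇒1≤length (there _) = s≤s z≤n

triangle⇒edge : ∀ {n} (G : Graph n) → 0 < △G G → 1 ≤ n × 1 ≤ m G
triangle⇒edge {n} G 0<△ = go (triangles G) refl 0<△
  where
  open Graph G
  V : List (Fin n)
  V = allFin n
  positive : ∀ {n} → Fin n → 1 ≤ n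
  positive zero = s≤s z≤n
  positive (suc _) = s≤s z≤n
  go : ∀ ts → triangles G ≡ ts → 0 < length ts → 1 ≤ n × 1 ≤ m G
  go ((u , v , w) ∷ ts) e _ with ∈-filter⁻ (λ (u , v , w) → (u F.<? v) ×-dec (v F.<? w) ×-dec (u ~? v) ×-dec (v ~? w) ×-dec (u ~? w))
    {xs = cartesianProduct V (cartesianProduct V V)} (subst ((u , v , w) ∈_) (sym e) (here refl))
  ... | _ , u<v , _ , u~v , _ = positive u , ∈⇒1≤length
    (∈-filter⁺ (λ (u , v) → (u F.<? v) ×-dec (u ~? v)) (∈-cartesianProduct⁺ (∈-allFin u) (∈-allFin v)) (u<v , u~v))

-- Since X ≥ 2, the factor 4 is at most X², which leaves a fifth power below a sixth.
cube<power : ∀ {X} c → 2 ≤ X → 6 ≤ c → 4 * (X * (X * X)) < X ^ c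
cube<power {X@(suc _)} c 2≤X 6≤c = begin-strict
  4 * (X * (X * X))         ≤⟨ ℕ.*-monoˡ-≤ (X * (X * X)) (ℕ.*-mono-≤ 2≤X 2≤X) ⟩
  X * X * (X * (X * X))     ≡⟨ solve X ⟩
  X ^ 5                     <⟨ ℕ.^-monoʳ-< X 2≤X (ℕ.n<1+n 5) ⟩
  X ^ 6                     ≤⟨ ℕ.^-monoʳ-≤ X 6≤c ⟩
  X ^ c                     ∎
  where
  open ℕ.≤-Reasoning
  solve : ∀ x → x * x * (x * (x * x)) ≡ x * (x * (x * (x * (x * 1))))
  solve = solve-∀

m*δ̄ : ∀ {n} (G : Graph n) → 1 ≤ m G → fromℕ (m G) ℚ.* δ̄ G ≡ fromℕ (minDegreeSum G)
m*δ̄ G = *-÷ (m G) (fromℕ (minDegreeSum G))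

-- There are 19 registers and 17 arrays, and 53 = 19 + 2 · 17.
space-bound : ∀ k n → 1 ≤ k + n → Algorithm.space algorithm (2 * k + n) ≤ 300 * (k + n)
space-bound k n 1≤ = begin
  19 + 17 * (2 * k + n)              ≤⟨ ℕ.+-mono-≤ (ℕ.*-monoʳ-≤ 19 1≤) (ℕ.*-monoʳ-≤ 17 (ℕ.+-monoʳ-≤ (2 * k) (ℕ.m≤n*m n 2))) ⟩
  19 * (k + n) + 17 * (2 * k + 2 * n) ≡⟨ solve k n ⟩
  53 * (k + n)                       ≤⟨ ℕ.*-monoˡ-≤ (k + n) (ℕ.m≤m+n 53 247) ⟩
  300 * (k + n)                      ∎
  where
  open ℕ.≤-Reasoning
  solve : ∀ k n → 19 * (k + n) + 17 * (2 * k + 2 * n) ≡ 53 * (k + n)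
  solve = solve-∀

theorem2 : Σ[ alg ∈ Algorithm ] ∃[ c ]
    ∀ {n} (G : Graph n) → 0 < △G G →
    ∀ σ₀ → Initial G σ₀ →
    ∃[ s ] Algorithm.space alg s ≤ c * (m G + n) ×
    Σ[ ev ∈ Evaluation (limits ((m G + n) ^ c) s) alg G σ₀ ]
    StoresFractions (Evaluation.final ev) (Algorithm.atOutput alg) (TC G) ×
    fromℕ (Evaluation.time ev) ℚ.≤ fromℕ c ℚ.* (fromℕ (m G) ℚ.* δ̄ G)
-- One constant bounds time and space and is the exponent of the word limit; it exceeds the 243, 53
-- and 6 that these three call for.
theorem2 = algorithm , 300 , solution
  where
  solution : ∀ {n} (G : Graph n) → 0 < △G G → ∀ σ₀ → Initial G σ₀ →
    ∃[ s ] Algorithm.space algorithm s ≤ 300 * (m G + n) ×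
    Σ[ ev ∈ Evaluation (limits ((m G + n) ^ 300) s) algorithm G σ₀ ]
    StoresFractions (Evaluation.final ev) (Algorithm.atOutput algorithm) (TC G) ×
    fromℕ (Evaluation.time ev) ℚ.≤ fromℕ 300 ℚ.* (fromℕ (m G) ℚ.* δ̄ G)
  -- All arrays have the same number of cells, so 2m + n leaves room both for the entries of a
  -- matrix and for a vector.
  solution {n} G 0<△ σ₀ initial = 2 * m G + n , space-bound (m G) n 1≤X , evaluation , storedTC {σ = Stage₆.σ′} Stage₆.post , time
    where
    1≤n : 1 ≤ n
    1≤n = proj₁ (triangle⇒edge G 0<△)
    1≤m : 1 ≤ m G
    1≤m = proj₂ (triangle⇒edge G 0<△)
    1≤X : 1 ≤ m G + n
    1≤X = ℕ.≤-trans 1≤n (ℕ.m≤n+m n (m G))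
    open Execution G 0<△ σ₀ initial (m G + n) (ℕ.m≤n+m n (m G)) (ℕ.m≤m+n (m G) n) 1≤X
      (limits ((m G + n) ^ 300) (2 * m G + n)) (cube<power 300 (ℕ.+-mono-≤ 1≤m 1≤n) (ℕ.m≤m+n 6 294))
      (ℕ.m≤n+m n (2 * m G)) (ℕ.m≤m+n (2 * m G) n)
    time : fromℕ (Evaluation.time evaluation) ℚ.≤ fromℕ 300 ℚ.* (fromℕ (m G) ℚ.* δ̄ G)
    time = ℚ.≤-trans (fromℕ-mono time-bound)
      (ℚ.≤-reflexive (sym (trans (cong (fromℕ 300 ℚ.*_) (m*δ̄ G 1≤m)) (fromℕ-* 300 (minDegreeSum G)))))
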